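{- The Presburger liveness problem for discrete pushdown timed automata with reversal-bounded counters is decidable: given such an automaton $\mathcal{A}$ and two Presburger sets $I$ and $P$ of configurations of $\mathcal{A}$, it is decidable whether there is an infinite execution $c^0,c^1,\dots$ of $\mathcal{A}$ with $c^0\in I$ and $c^k\in P$ for infinitely many $k$.
   Context: A discrete timed automaton is a finite-state machine $\langle S,\{x_1,\dots,x_m\},\mathcal{C},Inv,R,C\rangle$ with integer-valued clocks $x_1,\dots,x_m$, clock constraints $\mathcal{C}$ (Boolean combinations of $x_i-x_j\sim d$, $x_i\sim d$ with $d\in\mathbb{Z}$, $\sim\in\{<,>,\le,\ge,=\}$), state invariants $Inv:S\to\mathcal{C}$, reset sets $R:S\times S\to 2^{\{x_1,\dots,x_m\}}$ and reset conditions $C:S\times S\to\mathcal{C}$; a progress transition increases all clocks by the same positive integer amount at the same state while the invariant holds throughout, and a reset transition from $s_1$ to $s_2$ requires $Inv(s_1)$ and $C(s_1,s_2)$, resets the clocks in $R(s_1,s_2)$ to $0$, keeps the others, and requires $Inv(s_2)$ afterwards. A discrete pushdown timed automaton with reversal-bounded counters additionally has finitely many counters (integer variables that can be tested against $0$, incremented or decremented by $1$, or left unchanged), each reversal-bounded (there is $r$ such that in every execution the counter alternates between nondecreasing and nonincreasing mode at most $r$ times), and a pushdown stack over a finite alphabet $\{a^1,\dots,a^l\}$ (with a bottom symbol), on which transitions may push a symbol, pop the top symbol, or test whether the top symbol equals a given symbol. A configuration consists of a control state, clock values, counter values and a stack word; an infinite execution is an infinite sequence of configurations each obtained from the previous one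 by one move. The stack word counts of a stack word $w$ are the tuple $(n_{a^1},\dots,n_{a^l})$ where $n_{a^i}$ is the number of occurrences of $a^i$ in $w$. A set of configurations is Presburger if there is a Presburger formula (first-order formula over the integers with $+$, $<$ and constants) $\varphi$ in the control state (as a bounded integer variable), clock values, counter values and stack word counts such that a configuration belongs to the set iff its corresponding tuple satisfies $\varphi$. -}

module Defs where

open import Data.Nat using (ℕ; zero; suc; _≤_; _<_)
open import Data.Integer as ℤ using (ℤ; +_; _-_; _+_; 0ℤ; 1ℤ; -1ℤ)
open import Data.Integer.Properties using () renaming (_<?_ to _<ℤ?_)
open import Data.Fin using (Fin; toℕ)
open import Data.Fin.Properties using () renaming (_≟_ to _≟ᶠ_)
open import Data.List using (List; []; _∷_; length; filter; map; upTo)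
open import Data.Bool using (Bool; true; false; if_then_else_)
open import Data.Maybe using (Maybe; just; nothing)
open import Data.Product using (Σ; _×_; _,_; ∃)
open import Data.Sum using (_⊎_)
open import Data.Unit using (⊤)
open import Relation.Nullary using (¬_)
open import Relation.Nullary.Decidable using (⌊_⌋)
open import Relation.Binary.PropositionalEquality using (_≡_; _≢_)
open import Data.List.Membership.Propositional using (_∈_)

data Cmp : Set where
  lt gt le ge eq : Cmp

cmp : Cmp → ℤ → ℤ → Set
cmp lt a b = a ℤ.< b
cmp gt a b = b ℤ.< a
cmp le a b = a ℤ.≤ b
cmp ge a b = b ℤ.≤ a
cmp eq a b = a ≡ b

data ClockConstraint (m : ℕ) : Set where
  trueC   : ClockConstraint m
  diffC   : Fin m → Fin m → Cmp → ℤ → ClockConstraint m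
  singleC : Fin m → Cmp → ℤ → ClockConstraint m
  notC    : ClockConstraint m → ClockConstraint m
  andC    : ClockConstraint m → ClockConstraint m → ClockConstraint m
  orC     : ClockConstraint m → ClockConstraint m → ClockConstraint m

Clocks : ℕ → Set
Clocks m = Fin m → ℕ

_⊨ᶜ_ : ∀ {m} → Clocks m → ClockConstraint m → Set
x ⊨ᶜ trueC = ⊤
x ⊨ᶜ diffC i j c d = cmp c ((+ x i) - (+ x j)) d
x ⊨ᶜ singleC i c d = cmp c (+ x i) d
x ⊨ᶜ notC φ = ¬ (x ⊨ᶜ φ)
x ⊨ᶜ andC φ ψ = (x ⊨ᶜ φ) × (x ⊨ᶜ ψ)
x ⊨ᶜ orC φ ψ = (x ⊨ᶜ φ) ⊎ (x ⊨ᶜ ψ)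

-- Discrete pushdown timed automata with counters
--   nS : number of control states, m : clocks, k : counters,
--   l : stack alphabet size (alphabet a¹…aˡ = Fin l; the bottom symbol is
--       implicit: the stack word is a List (Fin l) sitting on the bottom)

data Kind (m : ℕ) : Set where
  progress : Kind m
  reset    : (Fin m → Bool) → ClockConstraint m → Kind m

data CtrTest : Set where
  noTest isZero nonZero : CtrTest

data CtrUpd : Set where
  incr decr keep : CtrUpd

ctrTest : CtrTest → ℤ → Set
ctrTest noTest  v = ⊤
ctrTest isZero  v = v ≡ 0ℤ
ctrTest nonZero v = v ≢ 0ℤ

ctrUpd : CtrUpd → ℤ → ℤ
ctrUpd incr v = v + 1ℤ
ctrUpd decr v = v + -1ℤ
ctrUpd keep v = v

data StackOp (l : ℕ) : Set where
  nop      : StackOp l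
  push     : Fin l → StackOp l
  pop      : StackOp l
  topIs    : Fin l → StackOp l
  topIsBot : StackOp l

StackRel : ∀ {l} → StackOp l → List (Fin l) → List (Fin l) → Set
StackRel nop       w w' = w' ≡ w
StackRel (push a)  w w' = w' ≡ a ∷ w
StackRel pop       w w' = Σ _ λ a → w ≡ a ∷ w'
StackRel (topIs a) w w' = (Σ (List _) λ u → w ≡ a ∷ u) × (w' ≡ w)
StackRel topIsBot  w w' = (w ≡ []) × (w' ≡ w)

record Edge (nS m k l : ℕ) : Set where
  field
    src    : Fin nS
    tgt    : Fin nS
    kind   : Kind m
    ctest  : Fin k → CtrTest
    cupd   : Fin k → CtrUpd
    stack  : StackOp l

record Automaton (nS m k l : ℕ) : Set where
  field
    Inv   : Fin nS → ClockConstraint m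
    edges : List (Edge nS m k l)

record Config (nS m k l : ℕ) : Set where
  constructor conf
  field
    state    : Fin nS
    clocks   : Clocks m
    counters : Fin k → ℤ
    stackW   : List (Fin l)

open Edge
open Automaton
open Config

ClockStep : ∀ {nS m k l} → Automaton nS m k l → Edge nS m k l →
            Config nS m k l → Config nS m k l → Set
ClockStep {m = m} A e c c' with kind e
... | progress =
      (tgt e ≡ src e) ×
      Σ ℕ λ δ → (1 ≤ δ) ×
        (∀ i → clocks c' i ≡ clocks c i Data.Nat.+ δ) ×
        (∀ t → t ≤ δ → (λ i → clocks c i Data.Nat.+ t) ⊨ᶜ Inv A (src e))
... | reset R C =
      (clocks c ⊨ᶜ Inv A (src e)) × (clocks c ⊨ᶜ C) ×
      (∀ i → clocks c' i ≡ (if R i then 0 else clocks c i)) ×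
      (clocks c' ⊨ᶜ Inv A (tgt e))

EdgeStep : ∀ {nS m k l} → Automaton nS m k l → Edge nS m k l →
           Config nS m k l → Config nS m k l → Set
EdgeStep A e c c' =
  (state c ≡ src e) × (state c' ≡ tgt e) ×
  ClockStep A e c c' ×
  (∀ j → ctrTest (ctest e j) (counters c j)) ×
  (∀ j → counters c' j ≡ ctrUpd (cupd e j) (counters c j)) ×
  StackRel (stack e) (stackW c) (stackW c')

Step : ∀ {nS m k l} → Automaton nS m k l → Config nS m k l → Config nS m k l → Set
Step A c c' = Σ (Edge _ _ _ _) λ e → (e ∈ edges A) × EdgeStep A e c c'

data Mode : Set where
  nondecr nonincr : Mode

reversals : Mode → ℤ → List ℤ → ℕ
reversals m v [] = 0
reversals nondecr v (w ∷ ws) =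
  if ⌊ w <ℤ? v ⌋ then suc (reversals nonincr w ws) else reversals nondecr w ws
reversals nonincr v (w ∷ ws) =
  if ⌊ v <ℤ? w ⌋ then suc (reversals nondecr w ws) else reversals nonincr w ws

reversalsUpTo : (ℕ → ℤ) → ℕ → ℕ
reversalsUpTo f n = reversals nondecr (f 0) (map f (upTo (suc n)))

ReversalBounded : ∀ {nS m k l} → ℕ → Automaton nS m k l → Set
ReversalBounded {nS} {m} {k} {l} r A =
  (ρ : ℕ → Config nS m k l) (n : ℕ) →
  (∀ i → i < n → Step A (ρ i) (ρ (suc i))) →
  (j : Fin k) → reversalsUpTo (λ i → counters (ρ i) j) n ≤ r

data Term (V : Set) : Set where
  var  : V → Term V
  con  : ℤ → Term V
  _⊕_  : Term V → Term V → Term V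

data PFormula (V : Set) : Set where
  _≺_  : Term V → Term V → PFormula V
  _≐_  : Term V → Term V → PFormula V
  notP : PFormula V → PFormula V
  andP : PFormula V → PFormula V → PFormula V
  orP  : PFormula V → PFormula V → PFormula V
  exP  : PFormula (Maybe V) → PFormula V
  allP : PFormula (Maybe V) → PFormula V

evalT : ∀ {V : Set} → (V → ℤ) → Term V → ℤ
evalT ρ (var x) = ρ x
evalT ρ (con d) = d
evalT ρ (t ⊕ u) = evalT ρ t + evalT ρ u

extend : ∀ {V : Set} → (V → ℤ) → ℤ → Maybe V → ℤ
extend ρ a nothing  = a
extend ρ a (just x) = ρ x

⟦_⟧ : ∀ {V : Set} → PFormula V → (V → ℤ) → Set
⟦ t ≺ u ⟧ ρ = evalT ρ t ℤ.< evalT ρ u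
⟦ t ≐ u ⟧ ρ = evalT ρ t ≡ evalT ρ u
⟦ notP φ ⟧ ρ = ¬ ⟦ φ ⟧ ρ
⟦ andP φ ψ ⟧ ρ = ⟦ φ ⟧ ρ × ⟦ ψ ⟧ ρ
⟦ orP φ ψ ⟧ ρ = ⟦ φ ⟧ ρ ⊎ ⟦ ψ ⟧ ρ
⟦ exP φ ⟧ ρ = Σ ℤ λ a → ⟦ φ ⟧ (extend ρ a)
⟦ allP φ ⟧ ρ = (a : ℤ) → ⟦ φ ⟧ (extend ρ a)

data ConfVar (m k l : ℕ) : Set where
  stateV : ConfVar m k l
  clockV : Fin m → ConfVar m k l
  ctrV   : Fin k → ConfVar m k l
  countV : Fin l → ConfVar m k l

count : ∀ {l} → Fin l → List (Fin l) → ℕ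
count a w = length (filter (_≟ᶠ a) w)

confVal : ∀ {nS m k l} → Config nS m k l → ConfVar m k l → ℤ
confVal c stateV     = + toℕ (state c)
confVal c (clockV i) = + clocks c i
confVal c (ctrV j)   = counters c j
confVal c (countV a) = + count a (stackW c)

PresburgerSet : ℕ → ℕ → ℕ → Set
PresburgerSet m k l = PFormula (ConfVar m k l)

_∈ₚ_ : ∀ {nS m k l} → Config nS m k l → PresburgerSet m k l → Set
c ∈ₚ φ = ⟦ φ ⟧ (confVal c)

InfiniteExecution : ∀ {nS m k l} → Automaton nS m k l → (ℕ → Config nS m k l) → Set
InfiniteExecution A e = ∀ i → Step A (e i) (e (suc i))

PresburgerLive : ∀ {nS m k l} → Automaton nS m k l →
                 PresburgerSet m k l → PresburgerSet m k l → Set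
PresburgerLive {nS} {m} {k} {l} A I P =
  Σ (ℕ → Config nS m k l) λ e →
    InfiniteExecution A e × (e 0 ∈ₚ I) ×
    (∀ N → Σ ℕ λ j → (N ≤ j) × (e j ∈ₚ P))

{-# OPTIONS --safe #-}
module Submission where

-- Clock constraints only depend on the differences of the clocks capped at the largest constant, and
-- this finite abstraction evolves deterministically. The counters pass through a bounded number of
-- stages in which each is monotone and of constant sign, so that their tests turn into conditions on
-- the ends of the stages. Runs are therefore simulated by pushdown machines with finite control that
-- emit vectors of integers. By Parikh's theorem, proved by solving systems of inequations over
-- commutative regular expressions, the sums of the emitted vectors form semilinear sets, and
-- quantifier elimination makes reachability, as a relation between numerical data, Presburger.
--
-- An infinite execution passes infinitely often through configurations whose stack is never
-- undercut later. Between such configurations of a fixed location the relation φ(x, y), "x is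
-- reachable from I, and y is reachable from x through P", is Presburger and, by transitivity, holds
-- for all pairs of such configurations that are far enough apart. Sequences of this kind exist if and
-- only if there are x and d such that φ(x + n d, x + n′ d) holds for suitable n′ ≫ n ≫ 0: every
-- sequence of tuples can be thinned until all linear forms of φ are constant or strictly monotone,
-- and then two of its members determine x and d. The condition on x and d is again Presburger.

open import Defs
open import Data.Nat using (ℕ; zero; suc; _+_; _*_; _∸_; _⊔_; _⊓_; _≤_; _<_; z≤n; s≤s)
import Data.Nat.Properties as ℕₚ
open import Data.Nat.Induction using (<-rec)
open import Data.Integer using (ℤ; +_; -[1+_]; 0ℤ; 1ℤ; -1ℤ; ∣_∣; +≤+; -≤+; +<+; -<+) renaming (_+_ to infixl 6 _+ᶻ_; _*_ to infixl 7 _*ᶻ_; _-_ to infixl 6 _-ᶻ_; -_ to infix 8 -ᶻ_; _≤_ to infix 4 _≤ᶻ_; _<_ to infix 4 _<ᶻ_; _⊓_ to infixl 7 _⊓ᶻ_; _⊔_ to infixl 6 _⊔ᶻ_)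
import Data.Integer.Properties as ℤₚ
open import Data.Integer.Divisibility.Signed using (_∣_; divides; _∣?_)
import Data.Integer.Divisibility.Signed as Div
open import Data.Integer.DivMod using (_%ℕ_; _/ℕ_; a≡a%ℕn+[a/ℕn]*n; n%ℕd<d)
open import Data.Integer.Tactic.RingSolver using (solve-∀)
open import Data.Fin using (Fin; zero; suc; toℕ; fromℕ<)
import Data.Fin as Fin
import Data.Fin.Properties as Finₚ
open import Data.Bool using (Bool; true; false; if_then_else_; _∧_; not)
import Data.Bool.Properties as Boolₚ
open import Data.Maybe using (Maybe; just; nothing)
open import Data.Product using (Σ; _×_; _,_; proj₁; proj₂)
open import Data.Sum using (_⊎_; inj₁; inj₂; [_,_]′)
import Data.Sum as Sum
open import Data.Unit using (⊤; tt)
open import Data.Empty using (⊥; ⊥-elim)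
open import Data.List using (List; []; _∷_; length; map; _++_; applyUpTo; _ʳ++_)
import Data.List as List
import Data.List.Properties as Listₚ
open import Data.List.Relation.Unary.Any using (index)
open import Data.List.Relation.Unary.Any.Properties using (lookup-index)
import Data.List.Membership.Propositional.Properties as ∈ₚ
open import Data.Vec using (Vec; []; _∷_; lookup; tabulate; replicate; zipWith)
import Data.Vec.Properties as Vecₚ
open import Relation.Nullary using (¬_; Dec; yes; no; ¬?; _×-dec_; _⊎-dec_)
open import Relation.Nullary.Decidable using (map′; ⌊_⌋)
open import Relation.Binary.Definitions using (tri<; tri≈; tri>; DecidableEquality)
open import Relation.Binary.PropositionalEquality using (_≡_; _≢_; refl; sym; trans; cong; cong₂; subst; subst₂; isEquivalence; module ≡-Reasoning)
open import Function using (_∘_; id)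
open import Algebra.Structures using (IsCommutativeMonoid)
open import Relation.Binary.Construct.Closure.ReflexiveTransitive using (_◅_; _◅◅_) renaming (Star to Path; ε to halt)
open Edge
open Config

-- Much of what the argument speaks of cannot be computed from an execution: the stage in which it
-- settles, the indices whose stack is never undercut, the thinned subsequence. All of this is
-- confined to the refutation, whose conclusion is ⊥, so double negations suffice there. A positive
-- answer is explicit: one of finitely many pairs of a stage and a location, together with `x` and
-- `d`, from which an execution is built. A location consists of the control state, the capped clock
-- differences and the top stack symbol. Apart from the numbers, this is all that a run above the
-- current stack can see of a configuration. Hence a loop between two tuples can start at any
-- configuration with the right numbers and location, whatever word lies below; this is what allows
-- a progression of mere tuples to be turned into a run. Resets make a clock value neither monotone
-- nor a plain sum of labels. The machine therefore guesses, phase by phase, which clocks are not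
-- reset any more: these keep their value and gain the time that passes, the others contribute
-- nothing until their last reset.

infix 2 _⟷_

_⟷_ : Set → Set → Set
A ⟷ B = (A → B) × (B → A)

⟷-refl : ∀ {A} → A ⟷ A
⟷-refl = id , id

⟷-sym : ∀ {A B} → A ⟷ B → B ⟷ A
⟷-sym (f , g) = g , f

⟷-trans : ∀ {A B C} → A ⟷ B → B ⟷ C → A ⟷ C
⟷-trans (f , g) (h , k) = h ∘ f , g ∘ k

≡⇒⟷ : ∀ {A B} → A ≡ B → A ⟷ B
≡⇒⟷ refl = ⟷-refl

¬-⟷ : ∀ {A B} → A ⟷ B → (¬ A) ⟷ (¬ B)
¬-⟷ (f , g) = (λ na b → na (g b)) , λ nb a → nb (f a)

×-⟷ : ∀ {A B C D} → A ⟷ B → C ⟷ D → (A × C) ⟷ (B × D)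
×-⟷ (f , g) (h , k) = (λ (a , c) → f a , h c) , λ (b , d) → g b , k d

⊎-⟷ : ∀ {A B C D} → A ⟷ B → C ⟷ D → (A ⊎ C) ⟷ (B ⊎ D)
⊎-⟷ (f , g) (h , k) = Sum.map f h , Sum.map g k

-- Integer inequalities

-- Linear consequences: the hypothesis is a sum of known inequalities, and the equation is left to
-- the ring solver.
≤-by : ∀ {a b c d} → a ≤ᶻ b → d -ᶻ c ≡ b -ᶻ a → c ≤ᶻ d
≤-by p e = ℤₚ.0≤i-j⇒j≤i (subst (0ℤ ≤ᶻ_) (sym e) (ℤₚ.i≤j⇒0≤j-i p))

<⇒1+≤ : ∀ {a b} → a <ᶻ b → 1ℤ +ᶻ a ≤ᶻ b
<⇒1+≤ = ℤₚ.i<j⇒suc[i]≤j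

1+≤⇒< : ∀ {a b} → 1ℤ +ᶻ a ≤ᶻ b → a <ᶻ b
1+≤⇒< = ℤₚ.suc[i]≤j⇒i<j

<-by : ∀ {a b c d} → a <ᶻ b → d -ᶻ c ≡ b -ᶻ a → c <ᶻ d
<-by {a} {b} {c} {d} p e = 1+≤⇒< (≤-by (<⇒1+≤ p) (trans (shift d c) (trans (cong (_-ᶻ 1ℤ) e) (sym (shift b a)))))
  where
  shift : ∀ x y → x -ᶻ (1ℤ +ᶻ y) ≡ x -ᶻ y -ᶻ 1ℤ
  shift = solve-∀

i≤∣i∣ : ∀ i → i ≤ᶻ + ∣ i ∣
i≤∣i∣ (+ n)    = ℤₚ.≤-refl
i≤∣i∣ -[1+ n ] = -≤+

-∣i∣≤i : ∀ i → -ᶻ (+ ∣ i ∣) ≤ᶻ i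
-∣i∣≤i (+ zero)    = ℤₚ.≤-refl
-∣i∣≤i (+ (suc n)) = -≤+
-∣i∣≤i -[1+ n ]    = ℤₚ.≤-refl

-- Quantifier-free Presburger formulas

data Lin (V : Set) : Set where
  lvar : V → Lin V
  lcon : ℤ → Lin V
  _⊞_  : Lin V → Lin V → Lin V
  _⊠_  : ℤ → Lin V → Lin V

infixl 6 _⊞_
infixl 7 _⊠_

⟦_⟧ˡ : ∀ {V} → Lin V → (V → ℤ) → ℤ
⟦ lvar v ⟧ˡ ρ = ρ v
⟦ lcon c ⟧ˡ ρ = c
⟦ t ⊞ u ⟧ˡ ρ = ⟦ t ⟧ˡ ρ +ᶻ ⟦ u ⟧ˡ ρ
⟦ c ⊠ t ⟧ˡ ρ = c *ᶻ ⟦ t ⟧ˡ ρ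

-- pos t says 0 < t, and dvd n t says that suc n divides t, so that moduli are never 0.
data QF (V : Set) : Set where
  pos    : Lin V → QF V
  dvd    : ℕ → Lin V → QF V
  neg    : QF V → QF V
  and or : QF V → QF V → QF V

⟦_⟧ᵠ : ∀ {V} → QF V → (V → ℤ) → Set
⟦ pos t ⟧ᵠ ρ = 0ℤ <ᶻ ⟦ t ⟧ˡ ρ
⟦ dvd n t ⟧ᵠ ρ = + suc n ∣ ⟦ t ⟧ˡ ρ
⟦ neg φ ⟧ᵠ ρ = ¬ ⟦ φ ⟧ᵠ ρ
⟦ and φ ψ ⟧ᵠ ρ = ⟦ φ ⟧ᵠ ρ × ⟦ ψ ⟧ᵠ ρ
⟦ or φ ψ ⟧ᵠ ρ = ⟦ φ ⟧ᵠ ρ ⊎ ⟦ ψ ⟧ᵠ ρ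

dec-QF : ∀ {V} (φ : QF V) ρ → Dec (⟦ φ ⟧ᵠ ρ)
dec-QF (pos t) ρ = 0ℤ ℤₚ.<? ⟦ t ⟧ˡ ρ
dec-QF (dvd n t) ρ = + suc n ∣? ⟦ t ⟧ˡ ρ
dec-QF (neg φ) ρ = ¬? (dec-QF φ ρ)
dec-QF (and φ ψ) ρ = dec-QF φ ρ ×-dec dec-QF ψ ρ
dec-QF (or φ ψ) ρ = dec-QF φ ρ ⊎-dec dec-QF ψ ρ

subˡ : ∀ {V W} → (V → Lin W) → Lin V → Lin W
subˡ τ (lvar v) = τ v
subˡ τ (lcon c) = lcon c
subˡ τ (t ⊞ u) = subˡ τ t ⊞ subˡ τ u
subˡ τ (c ⊠ t) = c ⊠ subˡ τ t

sub : ∀ {V W} → (V → Lin W) → QF V → QF W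
sub τ (pos t) = pos (subˡ τ t)
sub τ (dvd n t) = dvd n (subˡ τ t)
sub τ (neg φ) = neg (sub τ φ)
sub τ (and φ ψ) = and (sub τ φ) (sub τ ψ)
sub τ (or φ ψ) = or (sub τ φ) (sub τ ψ)

subˡ-eval : ∀ {V W} (τ : V → Lin W) ρ ρ′ → (∀ v → ⟦ τ v ⟧ˡ ρ ≡ ρ′ v) → ∀ t → ⟦ subˡ τ t ⟧ˡ ρ ≡ ⟦ t ⟧ˡ ρ′
subˡ-eval τ ρ ρ′ e (lvar v) = e v
subˡ-eval τ ρ ρ′ e (lcon c) = refl
subˡ-eval τ ρ ρ′ e (t ⊞ u) = cong₂ _+ᶻ_ (subˡ-eval τ ρ ρ′ e t) (subˡ-eval τ ρ ρ′ e u)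
subˡ-eval τ ρ ρ′ e (c ⊠ t) = cong (c *ᶻ_) (subˡ-eval τ ρ ρ′ e t)

sub-eval : ∀ {V W} (τ : V → Lin W) ρ ρ′ → (∀ v → ⟦ τ v ⟧ˡ ρ ≡ ρ′ v) → ∀ φ → ⟦ sub τ φ ⟧ᵠ ρ ⟷ ⟦ φ ⟧ᵠ ρ′
sub-eval τ ρ ρ′ e (pos t) = ≡⇒⟷ (cong (0ℤ <ᶻ_) (subˡ-eval τ ρ ρ′ e t))
sub-eval τ ρ ρ′ e (dvd n t) = ≡⇒⟷ (cong (+ suc n ∣_) (subˡ-eval τ ρ ρ′ e t))
sub-eval τ ρ ρ′ e (neg φ) = ¬-⟷ (sub-eval τ ρ ρ′ e φ)
sub-eval τ ρ ρ′ e (and φ ψ) = ×-⟷ (sub-eval τ ρ ρ′ e φ) (sub-eval τ ρ ρ′ e ψ)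
sub-eval τ ρ ρ′ e (or φ ψ) = ⊎-⟷ (sub-eval τ ρ ρ′ e φ) (sub-eval τ ρ ρ′ e ψ)

eval-cong : ∀ {V} {ρ ρ′ : V → ℤ} → (∀ v → ρ v ≡ ρ′ v) → ∀ φ → ⟦ φ ⟧ᵠ ρ ⟷ ⟦ φ ⟧ᵠ ρ′
eval-cong {ρ = ρ} {ρ′} e φ =
  ⟷-trans (⟷-sym (sub-eval lvar ρ ρ (λ _ → refl) φ)) (sub-eval lvar ρ ρ′ e φ)

ttᵠ ffᵠ : ∀ {V} → QF V
ttᵠ = pos (lcon 1ℤ)
ffᵠ = neg ttᵠ

tt-holds : ∀ {V} {ρ : V → ℤ} → ⟦ ttᵠ ⟧ᵠ ρ
tt-holds = +<+ (s≤s z≤n)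

ff-fails : ∀ {V} {ρ : V → ℤ} → ¬ ⟦ ffᵠ {V} ⟧ᵠ ρ
ff-fails {ρ = ρ} f = f (tt-holds {ρ = ρ})

orN : ∀ {V} → ℕ → (ℕ → QF V) → QF V
orN zero f = ffᵠ
orN (suc n) f = or (f n) (orN n f)

orN-spec : ∀ {V} (ρ : V → ℤ) n f → ⟦ orN n f ⟧ᵠ ρ ⟷ (Σ ℕ λ i → i < n × ⟦ f i ⟧ᵠ ρ)
orN-spec {V} ρ n f = to n , λ (i , i<n , h) → from n i i<n h
  where
  to : ∀ n → ⟦ orN n f ⟧ᵠ ρ → Σ ℕ λ i → i < n × ⟦ f i ⟧ᵠ ρ
  to zero h = ⊥-elim (ff-fails {ρ = ρ} h)
  to (suc n) (inj₁ h) = n , ℕₚ.≤-refl , h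
  to (suc n) (inj₂ h) with to n h
  ... | i , i<n , p = i , ℕₚ.m≤n⇒m≤1+n i<n , p
  from : ∀ n i → i < n → ⟦ f i ⟧ᵠ ρ → ⟦ orN n f ⟧ᵠ ρ
  from (suc n) i (s≤s i≤n) h with ℕₚ.m≤n⇒m<n∨m≡n i≤n
  ... | inj₁ i<n = inj₂ (from n i i<n h)
  ... | inj₂ refl = inj₁ h

-- L is a multiple of all moduli of a formula.
Per : ∀ {V} → ℤ → QF V → Set
Per L (pos t) = ⊤
Per L (dvd n t) = + suc n ∣ L
Per L (neg φ) = Per L φ
Per L (and φ ψ) = Per L φ × Per L ψ
Per L (or φ ψ) = Per L φ × Per L ψ

-- The period is the product of all moduli. Its predecessor is computed instead, which makes the
-- period positive by construction: `suc m * suc n` is the successor of `n + m * suc n`.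
pred-period : ∀ {V} → QF V → ℕ
pred-period (pos t) = 0
pred-period (dvd n t) = n
pred-period (neg φ) = pred-period φ
pred-period (and φ ψ) = pred-period ψ + pred-period φ * suc (pred-period ψ)
pred-period (or φ ψ) = pred-period ψ + pred-period φ * suc (pred-period ψ)

period : ∀ {V} → QF V → ℤ
period φ = + suc (pred-period φ)

Per-∣ : ∀ {V} (φ : QF V) {L L′} → L ∣ L′ → Per L φ → Per L′ φ
Per-∣ (pos t) d p = tt
Per-∣ (dvd n t) d p = Div.∣-trans p d
Per-∣ (neg φ) d p = Per-∣ φ d p
Per-∣ (and φ ψ) d (p , q) = Per-∣ φ d p , Per-∣ ψ d q
Per-∣ (or φ ψ) d (p , q) = Per-∣ φ d p , Per-∣ ψ d q

suc*suc : ∀ m n → + suc (n + m * suc n) ≡ + suc m *ᶻ + suc n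
suc*suc m n = ℤₚ.pos-* (suc m) (suc n)

Per-period : ∀ {V} (φ : QF V) → Per (period φ) φ
Per-period-and : ∀ {V} (φ ψ : QF V) → Per (+ suc (pred-period ψ + pred-period φ * suc (pred-period ψ))) φ
                                     × Per (+ suc (pred-period ψ + pred-period φ * suc (pred-period ψ))) ψ
Per-period (pos t) = tt
Per-period (dvd n t) = Div.∣-refl
Per-period (neg φ) = Per-period φ
Per-period (and φ ψ) = Per-period-and φ ψ
Per-period (or φ ψ) = Per-period-and φ ψ
Per-period-and φ ψ =
  Per-∣ φ (divides (period ψ) (trans (suc*suc (pred-period φ) (pred-period ψ)) (ℤₚ.*-comm (period φ) (period ψ)))) (Per-period φ) ,
  Per-∣ ψ (divides (period φ) (suc*suc (pred-period φ) (pred-period ψ))) (Per-period ψ)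

-- Quantifier elimination

coef : ∀ {V} → Lin (Maybe V) → ℤ
coef (lvar nothing) = 1ℤ
coef (lvar (just v)) = 0ℤ
coef (lcon c) = 0ℤ
coef (t ⊞ u) = coef t +ᶻ coef u
coef (c ⊠ t) = c *ᶻ coef t

rest : ∀ {V} → Lin (Maybe V) → Lin V
rest (lvar nothing) = lcon 0ℤ
rest (lvar (just v)) = lvar v
rest (lcon c) = lcon c
rest (t ⊞ u) = rest t ⊞ rest u
rest (c ⊠ t) = c ⊠ rest t

split-eval : ∀ {V} (ρ : V → ℤ) a t → ⟦ t ⟧ˡ (extend ρ a) ≡ coef t *ᶻ a +ᶻ ⟦ rest t ⟧ˡ ρ
split-eval ρ a (lvar nothing) = lem a
  where
  lem : ∀ a → a ≡ 1ℤ *ᶻ a +ᶻ 0ℤ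
  lem = solve-∀
split-eval ρ a (lvar (just v)) = lem a (ρ v)
  where
  lem : ∀ a x → x ≡ 0ℤ *ᶻ a +ᶻ x
  lem = solve-∀
split-eval ρ a (lcon c) = lem a c
  where
  lem : ∀ a x → x ≡ 0ℤ *ᶻ a +ᶻ x
  lem = solve-∀
split-eval ρ a (t ⊞ u) =
  trans (cong₂ _+ᶻ_ (split-eval ρ a t) (split-eval ρ a u)) (lem (coef t) (coef u) a _ _)
  where
  lem : ∀ c d a x y → c *ᶻ a +ᶻ x +ᶻ (d *ᶻ a +ᶻ y) ≡ (c +ᶻ d) *ᶻ a +ᶻ (x +ᶻ y)
  lem = solve-∀
split-eval ρ a (c ⊠ t) = trans (cong (c *ᶻ_) (split-eval ρ a t)) (lem c (coef t) a _)
  where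
  lem : ∀ c d a x → c *ᶻ (d *ᶻ a +ᶻ x) ≡ c *ᶻ d *ᶻ a +ᶻ c *ᶻ x
  lem = solve-∀

-- minf r φ is the truth value of φ as the variable tends to -∞ in the residue class of r.
minf : ∀ {V} → ℤ → QF (Maybe V) → QF V
minf r (pos t) with coef t
... | + zero = pos (rest t)
... | + suc _ = ffᵠ
... | -[1+ _ ] = ttᵠ
minf r (dvd n t) = dvd n (lcon (coef t *ᶻ r) ⊞ rest t)
minf r (neg φ) = neg (minf r φ)
minf r (and φ ψ) = and (minf r φ) (minf r ψ)
minf r (or φ ψ) = or (minf r φ) (minf r ψ)

∣-shift : ∀ {k a b} → k ∣ (a -ᶻ b) → (k ∣ a) ⟷ (k ∣ b)
∣-shift {k} {a} {b} d =
  (λ h → subst (k ∣_) (lem₁ a b) (Div.∣m∣n⇒∣m-n h d)) ,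
  (λ h → subst (k ∣_) (lem₂ a b) (Div.∣m∣n⇒∣m+n d h))
  where
  lem₁ : ∀ a b → a -ᶻ (a -ᶻ b) ≡ b
  lem₁ = solve-∀
  lem₂ : ∀ a b → a -ᶻ b +ᶻ b ≡ a
  lem₂ = solve-∀

minf-spec : ∀ {V} (ρ : V → ℤ) L r φ → Per L φ →
            Σ ℤ λ b → ∀ y q → y ≤ᶻ b → y ≡ r +ᶻ q *ᶻ L → ⟦ φ ⟧ᵠ (extend ρ y) ⟷ ⟦ minf r φ ⟧ᵠ ρ
minf-spec ρ L r (pos t) per with coef t in eqn
... | + zero = 0ℤ , λ y q y≤ e →
  ≡⇒⟷ (cong (0ℤ <ᶻ_) (trans (split-eval ρ y t) (trans (cong (λ c → c *ᶻ y +ᶻ ⟦ rest t ⟧ˡ ρ) eqn) (lem y _))))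
  where
  lem : ∀ y x → 0ℤ *ᶻ y +ᶻ x ≡ x
  lem = solve-∀
... | + suc n = -ᶻ (+ ∣ T ∣) , λ y q y≤ e →
    (λ h → ⊥-elim (ℤₚ.<⇒≱ (subst (0ℤ <ᶻ_) (trans (split-eval ρ y t) (cong (λ c → c *ᶻ y +ᶻ T) eqn)) h) (bound y y≤))) ,
    (λ h → ⊥-elim (ff-fails {ρ = ρ} h))
  where
  T = ⟦ rest t ⟧ˡ ρ
  lem : ∀ n y T A → 0ℤ -ᶻ ((1ℤ +ᶻ n) *ᶻ y +ᶻ T) ≡ (-ᶻ A +ᶻ n *ᶻ 0ℤ +ᶻ A) -ᶻ (y +ᶻ n *ᶻ y +ᶻ T)
  lem = solve-∀
  bound : ∀ y → y ≤ᶻ -ᶻ (+ ∣ T ∣) → + suc n *ᶻ y +ᶻ T ≤ᶻ 0ℤ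
  bound y y≤ = ≤-by (ℤₚ.+-mono-≤ (ℤₚ.+-mono-≤ y≤ (ℤₚ.*-monoˡ-≤-nonNeg (+ n) (ℤₚ.≤-trans y≤ (ℤₚ.neg-mono-≤ (+≤+ (z≤n {∣ T ∣})))))) (i≤∣i∣ T))
                    (lem (+ n) y T (+ ∣ T ∣))
-- One further down than in the preceding case: there the form only has to be at most 0, here it
-- must be strictly positive.
... | -[1+ n ] = -ᶻ (+ suc ∣ T ∣) , λ y q y≤ e →
    (λ _ → tt-holds {ρ = ρ}) ,
    (λ _ → subst (0ℤ <ᶻ_) (sym (trans (split-eval ρ y t) (cong (λ c → c *ᶻ y +ᶻ T) eqn))) (bound y y≤))
  where
  T = ⟦ rest t ⟧ˡ ρ
  lem : ∀ n y T A → (-ᶻ (1ℤ +ᶻ n)) *ᶻ y +ᶻ T -ᶻ (1ℤ +ᶻ 0ℤ) ≡ (-ᶻ (1ℤ +ᶻ A) +ᶻ n *ᶻ 0ℤ +ᶻ T) -ᶻ (y +ᶻ n *ᶻ y +ᶻ -ᶻ A)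
  lem = solve-∀
  bound : ∀ y → y ≤ᶻ -ᶻ (+ suc ∣ T ∣) → 0ℤ <ᶻ -[1+ n ] *ᶻ y +ᶻ T
  bound y y≤ = 1+≤⇒< (≤-by (ℤₚ.+-mono-≤ (ℤₚ.+-mono-≤ y≤ (ℤₚ.*-monoˡ-≤-nonNeg (+ n) (ℤₚ.≤-trans y≤ (ℤₚ.neg-mono-≤ (+≤+ (z≤n {suc ∣ T ∣})))))) (-∣i∣≤i T))
                      (lem (+ n) y T (+ ∣ T ∣)))
minf-spec ρ L r (dvd n t) (divides k eqn) = 0ℤ , λ y q _ e → ∣-shift (divides (coef t *ᶻ q *ᶻ k) (begin
    ⟦ t ⟧ˡ (extend ρ y) -ᶻ (coef t *ᶻ r +ᶻ T)          ≡⟨ cong (_-ᶻ (coef t *ᶻ r +ᶻ T)) (split-eval ρ y t) ⟩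
    coef t *ᶻ y +ᶻ T -ᶻ (coef t *ᶻ r +ᶻ T)             ≡⟨ cong (λ z → coef t *ᶻ z +ᶻ T -ᶻ (coef t *ᶻ r +ᶻ T)) (trans e (cong (λ z → r +ᶻ q *ᶻ z) eqn)) ⟩
    coef t *ᶻ (r +ᶻ q *ᶻ (k *ᶻ + suc n)) +ᶻ T -ᶻ (coef t *ᶻ r +ᶻ T) ≡⟨ lem (coef t) r q k (+ suc n) T ⟩
    coef t *ᶻ q *ᶻ k *ᶻ + suc n ∎))
  where
  open ≡-Reasoning
  T = ⟦ rest t ⟧ˡ ρ
  lem : ∀ c r q k s T → c *ᶻ (r +ᶻ q *ᶻ (k *ᶻ s)) +ᶻ T -ᶻ (c *ᶻ r +ᶻ T) ≡ c *ᶻ q *ᶻ k *ᶻ s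
  lem = solve-∀
minf-spec ρ L r (neg φ) per with minf-spec ρ L r φ per
... | b , h = b , λ y q y≤ e → ¬-⟷ (h y q y≤ e)
minf-spec ρ L r (and φ ψ) (per , per′) with minf-spec ρ L r φ per | minf-spec ρ L r ψ per′
... | b , h | b′ , h′ = b ⊓ᶻ b′ , λ y q y≤ e →
  ×-⟷ (h y q (ℤₚ.≤-trans y≤ (ℤₚ.i⊓j≤i b b′)) e) (h′ y q (ℤₚ.≤-trans y≤ (ℤₚ.i⊓j≤j b b′)) e)
minf-spec ρ L r (or φ ψ) (per , per′) with minf-spec ρ L r φ per | minf-spec ρ L r ψ per′
... | b , h | b′ , h′ = b ⊓ᶻ b′ , λ y q y≤ e →
  ⊎-⟷ (h y q (ℤₚ.≤-trans y≤ (ℤₚ.i⊓j≤i b b′)) e) (h′ y q (ℤₚ.≤-trans y≤ (ℤₚ.i⊓j≤j b b′)) e)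

-- Substitution of the fraction s / suc c for the variable, after clearing denominators.
subFrac : ∀ {V} → ℕ → Lin V → QF (Maybe V) → QF V
subFrac c s (pos t) = pos (coef t ⊠ s ⊞ (+ suc c) ⊠ rest t)
subFrac c s (dvd n t) = dvd (n + c * suc n) (coef t ⊠ s ⊞ (+ suc c) ⊠ rest t)
subFrac c s (neg φ) = neg (subFrac c s φ)
subFrac c s (and φ ψ) = and (subFrac c s φ) (subFrac c s ψ)
subFrac c s (or φ ψ) = or (subFrac c s φ) (subFrac c s ψ)

-- Every atom is multiplied by the positive number `suc c`, which preserves the sign of a form, and
-- also divisibility once the modulus is multiplied as well.
subFrac-spec : ∀ {V} (ρ : V → ℤ) c s x φ → + suc c *ᶻ x ≡ ⟦ s ⟧ˡ ρ →
               ⟦ φ ⟧ᵠ (extend ρ x) ⟷ ⟦ subFrac c s φ ⟧ᵠ ρ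
subFrac-spec {V} ρ c s x φ e = go φ
  where
  open ≡-Reasoning
  lem : ∀ c k x T → k *ᶻ (c *ᶻ x) +ᶻ c *ᶻ T ≡ c *ᶻ (k *ᶻ x +ᶻ T)
  lem = solve-∀
  scaled : ∀ t → ⟦ coef t ⊠ s ⊞ (+ suc c) ⊠ rest t ⟧ˡ ρ ≡ + suc c *ᶻ ⟦ t ⟧ˡ (extend ρ x)
  scaled t = begin
    coef t *ᶻ ⟦ s ⟧ˡ ρ +ᶻ + suc c *ᶻ ⟦ rest t ⟧ˡ ρ    ≡⟨ cong (λ z → coef t *ᶻ z +ᶻ + suc c *ᶻ ⟦ rest t ⟧ˡ ρ) (sym e) ⟩
    coef t *ᶻ (+ suc c *ᶻ x) +ᶻ + suc c *ᶻ ⟦ rest t ⟧ˡ ρ ≡⟨ lem (+ suc c) (coef t) x _ ⟩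
    + suc c *ᶻ (coef t *ᶻ x +ᶻ ⟦ rest t ⟧ˡ ρ)         ≡⟨ cong (+ suc c *ᶻ_) (sym (split-eval ρ x t)) ⟩
    + suc c *ᶻ ⟦ t ⟧ˡ (extend ρ x) ∎
  go : ∀ φ → ⟦ φ ⟧ᵠ (extend ρ x) ⟷ ⟦ subFrac c s φ ⟧ᵠ ρ
  go (pos t) =
    (λ h → subst (0ℤ <ᶻ_) (sym (scaled t)) (subst (_<ᶻ + suc c *ᶻ ⟦ t ⟧ˡ (extend ρ x)) (ℤₚ.*-zeroʳ (+ suc c)) (ℤₚ.*-monoˡ-<-pos (+ suc c) h))) ,
    (λ h → ℤₚ.*-cancelˡ-<-nonNeg (+ suc c) (subst₂ _<ᶻ_ (sym (ℤₚ.*-zeroʳ (+ suc c))) (scaled t) h))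
  go (dvd n t) =
    (λ h → subst₂ _∣_ (sym (suc*suc c n)) (sym (scaled t)) (Div.*-monoʳ-∣ (+ suc c) h)) ,
    (λ h → Div.*-cancelˡ-∣ (+ suc c) (subst₂ _∣_ (suc*suc c n) (scaled t) h))
  go (neg φ) = ¬-⟷ (go φ)
  go (and φ ψ) = ×-⟷ (go φ) (go ψ)
  go (or φ ψ) = ⊎-⟷ (go φ) (go ψ)

module _ {V : Set} (χ : QF (Maybe V)) (L : ℕ) where

  atFrac : ℕ → Lin V → QF V
  atFrac c s = and (dvd c s) (subFrac c s χ)

  -- Some solution of χ lies at a distance at most L from the root of an atom pos t of the argument.
  tests : QF (Maybe V) → QF V
  tests (pos t) with coef t
  ... | + zero = ffᵠ
  -- Moving the variable by `L` changes the value of this atom by `suc c * L`; hence the values from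
  -- `- suc c * L` to `suc c * L` are tried.
  ... | + suc c = orN (suc (suc c * L)) λ i →
    or (atFrac c (lcon (+ i) ⊞ -1ℤ ⊠ rest t)) (atFrac c (lcon (-ᶻ (+ i)) ⊞ -1ℤ ⊠ rest t))
  ... | -[1+ c ] = orN (suc (suc c * L)) λ i →
    or (atFrac c (rest t ⊞ lcon (-ᶻ (+ i)))) (atFrac c (rest t ⊞ lcon (+ i)))
  tests (dvd n t) = ffᵠ
  tests (neg φ) = tests φ
  tests (and φ ψ) = or (tests φ) (tests ψ)
  tests (or φ ψ) = or (tests φ) (tests ψ)

  module _ (ρ : V → ℤ) where

    atFrac-sound : ∀ c s → ⟦ atFrac c s ⟧ᵠ ρ → Σ ℤ λ x → ⟦ χ ⟧ᵠ (extend ρ x)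
    atFrac-sound c s (divides q e , h) =
      q , proj₂ (subFrac-spec ρ c s q χ (trans (ℤₚ.*-comm (+ suc c) q) (sym e))) h

    atFrac-complete : ∀ c s x → ⟦ χ ⟧ᵠ (extend ρ x) → + suc c *ᶻ x ≡ ⟦ s ⟧ˡ ρ → ⟦ atFrac c s ⟧ᵠ ρ
    atFrac-complete c s x h e =
      divides x (trans (sym e) (ℤₚ.*-comm (+ suc c) x)) , proj₁ (subFrac-spec ρ c s x χ e) h

    tests-sound : ∀ φ → ⟦ tests φ ⟧ᵠ ρ → Σ ℤ λ x → ⟦ χ ⟧ᵠ (extend ρ x)
    tests-sound (pos t) h with coef t
    ... | + zero = ⊥-elim (ff-fails {ρ = ρ} h)
    ... | + suc c = [ atFrac-sound c _ , atFrac-sound c _ ]′ (proj₂ (proj₂ (proj₁ (orN-spec ρ (suc (suc c * L)) _) h)))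
    ... | -[1+ c ] = [ atFrac-sound c _ , atFrac-sound c _ ]′ (proj₂ (proj₂ (proj₁ (orN-spec ρ (suc (suc c * L)) _) h)))
    tests-sound (dvd n t) h = ⊥-elim (ff-fails {ρ = ρ} h)
    tests-sound (neg φ) h = tests-sound φ h
    tests-sound (and φ ψ) = [ tests-sound φ , tests-sound ψ ]′
    tests-sound (or φ ψ) = [ tests-sound φ , tests-sound ψ ]′

    far-sign : ∀ u e B → ∣ e ∣ ≤ B → ¬ (∣ u ∣ ≤ B) → (0ℤ <ᶻ u) ⟷ (0ℤ <ᶻ u -ᶻ e)
    far-sign (+ n) e B e≤ u≰ =
      (λ _ → 1+≤⇒< (≤-by (ℤₚ.+-mono-≤ (+≤+ (ℕₚ.≰⇒> u≰)) (ℤₚ.≤-trans (i≤∣i∣ e) (+≤+ e≤))) (lem (+ n) e (+ B)))) ,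
      (λ _ → +<+ (ℕₚ.≤-<-trans z≤n (ℕₚ.≰⇒> u≰)))
      where
      lem : ∀ n e B → n -ᶻ e -ᶻ (1ℤ +ᶻ 0ℤ) ≡ n +ᶻ B -ᶻ ((1ℤ +ᶻ B) +ᶻ e)
      lem = solve-∀
    far-sign -[1+ n ] e B e≤ u≰ =
      (λ ()) ,
      (λ h → ⊥-elim (ℤₚ.<⇒≱ h (≤-by (ℤₚ.+-mono-≤ (+≤+ (ℕₚ.<⇒≤ (ℕₚ.≰⇒> u≰))) (ℤₚ.≤-trans (ℤₚ.neg-mono-≤ (+≤+ e≤)) (-∣i∣≤i e))) (lem (+ n) e (+ B)))))
      where
      lem : ∀ n e B → 0ℤ -ᶻ (-ᶻ (1ℤ +ᶻ n) -ᶻ e) ≡ (1ℤ +ᶻ n) +ᶻ e -ᶻ (B +ᶻ -ᶻ B)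
      lem = solve-∀

    window : ∀ n u (f g : ℕ → QF V) → ∣ u ∣ ≤ n → (∀ i → u ≡ + i → ⟦ f i ⟧ᵠ ρ) → (∀ i → u ≡ -ᶻ (+ i) → ⟦ g i ⟧ᵠ ρ) →
             ⟦ orN (suc n) (λ i → or (f i) (g i)) ⟧ᵠ ρ
    window n (+ i) f g i≤ F G = proj₂ (orN-spec ρ (suc n) _) (i , s≤s i≤ , inj₁ (F i refl))
    window n -[1+ i ] f g i≤ F G = proj₂ (orN-spec ρ (suc n) _) (suc i , s≤s i≤ , inj₂ (G (suc i) refl))

    -- Either x is close to the root of an atom, or moving it down by L changes no atom.
    tests-complete : ∀ x → ⟦ χ ⟧ᵠ (extend ρ x) → ∀ φ → Per (+ L) φ →
                     ⟦ tests φ ⟧ᵠ ρ ⊎ (⟦ φ ⟧ᵠ (extend ρ x) ⟷ ⟦ φ ⟧ᵠ (extend ρ (x -ᶻ + L)))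
    tests-complete x h (pos t) per with coef t in eqn
    ... | + zero = inj₂ (≡⇒⟷ (cong (0ℤ <ᶻ_) (trans (const x) (sym (const (x -ᶻ + L))))))
      where
      lem : ∀ y T → 0ℤ *ᶻ y +ᶻ T ≡ T
      lem = solve-∀
      const : ∀ y → ⟦ t ⟧ˡ (extend ρ y) ≡ ⟦ rest t ⟧ˡ ρ
      const y = trans (split-eval ρ y t) (trans (cong (λ c → c *ᶻ y +ᶻ ⟦ rest t ⟧ˡ ρ) eqn) (lem y _))
    ... | + suc c = near-or-far (∣ ⟦ t ⟧ˡ (extend ρ x) ∣ ℕₚ.≤? suc c * L)
      where
      T = ⟦ rest t ⟧ˡ ρ
      val : ∀ y → ⟦ t ⟧ˡ (extend ρ y) ≡ + suc c *ᶻ y +ᶻ T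
      val y = trans (split-eval ρ y t) (cong (λ c → c *ᶻ y +ᶻ T) eqn)
      lem : ∀ c x T L → c *ᶻ x +ᶻ T -ᶻ c *ᶻ L ≡ c *ᶻ (x -ᶻ L) +ᶻ T
      lem = solve-∀
      root : ∀ cx T u → cx +ᶻ T ≡ u → cx ≡ u +ᶻ -1ℤ *ᶻ T
      root cx T .(cx +ᶻ T) refl = lem′ cx T
        where
        lem′ : ∀ cx T → cx ≡ cx +ᶻ T +ᶻ -1ℤ *ᶻ T
        lem′ = solve-∀
      near-or-far : Dec (∣ ⟦ t ⟧ˡ (extend ρ x) ∣ ≤ suc c * L) → _
      near-or-far (yes p) = inj₁ (window (suc c * L) _ _ _ p
        (λ i e → atFrac-complete c _ x h (root _ T _ (trans (sym (val x)) e)))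
        (λ i e → atFrac-complete c _ x h (root _ T _ (trans (sym (val x)) e))))
      near-or-far (no p) = inj₂ (⟷-trans (far-sign _ (+ suc c *ᶻ + L) (suc c * L) (ℕₚ.≤-reflexive (cong ∣_∣ (sym (ℤₚ.pos-* (suc c) L)))) p)
        (≡⇒⟷ (cong (0ℤ <ᶻ_) (trans (cong (_-ᶻ + suc c *ᶻ + L) (val x)) (trans (lem (+ suc c) x T (+ L)) (sym (val (x -ᶻ + L))))))))
    ... | -[1+ c ] = near-or-far (∣ ⟦ t ⟧ˡ (extend ρ x) ∣ ℕₚ.≤? suc c * L)
      where
      T = ⟦ rest t ⟧ˡ ρ
      val : ∀ y → ⟦ t ⟧ˡ (extend ρ y) ≡ -[1+ c ] *ᶻ y +ᶻ T
      val y = trans (split-eval ρ y t) (cong (λ c → c *ᶻ y +ᶻ T) eqn)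
      lem : ∀ c x T L → -ᶻ c *ᶻ x +ᶻ T -ᶻ -ᶻ (c *ᶻ L) ≡ -ᶻ c *ᶻ (x -ᶻ L) +ᶻ T
      lem = solve-∀
      root : ∀ c x T u → -ᶻ c *ᶻ x +ᶻ T ≡ u → c *ᶻ x ≡ T +ᶻ -ᶻ u
      root c x T .(-ᶻ c *ᶻ x +ᶻ T) refl = lem′ c x T
        where
        lem′ : ∀ c x T → c *ᶻ x ≡ T +ᶻ -ᶻ (-ᶻ c *ᶻ x +ᶻ T)
        lem′ = solve-∀
      near-or-far : Dec (∣ ⟦ t ⟧ˡ (extend ρ x) ∣ ≤ suc c * L) → _
      near-or-far (yes p) = inj₁ (window (suc c * L) _ _ _ p
        (λ i e → atFrac-complete c _ x h (root (+ suc c) x T _ (trans (sym (val x)) e)))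
        (λ i e → atFrac-complete c _ x h (trans (root (+ suc c) x T _ (trans (sym (val x)) e)) (cong (T +ᶻ_) (ℤₚ.neg-involutive (+ i))))))
      near-or-far (no p) = inj₂ (⟷-trans (far-sign _ (-ᶻ (+ suc c *ᶻ + L)) (suc c * L) (ℕₚ.≤-reflexive (trans (ℤₚ.∣-i∣≡∣i∣ (+ suc c *ᶻ + L)) (cong ∣_∣ (sym (ℤₚ.pos-* (suc c) L))))) p)
        (≡⇒⟷ (cong (0ℤ <ᶻ_) (trans (cong (_-ᶻ -ᶻ (+ suc c *ᶻ + L)) (val x)) (trans (lem (+ suc c) x T (+ L)) (sym (val (x -ᶻ + L))))))))
    tests-complete x h (dvd n t) (divides k e) = inj₂ (∣-shift (divides (coef t *ᶻ k)
      (trans (cong₂ _-ᶻ_ (split-eval ρ x t) (split-eval ρ (x -ᶻ + L) t))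
        (trans (cong (λ z → coef t *ᶻ x +ᶻ ⟦ rest t ⟧ˡ ρ -ᶻ (coef t *ᶻ (x -ᶻ z) +ᶻ ⟦ rest t ⟧ˡ ρ)) e) (lem (coef t) x _ k (+ suc n))))))
      where
      lem : ∀ c x T k s → c *ᶻ x +ᶻ T -ᶻ (c *ᶻ (x -ᶻ k *ᶻ s) +ᶻ T) ≡ c *ᶻ k *ᶻ s
      lem = solve-∀
    tests-complete x h (neg φ) per = Sum.map₂ ¬-⟷ (tests-complete x h φ per)
    tests-complete x h (and φ ψ) (per , per′) with tests-complete x h φ per | tests-complete x h ψ per′
    ... | inj₁ p | _ = inj₁ (inj₁ p)
    ... | inj₂ _ | inj₁ p = inj₁ (inj₂ p)
    ... | inj₂ f | inj₂ g = inj₂ (×-⟷ f g)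
    tests-complete x h (or φ ψ) (per , per′) with tests-complete x h φ per | tests-complete x h ψ per′
    ... | inj₁ p | _ = inj₁ (inj₁ p)
    ... | inj₂ _ | inj₁ p = inj₁ (inj₂ p)
    ... | inj₂ f | inj₂ g = inj₂ (⊎-⟷ f g)

-- Cooper's method with the coefficients left as they are, the test points being fractions instead.
-- A solution is moved down by the period again and again: either it comes near the root of an atom,
-- which `tests` detects, or it remains a solution down to the region where `minf` gives the truth
-- value.
eliminate : ∀ {V} → QF (Maybe V) → QF V
eliminate φ = or (orN (suc (pred-period φ)) λ r → minf (+ r) φ) (tests φ (suc (pred-period φ)) φ)

eliminate-spec : ∀ {V} (ρ : V → ℤ) φ → ⟦ eliminate φ ⟧ᵠ ρ ⟷ (Σ ℤ λ x → ⟦ φ ⟧ᵠ (extend ρ x))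
eliminate-spec {V} ρ φ = [ fromMinf , tests-sound φ ℓ ρ φ ]′ , to
  where
  ℓ = suc (pred-period φ)
  L = + ℓ
  -- As `L` is at least 1, this many steps down from `x` are certain to reach `b`.
  below : ∀ b x → x -ᶻ + (∣ x ∣ + ∣ b ∣) *ᶻ L ≤ᶻ b
  below b x = ≤-by (ℤₚ.+-mono-≤ (ℤₚ.+-mono-≤ (i≤∣i∣ x) (-∣i∣≤i b))
                     (ℤₚ.*-monoʳ-≤-nonNeg (+ pred-period φ) (+≤+ (z≤n {∣ x ∣ + ∣ b ∣}))))
    (trans (cong (λ z → b -ᶻ (x -ᶻ z *ᶻ L)) (ℤₚ.pos-+ ∣ x ∣ ∣ b ∣)) (trans (lem b x (+ ∣ x ∣) (+ ∣ b ∣) (+ pred-period φ)) (cong (λ z → + ∣ x ∣ +ᶻ b +ᶻ z *ᶻ + pred-period φ -ᶻ (x +ᶻ -ᶻ (+ ∣ b ∣) +ᶻ 0ℤ *ᶻ + pred-period φ)) (sym (ℤₚ.pos-+ ∣ x ∣ ∣ b ∣)))))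
    where
    lem : ∀ b x X B p → b -ᶻ (x -ᶻ (X +ᶻ B) *ᶻ (1ℤ +ᶻ p)) ≡ X +ᶻ b +ᶻ (X +ᶻ B) *ᶻ p -ᶻ (x +ᶻ -ᶻ B +ᶻ 0ℤ *ᶻ p)
    lem = solve-∀
  fromMinf : ⟦ orN ℓ (λ r → minf (+ r) φ) ⟧ᵠ ρ → Σ ℤ λ x → ⟦ φ ⟧ᵠ (extend ρ x)
  fromMinf h with proj₁ (orN-spec ρ ℓ (λ r → minf (+ r) φ)) h
  ... | r , _ , hr with minf-spec ρ L (+ r) φ (Per-period φ)
  ... | b , spec = + r -ᶻ k *ᶻ L , proj₂ (spec (+ r -ᶻ k *ᶻ L) (-ᶻ k) (below b (+ r)) (lem (+ r) k L)) hr
    where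
    k = + (r + ∣ b ∣)
    lem : ∀ r k L → r -ᶻ k *ᶻ L ≡ r +ᶻ -ᶻ k *ᶻ L
    lem = solve-∀
  descend : ∀ x → ⟦ φ ⟧ᵠ (extend ρ x) → ∀ n → ⟦ tests φ ℓ φ ⟧ᵠ ρ ⊎ ⟦ φ ⟧ᵠ (extend ρ (x -ᶻ + n *ᶻ L))
  descend x h zero = inj₂ (subst (λ z → ⟦ φ ⟧ᵠ (extend ρ z)) (lem x L) h)
    where
    lem : ∀ x L → x ≡ x -ᶻ 0ℤ *ᶻ L
    lem = solve-∀
  descend x h (suc n) with descend x h n
  ... | inj₁ p = inj₁ p
  ... | inj₂ h′ with tests-complete φ ℓ ρ _ h′ φ (Per-period φ)
  ... | inj₁ p = inj₁ p
  ... | inj₂ (f , _) = inj₂ (subst (λ z → ⟦ φ ⟧ᵠ (extend ρ z)) (lem x (+ n) L) (f h′))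
    where
    lem : ∀ x n L → x -ᶻ n *ᶻ L -ᶻ L ≡ x -ᶻ (1ℤ +ᶻ n) *ᶻ L
    lem = solve-∀
  to : (Σ ℤ λ x → ⟦ φ ⟧ᵠ (extend ρ x)) → ⟦ eliminate φ ⟧ᵠ ρ
  to (x , h) with minf-spec ρ L (+ (x %ℕ ℓ)) φ (Per-period φ)
  ... | b , spec with descend x h (∣ x ∣ + ∣ b ∣)
  ... | inj₁ p = inj₂ p
  ... | inj₂ h′ = inj₁ (proj₂ (orN-spec ρ ℓ (λ r → minf (+ r) φ)) (x %ℕ ℓ , n%ℕd<d x ℓ ,
        proj₁ (spec _ (x /ℕ ℓ -ᶻ + (∣ x ∣ + ∣ b ∣)) (below b x)
          (trans (cong (_-ᶻ + (∣ x ∣ + ∣ b ∣) *ᶻ L) (a≡a%ℕn+[a/ℕn]*n x ℓ)) (lem (+ (x %ℕ ℓ)) (x /ℕ ℓ) (+ (∣ x ∣ + ∣ b ∣)) L))) h′))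
    where
    lem : ∀ r q n L → r +ᶻ q *ᶻ L -ᶻ n *ᶻ L ≡ r +ᶻ (q -ᶻ n) *ᶻ L
    lem = solve-∀

abstract
  elim : ∀ {V} → QF (Maybe V) → QF V
  elim = eliminate

  elim-spec : ∀ {V} (ρ : V → ℤ) φ → ⟦ elim φ ⟧ᵠ ρ ⟷ (Σ ℤ λ x → ⟦ φ ⟧ᵠ (extend ρ x))
  elim-spec = eliminate-spec

-- From Presburger formulas to quantifier-free ones

linear : ∀ {V} → Term V → Lin V
linear (var v) = lvar v
linear (con c) = lcon c
linear (t ⊕ u) = linear t ⊞ linear u

linear-eval : ∀ {V} (ρ : V → ℤ) t → ⟦ linear t ⟧ˡ ρ ≡ evalT ρ t
linear-eval ρ (var v) = refl
linear-eval ρ (con c) = refl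
linear-eval ρ (t ⊕ u) = cong₂ _+ᶻ_ (linear-eval ρ t) (linear-eval ρ u)

infixl 6 _⊟_
_⊟_ : ∀ {V} → Lin V → Lin V → Lin V
t ⊟ u = t ⊞ -1ℤ ⊠ u

⊟-eval : ∀ {V} (ρ : V → ℤ) t u → ⟦ t ⊟ u ⟧ˡ ρ ≡ ⟦ t ⟧ˡ ρ -ᶻ ⟦ u ⟧ˡ ρ
⊟-eval ρ t u = lem (⟦ t ⟧ˡ ρ) (⟦ u ⟧ˡ ρ)
  where
  lem : ∀ x y → x +ᶻ -1ℤ *ᶻ y ≡ x -ᶻ y
  lem = solve-∀

ltᵠ leᵠ eqᵠ : ∀ {V} → Lin V → Lin V → QF V
ltᵠ t u = pos (u ⊟ t)
leᵠ t u = neg (ltᵠ u t)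
eqᵠ t u = and (leᵠ t u) (leᵠ u t)

lt-spec : ∀ {V} (ρ : V → ℤ) t u → ⟦ ltᵠ t u ⟧ᵠ ρ ⟷ (⟦ t ⟧ˡ ρ <ᶻ ⟦ u ⟧ˡ ρ)
lt-spec ρ t u =
  (λ h → <-by h (trans (lem (⟦ t ⟧ˡ ρ) (⟦ u ⟧ˡ ρ)) (cong (_-ᶻ 0ℤ) (sym (⊟-eval ρ u t))))) ,
  (λ h → <-by h (trans (cong (_-ᶻ 0ℤ) (⊟-eval ρ u t)) (sym (lem (⟦ t ⟧ˡ ρ) (⟦ u ⟧ˡ ρ)))))
  where
  lem : ∀ x y → y -ᶻ x ≡ y -ᶻ x -ᶻ 0ℤ
  lem = solve-∀

le-spec : ∀ {V} (ρ : V → ℤ) t u → ⟦ leᵠ t u ⟧ᵠ ρ ⟷ (⟦ t ⟧ˡ ρ ≤ᶻ ⟦ u ⟧ˡ ρ)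
le-spec ρ t u =
  (λ h → ℤₚ.≮⇒≥ (λ u<t → h (proj₂ (lt-spec ρ u t) u<t))) ,
  (λ h u<t → ℤₚ.<⇒≱ (proj₁ (lt-spec ρ u t) u<t) h)

eq-spec : ∀ {V} (ρ : V → ℤ) t u → ⟦ eqᵠ t u ⟧ᵠ ρ ⟷ (⟦ t ⟧ˡ ρ ≡ ⟦ u ⟧ˡ ρ)
eq-spec ρ t u =
  (λ (p , q) → ℤₚ.≤-antisym (proj₁ (le-spec ρ t u) p) (proj₁ (le-spec ρ u t) q)) ,
  (λ e → proj₂ (le-spec ρ t u) (ℤₚ.≤-reflexive e) , proj₂ (le-spec ρ u t) (ℤₚ.≤-reflexive (sym e)))

qe : ∀ {V} → PFormula V → QF V
qe (t ≺ u) = ltᵠ (linear t) (linear u)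
qe (t ≐ u) = eqᵠ (linear t) (linear u)
qe (notP φ) = neg (qe φ)
qe (andP φ ψ) = and (qe φ) (qe ψ)
qe (orP φ ψ) = or (qe φ) (qe ψ)
qe (exP φ) = elim (qe φ)
qe (allP φ) = neg (elim (neg (qe φ)))

qe-spec : ∀ {V} (φ : PFormula V) ρ → ⟦ qe φ ⟧ᵠ ρ ⟷ ⟦ φ ⟧ ρ
qe-spec (t ≺ u) ρ = ⟷-trans (lt-spec ρ (linear t) (linear u)) (≡⇒⟷ (cong₂ _<ᶻ_ (linear-eval ρ t) (linear-eval ρ u)))
qe-spec (t ≐ u) ρ = ⟷-trans (eq-spec ρ (linear t) (linear u)) (≡⇒⟷ (cong₂ _≡_ (linear-eval ρ t) (linear-eval ρ u)))
qe-spec (notP φ) ρ = ¬-⟷ (qe-spec φ ρ)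
qe-spec (andP φ ψ) ρ = ×-⟷ (qe-spec φ ρ) (qe-spec ψ ρ)
qe-spec (orP φ ψ) ρ = ⊎-⟷ (qe-spec φ ρ) (qe-spec ψ ρ)
qe-spec (exP φ) ρ = ⟷-trans (elim-spec ρ (qe φ))
  ((λ (a , h) → a , proj₁ (qe-spec φ _) h) , λ (a , h) → a , proj₂ (qe-spec φ _) h)
-- The universal quantifier is eliminated as a negated existential one; this is constructively
-- adequate because `qe φ` is decidable at every value of the variable.
qe-spec (allP φ) ρ =
  (λ h a → [ proj₁ (qe-spec φ _) , (λ n → ⊥-elim (h (proj₂ (elim-spec ρ (neg (qe φ))) (a , n)))) ]′ (lem a)) ,
  (λ h k → let a , n = proj₁ (elim-spec ρ (neg (qe φ))) k in n (proj₂ (qe-spec φ _) (h a)))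
  where
  lem : ∀ a → ⟦ qe φ ⟧ᵠ (extend ρ a) ⊎ ¬ ⟦ qe φ ⟧ᵠ (extend ρ a)
  lem a with dec-QF (qe φ) (extend ρ a)
  ... | yes p = inj₁ p
  ... | no p = inj₂ p

-- Finite types

-- Only a retract of `Fin size`: an enumeration may contain repetitions. Exhaustive search, finite
-- disjunctions and decidable equality need no more, and the closure properties become simple.
record Finite (W : Set) : Set where
  field
    size    : ℕ
    enc     : W → Fin size
    dec     : Fin size → W
    dec-enc : ∀ w → dec (enc w) ≡ w

open Finite

≟-finite : ∀ {W} → Finite W → DecidableEquality W
≟-finite F x y = map′ (λ e → trans (sym (dec-enc F x)) (trans (cong (dec F) e) (dec-enc F y))) (cong (enc F)) (enc F x Finₚ.≟ enc F y)

any-finite : ∀ {W} {P : W → Set} → Finite W → (∀ w → Dec (P w)) → Dec (Σ W P)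
any-finite {P = P} F P? = map′ (λ (i , p) → dec F i , p) (λ (w , p) → enc F w , subst P (sym (dec-enc F w)) p) (Finₚ.any? (λ i → P? (dec F i)))

finite-retract : ∀ {V W} (f : V → W) (g : W → V) → (∀ v → g (f v) ≡ v) → Finite W → Finite V
finite-retract f g gf F = record
  { size = size F ; enc = λ v → enc F (f v) ; dec = λ i → g (dec F i)
  ; dec-enc = λ v → trans (cong g (dec-enc F (f v))) (gf v) }

finite-Fin : ∀ n → Finite (Fin n)
finite-Fin n = record { size = n ; enc = id ; dec = id ; dec-enc = λ _ → refl }

finite-⊎ : ∀ {V W} → Finite V → Finite W → Finite (V ⊎ W)
finite-⊎ {V} {W} F G = record
  { size = size F + size G
  ; enc = λ x → Fin.join (size F) (size G) (Sum.map (enc F) (enc G) x)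
  ; dec = λ i → Sum.map (dec F) (dec G) (Fin.splitAt (size F) i)
  ; dec-enc = λ x → trans (cong (Sum.map (dec F) (dec G)) (Finₚ.splitAt-join (size F) (size G) (Sum.map (enc F) (enc G) x))) (lem x) }
  where
  lem : ∀ x → Sum.map (dec F) (dec G) (Sum.map (enc F) (enc G) x) ≡ x
  lem (inj₁ v) = cong inj₁ (dec-enc F v)
  lem (inj₂ w) = cong inj₂ (dec-enc G w)

finite-× : ∀ {V W} → Finite V → Finite W → Finite (V × W)
finite-× F G = record
  { size = size F * size G
  ; enc = λ (v , w) → Fin.combine (enc F v) (enc G w)
  ; dec = λ i → let a , b = Fin.remQuot (size G) i in dec F a , dec G b
  ; dec-enc = λ (v , w) → trans (cong (λ (a , b) → dec F a , dec G b) (Finₚ.remQuot-combine (enc F v) (enc G w)))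
                                (cong₂ _,_ (dec-enc F v) (dec-enc G w)) }

finite-Bool : Finite Bool
finite-Bool = finite-retract (λ { false → zero ; true → suc zero }) (λ { zero → false ; (suc zero) → true })
  (λ { false → refl ; true → refl }) (finite-Fin 2)

finite-Maybe : ∀ {V} → Finite V → Finite (Maybe V)
finite-Maybe {V} F = finite-retract (λ { nothing → inj₁ zero ; (just v) → inj₂ v }) [ (λ _ → nothing) , just ]′
  (λ { nothing → refl ; (just v) → refl }) (finite-⊎ (finite-Fin 1) F)

finite-Vec : ∀ {V} → Finite V → ∀ n → Finite (Vec V n)
finite-Vec F zero = finite-retract (λ _ → zero) (λ _ → []) (λ { [] → refl }) (finite-Fin 1)
finite-Vec F (suc n) = finite-retract (λ { (x ∷ xs) → x , xs }) (λ (x , xs) → x ∷ xs) (λ { (x ∷ xs) → refl }) (finite-× F (finite-Vec F n))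

-- Quantification over finite blocks of variables and finite connectives

popVar : ∀ {V n} → V ⊎ Fin (suc n) → Lin (Maybe (V ⊎ Fin n))
popVar (inj₁ v) = lvar (just (inj₁ v))
popVar (inj₂ zero) = lvar nothing
popVar (inj₂ (suc i)) = lvar (just (inj₂ i))

exFin : ∀ {V} n → QF (V ⊎ Fin n) → QF V
exFin zero φ = sub [ lvar , (λ ()) ]′ φ
exFin (suc n) φ = exFin n (elim (sub popVar φ))

exFin-spec : ∀ {V} (ρ : V → ℤ) n φ → ⟦ exFin n φ ⟧ᵠ ρ ⟷ (Σ (Fin n → ℤ) λ f → ⟦ φ ⟧ᵠ [ ρ , f ]′)
exFin-spec ρ zero φ =
  (λ h → (λ ()) , proj₁ (sub-eval _ ρ [ ρ , (λ ()) ]′ (λ { (inj₁ v) → refl ; (inj₂ ()) }) φ) h) ,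
  (λ (f , h) → proj₂ (sub-eval _ ρ [ ρ , f ]′ (λ { (inj₁ v) → refl ; (inj₂ ()) }) φ) h)
exFin-spec ρ (suc n) φ = ⟷-trans (exFin-spec ρ n (elim (sub popVar φ)))
  ((λ (f , h) → let a , h′ = proj₁ (elim-spec [ ρ , f ]′ (sub popVar φ)) h in
      (λ { zero → a ; (suc i) → f i }) , proj₁ (sub-eval popVar (extend [ ρ , f ]′ a) _ (λ { (inj₁ v) → refl ; (inj₂ zero) → refl ; (inj₂ (suc i)) → refl }) φ) h′) ,
   (λ (f , h) → (λ i → f (suc i)) , proj₂ (elim-spec [ ρ , (λ i → f (suc i)) ]′ (sub popVar φ))
      (f zero , proj₂ (sub-eval popVar (extend [ ρ , (λ i → f (suc i)) ]′ (f zero)) _ (λ { (inj₁ v) → refl ; (inj₂ zero) → refl ; (inj₂ (suc i)) → refl }) φ) h)))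

exF : ∀ {V W} → Finite W → QF (V ⊎ W) → QF V
exF F φ = exFin (size F) (sub [ (λ v → lvar (inj₁ v)) , (λ w → lvar (inj₂ (enc F w))) ]′ φ)

exF-spec : ∀ {V W} (F : Finite W) (ρ : V → ℤ) φ → ⟦ exF F φ ⟧ᵠ ρ ⟷ (Σ (W → ℤ) λ f → ⟦ φ ⟧ᵠ [ ρ , f ]′)
exF-spec F ρ φ = ⟷-trans (exFin-spec ρ (size F) _)
  ((λ (f , h) → (λ w → f (enc F w)) , proj₁ (sub-eval _ [ ρ , f ]′ _ (λ { (inj₁ v) → refl ; (inj₂ w) → refl }) φ) h) ,
   (λ (f , h) → (λ i → f (dec F i)) , proj₂ (sub-eval _ [ ρ , (λ i → f (dec F i)) ]′ _ (λ { (inj₁ v) → refl ; (inj₂ w) → cong f (dec-enc F w) }) φ) h))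

orFin andFin : ∀ {V} n → (Fin n → QF V) → QF V
orFin zero f = ffᵠ
orFin (suc n) f = or (f zero) (orFin n (λ i → f (suc i)))
andFin zero f = ttᵠ
andFin (suc n) f = and (f zero) (andFin n (λ i → f (suc i)))

orFin-spec : ∀ {V} (ρ : V → ℤ) n f → ⟦ orFin n f ⟧ᵠ ρ ⟷ (Σ (Fin n) λ i → ⟦ f i ⟧ᵠ ρ)
orFin-spec ρ zero f = (λ h → ⊥-elim (ff-fails {ρ = ρ} h)) , λ ()
orFin-spec ρ (suc n) f =
  [ (λ h → zero , h) , (λ h → let i , p = proj₁ (orFin-spec ρ n (λ i → f (suc i))) h in suc i , p) ]′ ,
  λ { (zero , h) → inj₁ h ; (suc i , h) → inj₂ (proj₂ (orFin-spec ρ n (λ i → f (suc i))) (i , h)) }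

andFin-spec : ∀ {V} (ρ : V → ℤ) n f → ⟦ andFin n f ⟧ᵠ ρ ⟷ (∀ i → ⟦ f i ⟧ᵠ ρ)
andFin-spec ρ zero f = (λ _ ()) , λ _ → tt-holds {ρ = ρ}
andFin-spec ρ (suc n) f =
  (λ { (h , k) zero → h ; (h , k) (suc i) → proj₁ (andFin-spec ρ n (λ i → f (suc i))) k i }) ,
  λ h → h zero , proj₂ (andFin-spec ρ n (λ i → f (suc i))) (λ i → h (suc i))

orF andF : ∀ {V W} → Finite W → (W → QF V) → QF V
orF F f = orFin (size F) (λ i → f (dec F i))
andF F f = andFin (size F) (λ i → f (dec F i))

orF-spec : ∀ {V W} (F : Finite W) (ρ : V → ℤ) f → ⟦ orF F f ⟧ᵠ ρ ⟷ (Σ W λ w → ⟦ f w ⟧ᵠ ρ)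
orF-spec F ρ f = ⟷-trans (orFin-spec ρ (size F) _)
  ((λ (i , h) → dec F i , h) , λ (w , h) → enc F w , subst (λ w → ⟦ f w ⟧ᵠ ρ) (sym (dec-enc F w)) h)

andF-spec : ∀ {V W} (F : Finite W) (ρ : V → ℤ) f → ⟦ andF F f ⟧ᵠ ρ ⟷ (∀ w → ⟦ f w ⟧ᵠ ρ)
andF-spec F ρ f = ⟷-trans (andFin-spec ρ (size F) _)
  ((λ h w → subst (λ w → ⟦ f w ⟧ᵠ ρ) (dec-enc F w) (h (enc F w))) , λ h i → h (dec F i))

-- Commutative regular expressions and systems of inequations (Parikh's theorem)

module Parikh {M : Set} {_∙_ : M → M → M} {ε : M} (isCM : IsCommutativeMonoid _≡_ _∙_ ε) where

  open IsCommutativeMonoid isCM using (assoc; comm; identityˡ; identityʳ)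

  interchange : ∀ a b c d → (a ∙ b) ∙ (c ∙ d) ≡ (a ∙ c) ∙ (b ∙ d)
  interchange a b c d = begin
    (a ∙ b) ∙ (c ∙ d) ≡⟨ assoc a b (c ∙ d) ⟩
    a ∙ (b ∙ (c ∙ d)) ≡⟨ cong (a ∙_) (sym (assoc b c d)) ⟩
    a ∙ ((b ∙ c) ∙ d) ≡⟨ cong (λ z → a ∙ (z ∙ d)) (comm b c) ⟩
    a ∙ ((c ∙ b) ∙ d) ≡⟨ cong (a ∙_) (assoc c b d) ⟩
    a ∙ (c ∙ (b ∙ d)) ≡⟨ sym (assoc a c (b ∙ d)) ⟩
    (a ∙ c) ∙ (b ∙ d) ∎
    where open ≡-Reasoning

  leftComm : ∀ a b c → a ∙ (b ∙ c) ≡ b ∙ (a ∙ c)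
  leftComm a b c = trans (sym (assoc a b c)) (trans (cong (_∙ c) (comm a b)) (assoc b a c))

  Lang : Set₁
  Lang = M → Set

  infix 4 _⊆_
  _⊆_ : Lang → Lang → Set
  L ⊆ K = ∀ w → L w → K w

  data Star (L : Lang) : Lang where
    nil  : Star L ε
    cons : ∀ {u v} → L u → Star L v → Star L (u ∙ v)

  Prod : Lang → Lang → Lang
  Prod L K w = Σ M λ u → Σ M λ v → L u × K v × w ≡ u ∙ v

  star-mono : ∀ {L K} → L ⊆ K → Star L ⊆ Star K
  star-mono f _ nil = nil
  star-mono f _ (cons l s) = cons (f _ l) (star-mono f _ s)

  star-∙ : ∀ {L u v} → Star L u → Star L v → Star L (u ∙ v)
  star-∙ {L} {v = v} nil t = subst (Star L) (sym (identityˡ v)) t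
  star-∙ {L} {v = v} (cons {u} {u′} l s) t = subst (Star L) (sym (assoc u u′ v)) (cons l (star-∙ s t))

  data Exp (V : Set) : Set where
    ∅    : Exp V
    ⟨_⟩  : M → Exp V
    _∪_  : Exp V → Exp V → Exp V
    _·_  : Exp V → Exp V → Exp V
    _⋆   : Exp V → Exp V
    evar : V → Exp V

  ⟦_⟧ᵉ : ∀ {V} → Exp V → (V → Lang) → Lang
  ⟦ ∅ ⟧ᵉ ρ w = ⊥
  ⟦ ⟨ g ⟩ ⟧ᵉ ρ w = w ≡ g
  ⟦ e ∪ f ⟧ᵉ ρ w = ⟦ e ⟧ᵉ ρ w ⊎ ⟦ f ⟧ᵉ ρ w
  ⟦ e · f ⟧ᵉ ρ = Prod (⟦ e ⟧ᵉ ρ) (⟦ f ⟧ᵉ ρ)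
  ⟦ e ⋆ ⟧ᵉ ρ = Star (⟦ e ⟧ᵉ ρ)
  ⟦ evar v ⟧ᵉ ρ = ρ v

  subᵉ : ∀ {V W} → (V → Exp W) → Exp V → Exp W
  subᵉ τ ∅ = ∅
  subᵉ τ ⟨ g ⟩ = ⟨ g ⟩
  subᵉ τ (e ∪ f) = subᵉ τ e ∪ subᵉ τ f
  subᵉ τ (e · f) = subᵉ τ e · subᵉ τ f
  subᵉ τ (e ⋆) = subᵉ τ e ⋆
  subᵉ τ (evar v) = τ v

  sub-⊆ : ∀ {V W} (τ : V → Exp W) ρ ρ′ → (∀ v → ⟦ τ v ⟧ᵉ ρ ⊆ ρ′ v) → ∀ e → ⟦ subᵉ τ e ⟧ᵉ ρ ⊆ ⟦ e ⟧ᵉ ρ′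
  sub-⊆ τ ρ ρ′ h ⟨ g ⟩ w p = p
  sub-⊆ τ ρ ρ′ h (e ∪ f) w = Sum.map (sub-⊆ τ ρ ρ′ h e w) (sub-⊆ τ ρ ρ′ h f w)
  sub-⊆ τ ρ ρ′ h (e · f) w (u , v , p , q , r) = u , v , sub-⊆ τ ρ ρ′ h e u p , sub-⊆ τ ρ ρ′ h f v q , r
  sub-⊆ τ ρ ρ′ h (e ⋆) w = star-mono (sub-⊆ τ ρ ρ′ h e) w
  sub-⊆ τ ρ ρ′ h (evar v) w = h v w

  sub-⊇ : ∀ {V W} (τ : V → Exp W) ρ ρ′ → (∀ v → ρ′ v ⊆ ⟦ τ v ⟧ᵉ ρ) → ∀ e → ⟦ e ⟧ᵉ ρ′ ⊆ ⟦ subᵉ τ e ⟧ᵉ ρ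
  sub-⊇ τ ρ ρ′ h ⟨ g ⟩ w p = p
  sub-⊇ τ ρ ρ′ h (e ∪ f) w = Sum.map (sub-⊇ τ ρ ρ′ h e w) (sub-⊇ τ ρ ρ′ h f w)
  sub-⊇ τ ρ ρ′ h (e · f) w (u , v , p , q , r) = u , v , sub-⊇ τ ρ ρ′ h e u p , sub-⊇ τ ρ ρ′ h f v q , r
  sub-⊇ τ ρ ρ′ h (e ⋆) w = star-mono (sub-⊇ τ ρ ρ′ h e) w
  sub-⊇ τ ρ ρ′ h (evar v) w = h v w

  mono : ∀ {V} {ρ ρ′ : V → Lang} → (∀ v → ρ v ⊆ ρ′ v) → ∀ e → ⟦ e ⟧ᵉ ρ ⊆ ⟦ e ⟧ᵉ ρ′
  mono h ⟨ g ⟩ w p = p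
  mono h (e ∪ f) w = Sum.map (mono h e w) (mono h f w)
  mono h (e · f) w (u , v , p , q , r) = u , v , mono h e u p , mono h f v q , r
  mono h (e ⋆) w = star-mono (mono h e) w
  mono h (evar v) w = h v w

  -- With x the variable zero, f(x) = base f ∪ x · der f (x).
  base : ∀ {n} → Exp (Fin (suc n)) → Exp (Fin n)
  base = subᵉ λ { zero → ∅ ; (suc i) → evar i }

  der : ∀ {n} → Exp (Fin (suc n)) → Exp (Fin (suc n))
  der ∅ = ∅
  der ⟨ g ⟩ = ∅
  der (e ∪ f) = der e ∪ der f
  der (e · f) = (der e · f) ∪ (e · der f)
  der (e ⋆) = der e · (e ⋆)
  der (evar zero) = ⟨ ε ⟩
  der (evar (suc i)) = ∅

  infixr 5 _◂_
  _◂_ : ∀ {n} → Lang → (Fin n → Lang) → Fin (suc n) → Lang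
  (L ◂ ρ) zero = L
  (L ◂ ρ) (suc i) = ρ i

  module _ {n} (ρ : Fin n → Lang) where

    base-⊆ : ∀ X f → ⟦ base f ⟧ᵉ ρ ⊆ ⟦ f ⟧ᵉ (X ◂ ρ)
    base-⊆ X = sub-⊆ _ ρ (X ◂ ρ) (λ { zero w () ; (suc i) w p → p })

    der-⊆ : ∀ X f → Prod X (⟦ der f ⟧ᵉ (X ◂ ρ)) ⊆ ⟦ f ⟧ᵉ (X ◂ ρ)
    der-⊆ X (e ∪ f) w (u , v , p , inj₁ q , r) = inj₁ (der-⊆ X e w (u , v , p , q , r))
    der-⊆ X (e ∪ f) w (u , v , p , inj₂ q , r) = inj₂ (der-⊆ X f w (u , v , p , q , r))
    der-⊆ X (e · f) w (u , _ , p , inj₁ (a , b , q , q′ , refl) , refl) =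
      u ∙ a , b , der-⊆ X e _ (u , a , p , q , refl) , q′ , sym (assoc u a b)
    der-⊆ X (e · f) w (u , _ , p , inj₂ (a , b , q , q′ , refl) , refl) =
      a , u ∙ b , q , der-⊆ X f _ (u , b , p , q′ , refl) , leftComm u a b
    der-⊆ X (e ⋆) w (u , _ , p , (a , b , q , q′ , refl) , refl) =
      subst (Star _) (assoc u a b) (cons (der-⊆ X e _ (u , a , p , q , refl)) q′)
    der-⊆ X (evar zero) w (u , _ , p , refl , refl) = subst X (sym (identityʳ u)) p

    decompose : ∀ X f → ⟦ f ⟧ᵉ (X ◂ ρ) ⊆ (λ w → ⟦ base f ⟧ᵉ ρ w ⊎ Prod X (⟦ der f ⟧ᵉ (X ◂ ρ)) w)
    decompose X ⟨ g ⟩ w p = inj₁ p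
    decompose X (e ∪ f) w (inj₁ p) with decompose X e w p
    ... | inj₁ q = inj₁ (inj₁ q)
    ... | inj₂ (u , v , q , r , s) = inj₂ (u , v , q , inj₁ r , s)
    decompose X (e ∪ f) w (inj₂ p) with decompose X f w p
    ... | inj₁ q = inj₁ (inj₂ q)
    ... | inj₂ (u , v , q , r , s) = inj₂ (u , v , q , inj₂ r , s)
    decompose X (e · f) w (a , b , p , q , refl) with decompose X e a p | decompose X f b q
    ... | inj₂ (u , v , x , d , refl) | _ = inj₂ (u , v ∙ b , x , inj₁ (v , b , d , q , refl) , assoc u v b)
    ... | inj₁ _ | inj₂ (u , v , x , d , refl) = inj₂ (u , a ∙ v , x , inj₂ (a , v , p , d , refl) , leftComm a u v)
    ... | inj₁ p′ | inj₁ q′ = inj₁ (a , b , p′ , q′ , refl)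
    decompose X (e ⋆) w nil = inj₁ nil
    decompose X (e ⋆) w (cons {a} {b} p s) with decompose X e a p | decompose X (e ⋆) b s
    ... | inj₂ (u , v , x , d , refl) | _ = inj₂ (u , v ∙ b , x , (v , b , d , s , refl) , assoc u v b)
    ... | inj₁ _ | inj₂ (u , _ , x , (v , c , d , s′ , refl) , refl) =
      inj₂ (u , v ∙ (a ∙ c) , x , (v , a ∙ c , d , cons p s′ , refl) , trans (leftComm a u (v ∙ c)) (cong (u ∙_) (leftComm a v c)))
    ... | inj₁ p′ | inj₁ s′ = inj₁ (cons p′ s′)
    decompose X (evar zero) w p = inj₂ (w , ε , p , refl , sym (identityʳ w))
    decompose X (evar (suc i)) w p = inj₁ p

    -- By commutativity the elements of `G` contributed by the single occurrences of the variable
    -- can be collected at the end. The converse inclusion fails when the variable does not occur,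
    -- as nothing can then absorb `Star G`.
    pump : ∀ (A G : Lang) e → ⟦ e ⟧ᵉ (Prod A (Star G) ◂ ρ) ⊆ Prod (⟦ e ⟧ᵉ (A ◂ ρ)) (Star G)
    pump A G ⟨ g ⟩ w p = w , ε , p , nil , sym (identityʳ w)
    pump A G (e ∪ f) w (inj₁ p) with pump A G e w p
    ... | u , v , q , s , r = u , v , inj₁ q , s , r
    pump A G (e ∪ f) w (inj₂ p) with pump A G f w p
    ... | u , v , q , s , r = u , v , inj₂ q , s , r
    pump A G (e · f) w (a , b , p , q , refl) with pump A G e a p | pump A G f b q
    ... | u , v , p′ , s , refl | u′ , v′ , q′ , s′ , refl =
      u ∙ u′ , v ∙ v′ , (u , u′ , p′ , q′ , refl) , star-∙ s s′ , interchange u v u′ v′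
    pump A G (e ⋆) w nil = ε , ε , nil , nil , sym (identityʳ ε)
    pump A G (e ⋆) w (cons {a} {b} p t) with pump A G e a p | pump A G (e ⋆) b t
    ... | u , v , p′ , s , refl | u′ , v′ , q′ , s′ , refl =
      u ∙ u′ , v ∙ v′ , cons p′ q′ , star-∙ s s′ , interchange u v u′ v′
    pump A G (evar zero) w p = p
    pump A G (evar (suc i)) w p = w , ε , p , nil , sym (identityʳ w)

  -- The least solution of f(x) ⊆ x is a·g(a)⋆, where f(x) = a ∪ x·g(x).
  put : ∀ {n} → Exp (Fin n) → Fin (suc n) → Exp (Fin n)
  put s zero = s
  put s (suc i) = evar i

  least : ∀ {n} → Exp (Fin (suc n)) → Exp (Fin n)
  least f = base f · (subᵉ (put (base f)) (der f) ⋆)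

  module _ {n} (ρ : Fin n → Lang) (f : Exp (Fin (suc n))) where

    private
      A G S : Lang
      A = ⟦ base f ⟧ᵉ ρ
      G = ⟦ subᵉ (put (base f)) (der f) ⟧ᵉ ρ
      S = ⟦ least f ⟧ᵉ ρ

    -- The Hopkins-Kozen formula for one commutative inequation. With `S = A · G⋆`, `pump` bounds
    -- g(S) by `G · G⋆`, so that f(S), which is `A` together with `S` · g(S), lies in `A · G⋆`
    -- again.
    least-closed : ⟦ f ⟧ᵉ (S ◂ ρ) ⊆ S
    least-closed w p with decompose ρ S f w p
    ... | inj₁ q = w , ε , q , nil , sym (identityʳ w)
    ... | inj₂ (_ , v , (a , s , pa , ps , refl) , d , refl) with pump ρ A G (der f) v d
    ... | g , t , pg , pt , refl = a , (s ∙ (g ∙ t)) , pa ,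
          star-∙ ps (cons (sub-⊇ _ ρ (A ◂ ρ) (λ { zero w p → p ; (suc i) w p → p }) (der f) g pg) pt) ,
          assoc a s (g ∙ t)

    -- A closed `X` contains `A`, hence g(X) contains `G`, and `X` absorbs each factor from g(X)
    -- because their product lies in f(X).
    least-least : ∀ X → ⟦ f ⟧ᵉ (X ◂ ρ) ⊆ X → S ⊆ X
    least-least X cl w (a , s , pa , ps , refl) = absorb ps (cl a (base-⊆ ρ X f a pa))
      where
      A⊆X : A ⊆ X
      A⊆X w p = cl w (base-⊆ ρ X f w p)
      G⊆ : G ⊆ ⟦ der f ⟧ᵉ (X ◂ ρ)
      G⊆ = sub-⊆ _ ρ (X ◂ ρ) (λ { zero → A⊆X ; (suc i) w p → p }) (der f)
      absorb : ∀ {x s} → Star G s → X x → X (x ∙ s)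
      absorb {x} nil px = subst X (sym (identityʳ x)) px
      absorb {x} (cons {u} {v} g s) px =
        subst X (assoc x u v) (absorb s (cl _ (der-⊆ ρ X f _ (x , u , px , G⊆ u g , refl))))

  -- Elimination as in Gauss' algorithm, or Bekić's principle: the first inequation is solved with
  -- the other variables as parameters, its solution is substituted into the rest, and the rest is
  -- solved recursively.
  solve : ∀ n → (Fin n → Exp (Fin n)) → Fin n → Exp (Fin 0)
  reduced : ∀ {n} → (Fin (suc n) → Exp (Fin (suc n))) → Fin n → Exp (Fin n)
  reduced G i = subᵉ (put (least (G zero))) (G (suc i))
  solve (suc n) G zero = subᵉ (solve n (reduced G)) (least (G zero))
  solve (suc n) G (suc i) = solve n (reduced G) i

  none : Fin 0 → Lang
  none ()

  Sol : ∀ {n} → (Fin n → Exp (Fin n)) → Fin n → Lang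
  Sol {n} G i = ⟦ solve n G i ⟧ᵉ none

  solve-closed : ∀ n (G : Fin n → Exp (Fin n)) i → ⟦ G i ⟧ᵉ (Sol G) ⊆ Sol G i
  solve-closed (suc n) G i w p = go i (mono (λ { zero → into ; (suc j) w p → p }) (G i) w p)
    where
    ρ = Sol (reduced G)
    into : Sol G zero ⊆ ⟦ least (G zero) ⟧ᵉ ρ
    into = sub-⊆ _ none ρ (λ v w p → p) (least (G zero))
    out : ⟦ least (G zero) ⟧ᵉ ρ ⊆ Sol G zero
    out = sub-⊇ _ none ρ (λ v w p → p) (least (G zero))
    go : ∀ i {w} → ⟦ G i ⟧ᵉ (⟦ least (G zero) ⟧ᵉ ρ ◂ ρ) w → Sol G i w
    go zero {w} p = out w (least-closed ρ (G zero) w p)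
    go (suc j) {w} p = solve-closed n (reduced G) j w
      (sub-⊇ _ ρ _ (λ { zero w p → p ; (suc k) w p → p }) (G (suc j)) w p)

  solve-least : ∀ n (G : Fin n → Exp (Fin n)) (L : Fin n → Lang) → (∀ i → ⟦ G i ⟧ᵉ L ⊆ L i) → ∀ i → Sol G i ⊆ L i
  solve-least (suc n) G L cl = go
    where
    L′ : Fin n → Lang
    L′ i = L (suc i)
    S⊆ : ⟦ least (G zero) ⟧ᵉ L′ ⊆ L zero
    S⊆ = least-least L′ (G zero) (L zero) (λ w p → cl zero w (mono (λ { zero w p → p ; (suc k) w p → p }) (G zero) w p))
    rec : ∀ i → Sol (reduced G) i ⊆ L′ i
    rec = solve-least n (reduced G) L′ λ i w p → cl (suc i) w
      (sub-⊆ _ L′ L (λ { zero → S⊆ ; (suc k) w p → p }) (G (suc i)) w p)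
    go : ∀ i → Sol G i ⊆ L i
    go zero w p = S⊆ w (sub-⊆ _ none L′ rec (least (G zero)) w p)
    go (suc i) = rec i

  -- Semilinear sets

  mult : ℕ → M → M
  mult zero p = ε
  mult (suc n) p = p ∙ mult n p

  Span : List M → Lang
  Span [] w = w ≡ ε
  Span (p ∷ ps) w = Σ ℕ λ n → Σ M λ u → Span ps u × w ≡ mult n p ∙ u

  Linear : M × List M → Lang
  Linear (b , ps) w = Σ M λ u → Span ps u × w ≡ b ∙ u

  Semilinear : List (M × List M) → Lang
  Semilinear [] w = ⊥
  Semilinear (l ∷ ls) w = Linear l w ⊎ Semilinear ls w

  span-ε : ∀ ps → Span ps ε
  span-ε [] = refl
  span-ε (p ∷ ps) = 0 , ε , span-ε ps , sym (identityʳ ε)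

  mult-+ : ∀ m n p → mult (m + n) p ≡ mult m p ∙ mult n p
  mult-+ zero n p = sym (identityˡ _)
  mult-+ (suc m) n p = trans (cong (p ∙_) (mult-+ m n p)) (sym (assoc p _ _))

  span-∙ : ∀ ps {u v} → Span ps u → Span ps v → Span ps (u ∙ v)
  span-∙ [] refl refl = identityʳ ε
  span-∙ (p ∷ ps) (m , u , s , refl) (n , v , t , refl) =
    m + n , u ∙ v , span-∙ ps s t , trans (interchange (mult m p) u (mult n p) v) (cong (_∙ (u ∙ v)) (sym (mult-+ m n p)))

  span-++ : ∀ ps qs {u v} → Span ps u → Span qs v → Span (ps ++ qs) (u ∙ v)
  span-++ [] qs {v = v} refl t = subst (Span qs) (sym (identityˡ v)) t
  span-++ (p ∷ ps) qs {v = v} (n , u , s , refl) t = n , u ∙ v , span-++ ps qs s t , assoc (mult n p) u v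

  span-++⁻ : ∀ ps qs {w} → Span (ps ++ qs) w → Prod (Span ps) (Span qs) w
  span-++⁻ [] qs {w} s = ε , w , refl , s , sym (identityˡ w)
  span-++⁻ (p ∷ ps) qs (n , u , s , refl) with span-++⁻ ps qs s
  ... | a , b , sa , sb , refl = mult n p ∙ a , b , (n , a , sa , refl) , sb , sym (assoc (mult n p) a b)

  _⊗_ : M × List M → M × List M → M × List M
  (b , ps) ⊗ (c , qs) = b ∙ c , ps ++ qs

  linear-⊗ : ∀ l k {u v} → Linear l u → Linear k v → Linear (l ⊗ k) (u ∙ v)
  linear-⊗ (b , ps) (c , qs) (u , s , refl) (v , t , refl) = u ∙ v , span-++ ps qs s t , interchange b u c v

  linear-⊗⁻ : ∀ l k → Linear (l ⊗ k) ⊆ Prod (Linear l) (Linear k)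
  linear-⊗⁻ (b , ps) (c , qs) w (u , s , refl) with span-++⁻ ps qs s
  ... | x , y , sx , sy , refl = b ∙ x , c ∙ y , (x , sx , refl) , (y , sy , refl) , interchange b c x y

  semi-++ : ∀ ls ks w → Semilinear (ls ++ ks) w ⟷ (Semilinear ls w ⊎ Semilinear ks w)
  semi-++ [] ks w = inj₂ , λ { (inj₂ p) → p }
  semi-++ (l ∷ ls) ks w =
    (λ { (inj₁ p) → inj₁ (inj₁ p) ; (inj₂ p) → Sum.map₁ inj₂ (proj₁ (semi-++ ls ks w) p) }) ,
    (λ { (inj₁ (inj₁ p)) → inj₁ p ; (inj₁ (inj₂ p)) → inj₂ (proj₂ (semi-++ ls ks w) (inj₁ p)) ; (inj₂ p) → inj₂ (proj₂ (semi-++ ls ks w) (inj₂ p)) })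

  scale : M × List M → List (M × List M) → List (M × List M)
  scale l [] = []
  scale l (k ∷ ks) = (l ⊗ k) ∷ scale l ks

  prodˢ : List (M × List M) → List (M × List M) → List (M × List M)
  prodˢ [] ks = []
  prodˢ (l ∷ ls) ks = scale l ks ++ prodˢ ls ks

  scale-spec : ∀ l ks w → Semilinear (scale l ks) w ⟷ Prod (Linear l) (Semilinear ks) w
  scale-spec l [] w = (λ ()) , λ { (_ , _ , _ , () , _) }
  scale-spec l (k ∷ ks) w =
    (λ { (inj₁ p) → let u , v , a , b , r = linear-⊗⁻ l k w p in u , v , a , inj₁ b , r
       ; (inj₂ p) → let u , v , a , b , r = proj₁ (scale-spec l ks w) p in u , v , a , inj₂ b , r }) ,
    (λ { (u , v , a , inj₁ b , refl) → inj₁ (linear-⊗ l k a b)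
       ; (u , v , a , inj₂ b , r) → inj₂ (proj₂ (scale-spec l ks w) (u , v , a , b , r)) })

  prod-spec : ∀ ls ks w → Semilinear (prodˢ ls ks) w ⟷ Prod (Semilinear ls) (Semilinear ks) w
  prod-spec [] ks w = (λ ()) , λ { (_ , _ , () , _) }
  prod-spec (l ∷ ls) ks w = ⟷-trans (semi-++ (scale l ks) (prodˢ ls ks) w)
    ([ (λ p → let u , v , a , b , r = proj₁ (scale-spec l ks w) p in u , v , inj₁ a , b , r)
     , (λ p → let u , v , a , b , r = proj₁ (prod-spec ls ks w) p in u , v , inj₂ a , b , r) ]′ ,
     λ { (u , v , inj₁ a , b , r) → inj₁ (proj₂ (scale-spec l ks w) (u , v , a , b , r))
       ; (u , v , inj₂ a , b , r) → inj₂ (proj₂ (prod-spec ls ks w) (u , v , a , b , r)) })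

  -- A nonempty sum of elements of a linear set contains the base at least once; further copies of
  -- the base act as a period, and the given periods are available from the first copy on.
  starLinear : M × List M → List (M × List M)
  starLinear (b , ps) = (ε , []) ∷ (b , b ∷ ps) ∷ []

  -- In a commutative monoid the star of a union is the product of the stars.
  starˢ : List (M × List M) → List (M × List M)
  starˢ [] = (ε , []) ∷ []
  starˢ (l ∷ ls) = prodˢ (starLinear l) (starˢ ls)

  starLinear-⊆ : ∀ l → Semilinear (starLinear l) ⊆ Star (Linear l)
  starLinear-⊆ (b , ps) w (inj₁ (_ , refl , refl)) = subst (Star _) (sym (identityʳ ε)) nil
  starLinear-⊆ (b , ps) w (inj₂ (inj₁ (_ , (n , u , s , refl) , refl))) =
    subst (Star _) (trans (assoc b u (mult n b)) (cong (b ∙_) (comm u (mult n b)))) (cons (u , s , refl) (copies n))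
    where
    copies : ∀ n → Star (Linear (b , ps)) (mult n b)
    copies zero = nil
    copies (suc n) = cons (ε , span-ε ps , sym (identityʳ b)) (copies n)

  starLinear-cons : ∀ l {u v} → Linear l u → Semilinear (starLinear l) v → Semilinear (starLinear l) (u ∙ v)
  starLinear-cons (b , ps) (x , s , refl) (inj₁ (_ , refl , refl)) =
    inj₂ (inj₁ (x , (0 , x , s , sym (identityˡ x)) , trans (cong ((b ∙ x) ∙_) (identityʳ ε)) (identityʳ (b ∙ x))))
  starLinear-cons (b , ps) (x , s , refl) (inj₂ (inj₁ (_ , (n , y , t , refl) , refl))) =
    inj₂ (inj₁ (b ∙ x ∙′ (mult n b ∙ y) , (suc n , x ∙ y , span-∙ ps s t , eq₂) , eq₁))
    where
    _∙′_ = _∙_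
    infixl 5 _∙′_
    eq₁ : (b ∙ x) ∙ (b ∙ (mult n b ∙ y)) ≡ b ∙ ((b ∙ x) ∙ (mult n b ∙ y))
    eq₁ = leftComm (b ∙ x) b (mult n b ∙ y)
    eq₂ : (b ∙ x) ∙ (mult n b ∙ y) ≡ (b ∙ mult n b) ∙ (x ∙ y)
    eq₂ = interchange b x (mult n b) y

  star-ε : ∀ ls → Semilinear (starˢ ls) ε
  star-ε [] = inj₁ (ε , refl , sym (identityʳ ε))
  star-ε (l ∷ ls) = proj₂ (prod-spec (starLinear l) (starˢ ls) ε) (ε , ε , inj₁ (ε , refl , sym (identityʳ ε)) , star-ε ls , sym (identityʳ ε))

  star-cons : ∀ ls {u v} → Semilinear ls u → Semilinear (starˢ ls) v → Semilinear (starˢ ls) (u ∙ v)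
  star-cons (l ∷ ls) {u} {v} p q with proj₁ (prod-spec (starLinear l) (starˢ ls) v) q
  star-cons (l ∷ ls) {u} (inj₁ p) q | a , b , pa , pb , refl =
    proj₂ (prod-spec (starLinear l) (starˢ ls) _) (u ∙ a , b , starLinear-cons l p pa , pb , sym (assoc u a b))
  star-cons (l ∷ ls) {u} (inj₂ p) q | a , b , pa , pb , refl =
    proj₂ (prod-spec (starLinear l) (starˢ ls) _) (a , u ∙ b , pa , star-cons ls p pb , leftComm u a b)

  star-spec : ∀ ls w → Semilinear (starˢ ls) w ⟷ Star (Semilinear ls) w
  star-spec ls w = to ls w , from
    where
    to : ∀ ls → Semilinear (starˢ ls) ⊆ Star (Semilinear ls)
    to [] w (inj₁ (_ , refl , refl)) = subst (Star _) (sym (identityʳ ε)) nil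
    to (l ∷ ls) w p with proj₁ (prod-spec (starLinear l) (starˢ ls) w) p
    ... | a , b , pa , pb , refl =
      star-∙ (star-mono (λ _ → inj₁) _ (starLinear-⊆ l a pa)) (star-mono (λ _ → inj₂) _ (to ls b pb))
    from : ∀ {w} → Star (Semilinear ls) w → Semilinear (starˢ ls) w
    from nil = star-ε ls
    from (cons p s) = star-cons ls p (from s)

  normal : Exp (Fin 0) → List (M × List M)
  normal ∅ = []
  normal ⟨ g ⟩ = (g , []) ∷ []
  normal (e ∪ f) = normal e ++ normal f
  normal (e · f) = prodˢ (normal e) (normal f)
  normal (e ⋆) = starˢ (normal e)

  normal-spec : ∀ e w → Semilinear (normal e) w ⟷ ⟦ e ⟧ᵉ none w
  normal-spec ∅ w = (λ ()) , λ ()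
  normal-spec ⟨ g ⟩ w = (λ { (inj₁ (_ , refl , refl)) → identityʳ g }) , λ { refl → inj₁ (ε , refl , sym (identityʳ g)) }
  normal-spec (e ∪ f) w = ⟷-trans (semi-++ (normal e) (normal f) w) (⊎-⟷ (normal-spec e w) (normal-spec f w))
  normal-spec (e · f) w = ⟷-trans (prod-spec (normal e) (normal f) w)
    ((λ (u , v , p , q , r) → u , v , proj₁ (normal-spec e u) p , proj₁ (normal-spec f v) q , r) ,
     (λ (u , v , p , q , r) → u , v , proj₂ (normal-spec e u) p , proj₂ (normal-spec f v) q , r))
  normal-spec (e ⋆) w = ⟷-trans (star-spec (normal e) w)
    (star-mono (λ v → proj₁ (normal-spec e v)) w , star-mono (λ v → proj₂ (normal-spec e v)) w)

-- Labels of runs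

_+ᵛ_ : ∀ {n} → Vec ℤ n → Vec ℤ n → Vec ℤ n
_+ᵛ_ = zipWith _+ᶻ_

0ᵛ : ∀ {n} → Vec ℤ n
0ᵛ = replicate _ 0ℤ

+ᵛ-isCommutativeMonoid : ∀ n → IsCommutativeMonoid _≡_ (_+ᵛ_ {n}) 0ᵛ
+ᵛ-isCommutativeMonoid n = record
  { isMonoid = record
    { isSemigroup = record
      { isMagma = record { isEquivalence = isEquivalence ; ∙-cong = cong₂ _+ᵛ_ }
      ; assoc = Vecₚ.zipWith-assoc ℤₚ.+-assoc }
    ; identity = Vecₚ.zipWith-identityˡ ℤₚ.+-identityˡ , Vecₚ.zipWith-identityʳ ℤₚ.+-identityʳ }
  ; comm = Vecₚ.zipWith-comm ℤₚ.+-comm }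

infix 4 _At_,_
_At_,_ : ∀ {N V} → Vec ℤ N → (Fin N → Lin V) → (V → ℤ) → Set
w At t , ρ = ∀ i → lookup w i ≡ ⟦ t i ⟧ˡ ρ

weaken : ∀ {V} → Lin V → Lin (Maybe V)
weaken = subˡ (λ v → lvar (just v))

weaken-eval : ∀ {V} (ρ : V → ℤ) a t → ⟦ weaken t ⟧ˡ (extend ρ a) ≡ ⟦ t ⟧ˡ ρ
weaken-eval ρ a = subˡ-eval _ (extend ρ a) ρ (λ v → refl)

-- Semilinear sets as quantifier-free formulas

module SemilinearQ (N : ℕ) where

  open Parikh (+ᵛ-isCommutativeMonoid N)

  lookup-mult : ∀ n (p : Vec ℤ N) i → lookup (mult n p) i ≡ + n *ᶻ lookup p i
  lookup-mult zero p i = Vecₚ.lookup-replicate i 0ℤ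
  lookup-mult (suc n) p i = trans (Vecₚ.lookup-zipWith _+ᶻ_ i p (mult n p)) (trans (cong (lookup p i +ᶻ_) (lookup-mult n p i)) (lem (+ n) (lookup p i)))
    where
    lem : ∀ n p → p +ᶻ n *ᶻ p ≡ (1ℤ +ᶻ n) *ᶻ p
    lem = solve-∀

  spanQ : ∀ {V} → (Fin N → Lin V) → List (Vec ℤ N) → QF V
  spanQ t [] = andFin N λ i → eqᵠ (t i) (lcon 0ℤ)
  spanQ t (p ∷ ps) = elim (and (leᵠ (lcon 0ℤ) (lvar nothing)) (spanQ (λ i → weaken (t i) ⊟ lookup p i ⊠ lvar nothing) ps))

  spanQ-spec : ∀ {V} (ρ : V → ℤ) (t : Fin N → Lin V) ps → ⟦ spanQ t ps ⟧ᵠ ρ ⟷ (Σ (Vec ℤ N) λ w → Span ps w × (w At t , ρ))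
  spanQ-spec ρ t [] =
    (λ h → 0ᵛ , refl , λ i → trans (Vecₚ.lookup-replicate i 0ℤ) (sym (proj₁ (eq-spec ρ (t i) (lcon 0ℤ)) (proj₁ (andFin-spec ρ N _) h i)))) ,
    (λ { (_ , refl , e) → proj₂ (andFin-spec ρ N _) λ i → proj₂ (eq-spec ρ (t i) (lcon 0ℤ)) (trans (sym (e i)) (Vecₚ.lookup-replicate i 0ℤ)) })
  spanQ-spec {V} ρ t (p ∷ ps) = ⟷-trans (elim-spec ρ _) (to , from)
    where
    t′ : Fin N → Lin (Maybe V)
    t′ i = weaken (t i) ⊟ lookup p i ⊠ lvar nothing
    t′-eval : ∀ a i → ⟦ t′ i ⟧ˡ (extend ρ a) ≡ ⟦ t i ⟧ˡ ρ -ᶻ lookup p i *ᶻ a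
    t′-eval a i = trans (⊟-eval (extend ρ a) (weaken (t i)) (lookup p i ⊠ lvar nothing)) (cong (_-ᶻ lookup p i *ᶻ a) (weaken-eval ρ a (t i)))
    to : (Σ ℤ λ a → ⟦ leᵠ (lcon 0ℤ) (lvar nothing) ⟧ᵠ (extend ρ a) × ⟦ spanQ t′ ps ⟧ᵠ (extend ρ a)) → Σ (Vec ℤ N) λ w → Span (p ∷ ps) w × (w At t , ρ)
    to (a , a≥0 , h) with proj₁ (spanQ-spec (extend ρ a) t′ ps) h
    ... | u , s , e = mult ∣ a ∣ p +ᵛ u , (∣ a ∣ , u , s , refl) , λ i → begin
        lookup (mult ∣ a ∣ p +ᵛ u) i                       ≡⟨ Vecₚ.lookup-zipWith _+ᶻ_ i (mult ∣ a ∣ p) u ⟩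
        lookup (mult ∣ a ∣ p) i +ᶻ lookup u i              ≡⟨ cong₂ _+ᶻ_ (trans (lookup-mult ∣ a ∣ p i) (cong (_*ᶻ lookup p i) (ℤₚ.0≤i⇒+∣i∣≡i (proj₁ (le-spec (extend ρ a) (lcon 0ℤ) (lvar nothing)) a≥0)))) (trans (e i) (t′-eval a i)) ⟩
        a *ᶻ lookup p i +ᶻ (⟦ t i ⟧ˡ ρ -ᶻ lookup p i *ᶻ a) ≡⟨ lem a (lookup p i) (⟦ t i ⟧ˡ ρ) ⟩
        ⟦ t i ⟧ˡ ρ ∎
      where
      open ≡-Reasoning
      lem : ∀ a p t → a *ᶻ p +ᶻ (t -ᶻ p *ᶻ a) ≡ t
      lem = solve-∀
    from : (Σ (Vec ℤ N) λ w → Span (p ∷ ps) w × (w At t , ρ)) → Σ ℤ λ a → ⟦ leᵠ (lcon 0ℤ) (lvar nothing) ⟧ᵠ (extend ρ a) × ⟦ spanQ t′ ps ⟧ᵠ (extend ρ a)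
    from (_ , (n , u , s , refl) , e) = + n , proj₂ (le-spec (extend ρ (+ n)) (lcon 0ℤ) (lvar nothing)) (+≤+ z≤n) ,
      proj₂ (spanQ-spec (extend ρ (+ n)) t′ ps) (u , s , λ i → begin
        lookup u i                                                     ≡⟨ lem (+ n) (lookup p i) (lookup u i) ⟩
        + n *ᶻ lookup p i +ᶻ lookup u i -ᶻ lookup p i *ᶻ + n           ≡⟨ cong (λ z → z +ᶻ lookup u i -ᶻ lookup p i *ᶻ + n) (sym (lookup-mult n p i)) ⟩
        lookup (mult n p) i +ᶻ lookup u i -ᶻ lookup p i *ᶻ + n         ≡⟨ cong (_-ᶻ lookup p i *ᶻ + n) (trans (sym (Vecₚ.lookup-zipWith _+ᶻ_ i (mult n p) u)) (e i)) ⟩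
        ⟦ t i ⟧ˡ ρ -ᶻ lookup p i *ᶻ + n                                ≡⟨ sym (t′-eval (+ n) i) ⟩
        ⟦ t′ i ⟧ˡ (extend ρ (+ n)) ∎)
      where
      open ≡-Reasoning
      lem : ∀ n p u → u ≡ n *ᶻ p +ᶻ u -ᶻ p *ᶻ n
      lem = solve-∀

  semiQ : ∀ {V} → (Fin N → Lin V) → List (Vec ℤ N × List (Vec ℤ N)) → QF V
  semiQ t [] = ffᵠ
  semiQ t ((b , ps) ∷ ls) = or (spanQ (λ i → t i ⊟ lcon (lookup b i)) ps) (semiQ t ls)

  semiQ-spec : ∀ {V} (ρ : V → ℤ) (t : Fin N → Lin V) ls → ⟦ semiQ t ls ⟧ᵠ ρ ⟷ (Σ (Vec ℤ N) λ w → Semilinear ls w × (w At t , ρ))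
  semiQ-spec ρ t [] = (λ h → ⊥-elim (ff-fails {ρ = ρ} h)) , λ ()
  semiQ-spec {V} ρ t ((b , ps) ∷ ls) = to , from
    where
    t′ : Fin N → Lin V
    t′ i = t i ⊟ lcon (lookup b i)
    to : ⟦ semiQ t ((b , ps) ∷ ls) ⟧ᵠ ρ → Σ (Vec ℤ N) λ w → Semilinear ((b , ps) ∷ ls) w × (w At t , ρ)
    to (inj₁ h) with proj₁ (spanQ-spec ρ t′ ps) h
    ... | u , s , e = b +ᵛ u , inj₁ (u , s , refl) , λ i →
          trans (Vecₚ.lookup-zipWith _+ᶻ_ i b u) (trans (cong (lookup b i +ᶻ_) (trans (e i) (⊟-eval ρ (t i) (lcon (lookup b i))))) (lem (lookup b i) _))
      where
      lem : ∀ b t → b +ᶻ (t -ᶻ b) ≡ t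
      lem = solve-∀
    to (inj₂ h) with proj₁ (semiQ-spec ρ t ls) h
    ... | w , s , e = w , inj₂ s , e
    from : (Σ (Vec ℤ N) λ w → Semilinear ((b , ps) ∷ ls) w × (w At t , ρ)) → ⟦ semiQ t ((b , ps) ∷ ls) ⟧ᵠ ρ
    from (_ , inj₁ (u , s , refl) , e) = inj₁ (proj₂ (spanQ-spec ρ t′ ps) (u , s , λ i →
          trans (lem (lookup b i) (lookup u i)) (trans (cong (_-ᶻ lookup b i) (trans (sym (Vecₚ.lookup-zipWith _+ᶻ_ i b u)) (e i))) (sym (⊟-eval ρ (t i) (lcon (lookup b i)))))))
      where
      lem : ∀ b u → u ≡ b +ᶻ u -ᶻ b
      lem = solve-∀
    from (w , inj₂ s , e) = inj₂ (proj₂ (semiQ-spec ρ t ls) (w , s , e))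

-- Pushdown machines with labelled moves

data Eff (l : ℕ) : Set where
  look : Maybe (Fin l) → Eff l
  psh  : Fin l → Eff l
  pul  : Fin l → Eff l

-- The top symbol of the stack U on top of a base with top symbol t.
top : ∀ {l} → Maybe (Fin l) → List (Fin l) → Maybe (Fin l)
top t [] = t
top t (g ∷ U) = just g

App : ∀ {l} → Maybe (Fin l) → Eff l → List (Fin l) → List (Fin l) → Set
App t (look s) U U′ = top t U ≡ s × U′ ≡ U
App t (psh g) U U′ = U′ ≡ g ∷ U
App t (pul g) U U′ = U ≡ g ∷ U′

module Machine {N l : ℕ} {Q Act : Set} (finQ : Finite Q) (finA : Finite Act)
               (tr : Act → Eff l → Q → Q → Set) (tr? : ∀ a f q q′ → Dec (tr a f q q′))
               (lab : Act → Eff l → Q → Vec ℤ N) where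

  open IsCommutativeMonoid (+ᵛ-isCommutativeMonoid N) using (assoc; identityˡ; identityʳ)
  open Parikh (+ᵛ-isCommutativeMonoid N)
  open SemilinearQ N

  Top : Set
  Top = Maybe (Fin l)

  -- Runs above a base that is never popped and whose top symbol is t.
  data Run (t : Top) : Q → List (Fin l) → Vec ℤ N → Q → List (Fin l) → Set where
    stop : ∀ {q U} → Run t q U 0ᵛ q U
    step : ∀ a f {q U q₁ U₁ v q′ U′} → tr a f q q₁ → App t f U U₁ → Run t q₁ U₁ v q′ U′ → Run t q U (lab a f q +ᵛ v) q′ U′

  data Bal (t : Top) : Q → Vec ℤ N → Q → Set where
    done : ∀ {q} → Bal t q 0ᵛ q
    flat : ∀ a {q q₁ v q′} → tr a (look t) q q₁ → Bal t q₁ v q′ → Bal t q (lab a (look t) q +ᵛ v) q′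
    call : ∀ a b g {q q₁ q₂ q₃ u v q′} → tr a (psh g) q q₁ → Bal (just g) q₁ u q₂ → tr b (pul g) q₂ q₃ → Bal t q₃ v q′ →
           Bal t q (lab a (psh g) q +ᵛ (u +ᵛ (lab b (pul g) q₂ +ᵛ v))) q′

  Run-++ : ∀ {t q U u q₁ U₁ v q₂ U₂} → Run t q U u q₁ U₁ → Run t q₁ U₁ v q₂ U₂ → Run t q U (u +ᵛ v) q₂ U₂
  Run-++ {t} {q} {U} {v = v} {q₂} {U₂} stop r = subst (λ v → Run t q U v q₂ U₂) (sym (identityˡ v)) r
  Run-++ {t} {q} {U} {v = v} {q₂} {U₂} (step a f {v = w} x y r) s =
    subst (λ v → Run t q U v q₂ U₂) (sym (assoc (lab a f q) w v)) (step a f x y (Run-++ r s))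

  Bal⇒Run : ∀ {t s q v q′} → Bal s q v q′ → ∀ U → top t U ≡ s → Run t q U v q′ U
  Bal⇒Run done U e = stop
  Bal⇒Run (flat a x b) U refl = step a (look _) x (refl , refl) (Bal⇒Run b U refl)
  Bal⇒Run (call a b g x B y B′) U e =
    step a (psh g) x refl (Run-++ (Bal⇒Run B (g ∷ U) refl) (step b (pul g) y refl (Bal⇒Run B′ U e)))

  -- The shape of a run that comes down to the base: for each stack symbol a balanced part above it
  -- and the move that pops it, and a balanced part at the bottom. Balanced runs alone are not
  -- closed under removing the first move, so `Run⇒Desc` is the statement that goes through by
  -- induction.
  data Desc (t : Top) : Q → List (Fin l) → Vec ℤ N → Q → Set where
    last : ∀ {q v q′} → Bal t q v q′ → Desc t q [] v q′
    down : ∀ b {q u q₁ q₂ v q′ g U} → Bal (just g) q u q₁ → tr b (pul g) q₁ q₂ → Desc t q₂ U v q′ →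
           Desc t q (g ∷ U) (u +ᵛ (lab b (pul g) q₁ +ᵛ v)) q′

  prefix : ∀ {t q q₁ U v q′} w → (∀ {u q″} → Bal (top t U) q₁ u q″ → Bal (top t U) q (w +ᵛ u) q″) →
           Desc t q₁ U v q′ → Desc t q U (w +ᵛ v) q′
  prefix w f (last B) = last (f B)
  prefix {t} {q} {U = g ∷ U} {q′ = q′} w f (down b {u = u} {v = v} B y D) =
    subst (λ v → Desc t q (g ∷ U) v q′) (assoc w u _) (down b (f B) y D)

  Run⇒Desc : ∀ {t q U v q′} → Run t q U v q′ [] → Desc t q U v q′
  Run⇒Desc stop = last done
  Run⇒Desc {t} {U = U} (step a (look s) x (refl , refl) r) = prefix (lab a (look s) _) (flat a x) (Run⇒Desc r)
  Run⇒Desc {t} {q} {U} {q′ = q′} (step a (psh g) x refl r) with Run⇒Desc r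
  ... | down b {u = u} {q₁ = q₂} {v = v} B y D =
    subst (λ v → Desc t q U v q′) (trans (assoc (lab a (psh g) q) _ v) (cong (lab a (psh g) q +ᵛ_) (assoc u _ v)))
      (prefix (lab a (psh g) q +ᵛ (u +ᵛ lab b (pul g) q₂))
        (λ {w} {q″} B′ → subst (λ v → Bal (top t U) q v q″)
            (trans (cong (lab a (psh g) q +ᵛ_) (sym (assoc u _ w))) (sym (assoc (lab a (psh g) q) _ w)))
            (call a b g x B y B′)) D)
  Run⇒Desc {t} {q} {q′ = q′} (step a (pul g) {U₁ = U₁} {v = v} x refl r) =
    subst (λ v → Desc t q (g ∷ U₁) v q′) (identityˡ _) (down a done x (Run⇒Desc r))

  Run⇒Bal : ∀ {t q v q′} → Run t q [] v q′ [] → Bal t q v q′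
  Run⇒Bal r with Run⇒Desc r
  ... | last B = B

  -- The grammar of balanced runs

  NT : Set
  NT = Top × Q × Q

  finNT : Finite NT
  finNT = finite-× (finite-Maybe (finite-Fin l)) (finite-× finQ finQ)

  guard : ∀ {P : Set} {V} → Dec P → Exp V → Exp V
  guard (yes _) e = e
  guard (no _) e = ∅

  guard-spec : ∀ {P : Set} {V} (d : Dec P) (e : Exp V) ρ w → ⟦ guard d e ⟧ᵉ ρ w ⟷ (P × ⟦ e ⟧ᵉ ρ w)
  guard-spec (yes p) e ρ w = (λ h → p , h) , proj₂
  guard-spec (no ¬p) e ρ w = (λ ()) , λ (p , _) → ⊥-elim (¬p p)

  sumFin : ∀ {V} n → (Fin n → Exp V) → Exp V
  sumFin zero f = ∅
  sumFin (suc n) f = f zero ∪ sumFin n (λ i → f (suc i))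

  sumFin-spec : ∀ {V} n (f : Fin n → Exp V) ρ w → ⟦ sumFin n f ⟧ᵉ ρ w ⟷ (Σ (Fin n) λ i → ⟦ f i ⟧ᵉ ρ w)
  sumFin-spec zero f ρ w = (λ ()) , λ ()
  sumFin-spec (suc n) f ρ w =
    [ (λ h → zero , h) , (λ h → let i , p = proj₁ (sumFin-spec n _ ρ w) h in suc i , p) ]′ ,
    λ { (zero , h) → inj₁ h ; (suc i , h) → inj₂ (proj₂ (sumFin-spec n _ ρ w) (i , h)) }

  sumF : ∀ {V W} → Finite W → (W → Exp V) → Exp V
  sumF F f = sumFin (Finite.size F) (λ i → f (Finite.dec F i))

  sumF-spec : ∀ {V W} (F : Finite W) (f : W → Exp V) ρ w → ⟦ sumF F f ⟧ᵉ ρ w ⟷ (Σ W λ x → ⟦ f x ⟧ᵉ ρ w)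
  sumF-spec F f ρ w = ⟷-trans (sumFin-spec (Finite.size F) _ ρ w)
    ((λ (i , h) → Finite.dec F i , h) , λ (x , h) → Finite.enc F x , subst (λ x → ⟦ f x ⟧ᵉ ρ w) (sym (Finite.dec-enc F x)) h)

  Ix : Set
  Ix = Fin (Finite.size finNT)

  nt : NT → Exp Ix
  nt x = evar (Finite.enc finNT x)

  Call : Set
  Call = (Act × Act) × Fin l × Q × Q × Q

  finCall : Finite Call
  finCall = finite-× (finite-× finA finA) (finite-× (finite-Fin l) (finite-× finQ (finite-× finQ finQ)))

  flatE : NT → Act × Q → Exp Ix
  flatE (t , q , q′) (a , q₁) = guard (tr? a (look t) q q₁) (⟨ lab a (look t) q ⟩ · nt (t , q₁ , q′))

  callE : NT → Call → Exp Ix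
  callE (t , q , q′) ((a , b) , g , q₁ , q₂ , q₃) =
    guard (tr? a (psh g) q q₁ ×-dec tr? b (pul g) q₂ q₃)
      (⟨ lab a (psh g) q ⟩ · (nt (just g , q₁ , q₂) · (⟨ lab b (pul g) q₂ ⟩ · nt (t , q₃ , q′))))

  -- One alternative for each constructor of `Bal`: a context-free grammar whose nonterminals are a
  -- top symbol and two states, read in the commutative monoid of labels.
  rules : NT → Exp Ix
  rules x@(t , q , q′) =
    guard (≟-finite finQ q q′) ⟨ 0ᵛ ⟩ ∪ (sumF (finite-× finA finQ) (flatE x) ∪ sumF finCall (callE x))

  grammar : Ix → Exp Ix
  grammar i = rules (Finite.dec finNT i)

  BalL : NT → Vec ℤ N → Set
  BalL (t , q , q′) v = Bal t q v q′

  unroll : ∀ x (ρ : Ix → Vec ℤ N → Set) → (∀ i v → ρ i v → BalL (Finite.dec finNT i) v) → ∀ v → ⟦ rules x ⟧ᵉ ρ v → BalL x v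
  unroll x@(t , q , q′) ρ h v (inj₁ p) with proj₁ (guard-spec (≟-finite finQ q q′) ⟨ 0ᵛ ⟩ ρ v) p
  ... | refl , refl = done
  unroll x@(t , q , q′) ρ h v (inj₂ (inj₁ p)) with proj₁ (sumF-spec (finite-× finA finQ) (flatE x) ρ v) p
  ... | (a , q₁) , p′ with proj₁ (guard-spec (tr? a (look t) q q₁) _ ρ v) p′
  ... | y , (_ , u , refl , B , refl) = flat a y (subst (λ z → BalL z u) (Finite.dec-enc finNT _) (h _ u B))
  unroll x@(t , q , q′) ρ h v (inj₂ (inj₂ p)) with proj₁ (sumF-spec finCall (callE x) ρ v) p
  ... | ((a , b) , g , q₁ , q₂ , q₃) , p′ with proj₁ (guard-spec (tr? a (psh g) q q₁ ×-dec tr? b (pul g) q₂ q₃) _ ρ v) p′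
  ... | (y , z) , (_ , _ , refl , (u , _ , B , (_ , w , refl , B′ , refl) , refl) , refl) =
    call a b g y (subst (λ z → BalL z u) (Finite.dec-enc finNT _) (h _ u B)) z (subst (λ z → BalL z w) (Finite.dec-enc finNT _) (h _ w B′))

  balE : NT → Exp (Fin 0)
  balE x = solve _ grammar (Finite.enc finNT x)

  -- Soundness holds because the computed solution is the least one and `BalL` is closed under the
  -- rules; completeness below uses only that the solution is closed.
  balE-sound : ∀ x v → ⟦ balE x ⟧ᵉ none v → BalL x v
  balE-sound x v h = subst (λ z → BalL z v) (Finite.dec-enc finNT x)
    (solve-least _ grammar (λ i → BalL (Finite.dec finNT i)) (λ i → unroll (Finite.dec finNT i) _ (λ _ _ p → p)) _ v h)

  roll : ∀ x v → ⟦ rules x ⟧ᵉ (Sol grammar) v → ⟦ balE x ⟧ᵉ none v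
  roll x v h = solve-closed _ grammar (Finite.enc finNT x) v
    (subst (λ z → ⟦ rules z ⟧ᵉ (Sol grammar) v) (sym (Finite.dec-enc finNT x)) h)

  balE-complete : ∀ {t q v q′} → Bal t q v q′ → ⟦ balE (t , q , q′) ⟧ᵉ none v
  balE-complete {t} {q} done = roll (t , q , q) _ (inj₁ (proj₂ (guard-spec (≟-finite finQ q q) ⟨ 0ᵛ ⟩ (Sol grammar) 0ᵛ) (refl , refl)))
  balE-complete {t} {q} {q′ = q′} (flat a {q₁ = q₁} y B) = roll x _ (inj₂ (inj₁ (proj₂ (sumF-spec (finite-× finA finQ) (flatE x) (Sol grammar) _)
    ((a , q₁) , proj₂ (guard-spec (tr? a (look t) q q₁) _ (Sol grammar) _) (y , (_ , _ , refl , balE-complete B , refl))))))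
    where x = t , q , q′
  balE-complete {t} {q} {q′ = q′} (call a b g {q₁ = q₁} {q₂} {q₃} y B z B′) = roll x _ (inj₂ (inj₂ (proj₂ (sumF-spec finCall (callE x) (Sol grammar) _)
    (((a , b) , g , q₁ , q₂ , q₃) , proj₂ (guard-spec (tr? a (psh g) q q₁ ×-dec tr? b (pul g) q₂ q₃) _ (Sol grammar) _)
      ((y , z) , (_ , _ , refl , (_ , _ , balE-complete B , (_ , _ , refl , balE-complete B′ , refl) , refl) , refl))))))
    where x = t , q , q′

  runQ : ∀ {V} → Top → Q → Q → (Fin N → Lin V) → QF V
  runQ t q q′ τ = semiQ τ (normal (balE (t , q , q′)))

  runQ-spec : ∀ {V} t q q′ (τ : Fin N → Lin V) ρ →
              ⟦ runQ t q q′ τ ⟧ᵠ ρ ⟷ (Σ (Vec ℤ N) λ v → Run t q [] v q′ [] × (v At τ , ρ))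
  runQ-spec t q q′ τ ρ = ⟷-trans (semiQ-spec ρ τ _)
    ((λ (v , s , e) → v , Bal⇒Run (balE-sound (t , q , q′) v (proj₁ (normal-spec (balE (t , q , q′)) v) s)) [] refl , e) ,
     (λ (v , r , e) → v , proj₂ (normal-spec (balE (t , q , q′)) v) (balE-complete (Run⇒Bal r)) , e))

-- A finite abstraction of clock valuations

cap : ∀ M → ℕ → Fin (suc M)
cap M n = fromℕ< (s≤s (ℕₚ.m⊓n≤n n M))

toℕ-cap : ∀ M n → toℕ (cap M n) ≡ n ⊓ M
toℕ-cap M n = Finₚ.toℕ-fromℕ< (s≤s (ℕₚ.m⊓n≤n n M))

cap-cong : ∀ M {a b} → a ⊓ M ≡ b ⊓ M → cap M a ≡ cap M b
cap-cong M {a} {b} e = Finₚ.toℕ-injective (trans (toℕ-cap M a) (trans e (sym (toℕ-cap M b))))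

cap-toℕ : ∀ M (i : Fin (suc M)) → cap M (toℕ i) ≡ i
cap-toℕ M i = Finₚ.toℕ-injective (trans (toℕ-cap M (toℕ i)) (ℕₚ.m≤n⇒m⊓n≡m (Finₚ.toℕ≤pred[n] i)))

cmp? : ∀ c a b → Dec (cmp c a b)
cmp? lt a b = a ℤₚ.<? b
cmp? gt a b = b ℤₚ.<? a
cmp? le a b = a ℤₚ.≤? b
cmp? ge a b = b ℤₚ.≤? a
cmp? eq a b = a ℤₚ.≟ b

cmp-above : ∀ c {u v d} → d <ᶻ u → d <ᶻ v → cmp c u d ⟷ cmp c v d
cmp-above lt p q = (λ h → ⊥-elim (ℤₚ.<-asym p h)) , λ h → ⊥-elim (ℤₚ.<-asym q h)
cmp-above gt p q = (λ _ → q) , λ _ → p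
cmp-above le p q = (λ h → ⊥-elim (ℤₚ.<⇒≱ p h)) , λ h → ⊥-elim (ℤₚ.<⇒≱ q h)
cmp-above ge p q = (λ _ → ℤₚ.<⇒≤ q) , λ _ → ℤₚ.<⇒≤ p
cmp-above eq p q = (λ h → ⊥-elim (ℤₚ.<⇒≢ p (sym h))) , λ h → ⊥-elim (ℤₚ.<⇒≢ q (sym h))

cmp-below : ∀ c {u v d} → u <ᶻ d → v <ᶻ d → cmp c u d ⟷ cmp c v d
cmp-below lt p q = (λ _ → q) , λ _ → p
cmp-below gt p q = (λ h → ⊥-elim (ℤₚ.<-asym p h)) , λ h → ⊥-elim (ℤₚ.<-asym q h)
cmp-below le p q = (λ _ → ℤₚ.<⇒≤ q) , λ _ → ℤₚ.<⇒≤ p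
cmp-below ge p q = (λ h → ⊥-elim (ℤₚ.<⇒≱ p h)) , λ h → ⊥-elim (ℤₚ.<⇒≱ q h)
cmp-below eq p q = (λ h → ⊥-elim (ℤₚ.<⇒≢ p h)) , λ h → ⊥-elim (ℤₚ.<⇒≢ q h)

maxConst : ∀ {m} → ClockConstraint m → ℕ
maxConst trueC = 0
maxConst (diffC i j c d) = ∣ d ∣
maxConst (singleC i c d) = ∣ d ∣
maxConst (notC φ) = maxConst φ
maxConst (andC φ ψ) = maxConst φ ⊔ maxConst ψ
maxConst (orC φ ψ) = maxConst φ ⊔ maxConst ψ

-- Clock differences matter only up to a bound M on the constants of the constraints. With an
-- additional clock that is always 0, the matrix of the capped differences determines which
-- constraints hold, and its evolution under time steps and resets.
module ClockAbstraction (m M : ℕ) where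

  Mat : Set
  Mat = Vec (Vec (Fin (suc M)) (suc m)) (suc m)

  finMat : Finite Mat
  finMat = finite-Vec (finite-Vec (finite-Fin (suc M)) (suc m)) (suc m)

  infix 4 _⊨ᵃ_

  abstract
    entry : Mat → Fin (suc m) → Fin (suc m) → ℕ
    entry D i j = toℕ (lookup (lookup D i) j)

    mkMat : (Fin (suc m) → Fin (suc m) → ℕ) → Mat
    mkMat f = tabulate λ i → tabulate λ j → cap M (f i j)

    entry-mk : ∀ f i j → entry (mkMat f) i j ≡ f i j ⊓ M
    entry-mk f i j = trans (cong toℕ (trans (cong (λ r → lookup r j) (Vecₚ.lookup∘tabulate (λ i → tabulate λ j → cap M (f i j)) i)) (Vecₚ.lookup∘tabulate (λ j → cap M (f i j)) j))) (toℕ-cap M (f i j))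

    mk-cong : ∀ {f g} → (∀ i j → f i j ⊓ M ≡ g i j ⊓ M) → mkMat f ≡ mkMat g
    mk-cong h = Vecₚ.tabulate-cong λ i → Vecₚ.tabulate-cong λ j → cap-cong M (h i j)

    clock₀ : Clocks m → Fin (suc m) → ℕ
    clock₀ x zero = 0
    clock₀ x (suc i) = x i

    clock₀-zero : ∀ {x} → clock₀ x zero ≡ 0
    clock₀-zero = refl

    clock₀-suc : ∀ {x} i → clock₀ x (suc i) ≡ x i
    clock₀-suc i = refl

    entry≤ : ∀ D i j → entry D i j ≤ M
    entry≤ D i j = Finₚ.toℕ≤pred[n] (lookup (lookup D i) j)

    -- Truncated subtraction forgets the sign of a difference, but the entries at (i, j) and (j, i)
    -- together retain it; `gap` puts it back.
    α : Clocks m → Mat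
    α x = mkMat λ i j → clock₀ x i ∸ clock₀ x j

    entry-α : ∀ x i j → entry (α x) i j ≡ (clock₀ x i ∸ clock₀ x j) ⊓ M
    entry-α x = entry-mk λ i j → clock₀ x i ∸ clock₀ x j

    α-cong : ∀ {x y} → (∀ i → x i ≡ y i) → α x ≡ α y
    α-cong {x} {y} h = mk-cong λ i j → cong (_⊓ M) (cong₂ _∸_ (same i) (same j))
      where
      same : ∀ i → clock₀ x i ≡ clock₀ y i
      same zero = refl
      same (suc i) = h i

    ⊓-idem : ∀ n → n ⊓ M ≡ n ⊓ M ⊓ M
    ⊓-idem n = sym (ℕₚ.m≤n⇒m⊓n≡m (ℕₚ.m⊓n≤n n M))

    -- The additional clock stands still while all others advance, so only the differences from it
    -- change, and those truncated to 0 stay 0.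
    tickEntry : Mat → Fin (suc m) → Fin (suc m) → ℕ
    tickEntry D (suc i) zero = suc (entry D (suc i) zero)
    tickEntry D (suc i) (suc j) = entry D (suc i) (suc j)
    tickEntry D zero j = entry D zero j

    tickM : Mat → Mat
    tickM D = mkMat (tickEntry D)

    α-tick : ∀ {x y} → (∀ i → y i ≡ suc (x i)) → α y ≡ tickM (α x)
    α-tick {x} {y} h = mk-cong go
      where
      suc-cap : ∀ n → suc n ⊓ M ≡ suc (n ⊓ M) ⊓ M
      suc-cap n with ℕₚ.≤-total n M
      ... | inj₁ p = cong (λ z → suc z ⊓ M) (sym (ℕₚ.m≤n⇒m⊓n≡m p))
      ... | inj₂ p = trans (ℕₚ.m≥n⇒m⊓n≡n (ℕₚ.m≤n⇒m≤1+n p)) (trans (sym (ℕₚ.m≥n⇒m⊓n≡n (ℕₚ.n≤1+n M))) (cong (λ z → suc z ⊓ M) (sym (ℕₚ.m≥n⇒m⊓n≡n p))))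
      go : ∀ i j → (clock₀ y i ∸ clock₀ y j) ⊓ M ≡ tickEntry (α x) i j ⊓ M
      go zero j = trans (cong (_⊓ M) (ℕₚ.0∸n≡0 (clock₀ y j)))
        (trans (cong (_⊓ M) (sym (ℕₚ.0∸n≡0 (clock₀ x j)))) (trans (⊓-idem (0 ∸ clock₀ x j)) (cong (_⊓ M) (sym (entry-α x zero j)))))
      go (suc i) zero = trans (cong (_⊓ M) (h i)) (trans (suc-cap (x i)) (cong (λ z → suc z ⊓ M) (sym (entry-α x (suc i) zero))))
      go (suc i) (suc j) = trans (cong (_⊓ M) (cong₂ _∸_ (h i) (h j))) (trans (⊓-idem (x i ∸ x j)) (cong (_⊓ M) (sym (entry-α x (suc i) (suc j)))))

    -- After a reset a clock agrees with the additional clock, so its row and column are copied from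
    -- there.
    source : (Fin m → Bool) → Fin (suc m) → Fin (suc m)
    source R zero = zero
    source R (suc i) = if R i then zero else suc i

    resetM : (Fin m → Bool) → Mat → Mat
    resetM R D = mkMat λ i j → entry D (source R i) (source R j)

    α-reset : ∀ {x y} R → (∀ i → y i ≡ (if R i then 0 else x i)) → α y ≡ resetM R (α x)
    α-reset {x} {y} R h = mk-cong λ i j →
      trans (cong (_⊓ M) (cong₂ _∸_ (same i) (same j))) (trans (⊓-idem (clock₀ x (source R i) ∸ clock₀ x (source R j))) (cong (_⊓ M) (sym (entry-α x (source R i) (source R j)))))
      where
      same : ∀ i → clock₀ y i ≡ clock₀ x (source R i)
      same zero = refl
      same (suc i) with R i | h i
      ... | true | e = e
      ... | false | e = e

    gap : Mat → Fin (suc m) → Fin (suc m) → ℤ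
    gap D i j = + entry D i j -ᶻ + entry D j i

    _⊨ᵃ_ : Mat → ClockConstraint m → Set
    D ⊨ᵃ trueC = ⊤
    D ⊨ᵃ diffC i j c d = cmp c (gap D (suc i) (suc j)) d
    D ⊨ᵃ singleC i c d = cmp c (gap D (suc i) zero) d
    D ⊨ᵃ notC φ = ¬ (D ⊨ᵃ φ)
    D ⊨ᵃ andC φ ψ = D ⊨ᵃ φ × D ⊨ᵃ ψ
    D ⊨ᵃ orC φ ψ = D ⊨ᵃ φ ⊎ D ⊨ᵃ ψ

    _⊨ᵃ?_ : ∀ D φ → Dec (D ⊨ᵃ φ)
    D ⊨ᵃ? trueC = yes tt
    D ⊨ᵃ? diffC i j c d = cmp? c _ d
    D ⊨ᵃ? singleC i c d = cmp? c _ d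
    D ⊨ᵃ? notC φ = ¬? (D ⊨ᵃ? φ)
    D ⊨ᵃ? andC φ ψ = (D ⊨ᵃ? φ) ×-dec (D ⊨ᵃ? ψ)
    D ⊨ᵃ? orC φ ψ = (D ⊨ᵃ? φ) ⊎-dec (D ⊨ᵃ? ψ)

    -- The bound on `d` has to be strict: when capping changes the difference, the true and the
    -- capped value lie strictly on the same side of `d`, so that all five comparisons agree,
    -- equality included.
    capped-gap : ∀ c a b d → ∣ d ∣ < M → cmp c (+ a -ᶻ + b) d ⟷ cmp c (+ ((a ∸ b) ⊓ M) -ᶻ + ((b ∸ a) ⊓ M)) d
    capped-gap c a b d d<M with ℕₚ.≤-total b a
    ... | inj₁ b≤a = subst₂ (λ u v → cmp c u d ⟷ cmp c v d) (sym (trans (ℤₚ.[+m]-[+n]≡m⊖n a b) (ℤₚ.⊖-≥ b≤a)))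
                      (sym (trans (cong (λ z → + ((a ∸ b) ⊓ M) -ᶻ + (z ⊓ M)) (ℕₚ.m≤n⇒m∸n≡0 b≤a)) (ℤₚ.+-identityʳ _)))
                      (go (a ∸ b))
      where
      go : ∀ n → cmp c (+ n) d ⟷ cmp c (+ (n ⊓ M)) d
      go n with ℕₚ.≤-total n M
      ... | inj₁ n≤M = ≡⇒⟷ (cong (λ z → cmp c (+ z) d) (sym (ℕₚ.m≤n⇒m⊓n≡m n≤M)))
      ... | inj₂ M≤n = cmp-above c (ℤₚ.<-≤-trans d<+M (+≤+ M≤n)) (subst (λ z → d <ᶻ + z) (sym (ℕₚ.m≥n⇒m⊓n≡n M≤n)) d<+M)
        where
        d<+M : d <ᶻ + M
        d<+M = ℤₚ.≤-<-trans (i≤∣i∣ d) (+<+ d<M)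
    ... | inj₂ a≤b = subst₂ (λ u v → cmp c u d ⟷ cmp c v d) (sym (trans (ℤₚ.[+m]-[+n]≡m⊖n a b) (ℤₚ.⊖-≤ a≤b)))
                      (sym (trans (cong (λ z → + (z ⊓ M) -ᶻ + ((b ∸ a) ⊓ M)) (ℕₚ.m≤n⇒m∸n≡0 a≤b)) (ℤₚ.+-identityˡ _)))
                      (go (b ∸ a))
      where
      go : ∀ n → cmp c (-ᶻ (+ n)) d ⟷ cmp c (-ᶻ (+ (n ⊓ M))) d
      go n with ℕₚ.≤-total n M
      ... | inj₁ n≤M = ≡⇒⟷ (cong (λ z → cmp c (-ᶻ (+ z)) d) (sym (ℕₚ.m≤n⇒m⊓n≡m n≤M)))
      ... | inj₂ M≤n = cmp-below c (ℤₚ.≤-<-trans (ℤₚ.neg-mono-≤ (+≤+ M≤n)) -M<d) (subst (λ z → -ᶻ (+ z) <ᶻ d) (sym (ℕₚ.m≥n⇒m⊓n≡n M≤n)) -M<d)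
        where
        -M<d : -ᶻ (+ M) <ᶻ d
        -M<d = ℤₚ.<-≤-trans (ℤₚ.neg-mono-< (+<+ d<M)) (-∣i∣≤i d)

    gap-α : ∀ c x i j d → ∣ d ∣ < M → cmp c (+ clock₀ x i -ᶻ + clock₀ x j) d ⟷ cmp c (gap (α x) i j) d
    gap-α c x i j d p = ⟷-trans (capped-gap c (clock₀ x i) (clock₀ x j) d p)
      (≡⇒⟷ (cong₂ (λ u v → cmp c (+ u -ᶻ + v) d) (sym (entry-α x i j)) (sym (entry-α x j i))))

    ⊨-α : ∀ x φ → maxConst φ < M → (x ⊨ᶜ φ) ⟷ (α x ⊨ᵃ φ)
    ⊨-α x trueC p = ⟷-refl
    ⊨-α x (diffC i j c d) p = gap-α c x (suc i) (suc j) d p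
    ⊨-α x (singleC i c d) p = ⟷-trans (≡⇒⟷ (cong (λ z → cmp c z d) (sym (ℤₚ.+-identityʳ (+ x i))))) (gap-α c x (suc i) zero d p)
    ⊨-α x (notC φ) p = ¬-⟷ (⊨-α x φ p)
    ⊨-α x (andC φ ψ) p = ×-⟷ (⊨-α x φ (ℕₚ.≤-<-trans (ℕₚ.m≤m⊔n _ _) p)) (⊨-α x ψ (ℕₚ.≤-<-trans (ℕₚ.m≤n⊔m (maxConst φ) _) p))
    ⊨-α x (orC φ ψ) p = ⊎-⟷ (⊨-α x φ (ℕₚ.≤-<-trans (ℕₚ.m≤m⊔n _ _) p)) (⊨-α x ψ (ℕₚ.≤-<-trans (ℕₚ.m≤n⊔m (maxConst φ) _) p))

    α-char : ∀ x D → (∀ i j → entry D i j ≡ (clock₀ x i ∸ clock₀ x j) ⊓ M) ⟷ (α x ≡ D)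
    α-char x D =
      (λ h → trans (Vecₚ.tabulate-cong (λ i → trans (Vecₚ.tabulate-cong (λ j → Finₚ.toℕ-injective (trans (toℕ-cap M _) (sym (h i j))))) (Vecₚ.tabulate∘lookup (lookup D i)))) (Vecₚ.tabulate∘lookup D)) ,
      (λ { refl → entry-α x })

-- Bounds on the constants of an automaton

maxFin : ∀ n → (Fin n → ℕ) → ℕ
maxFin zero f = 0
maxFin (suc n) f = f zero ⊔ maxFin n (λ i → f (suc i))

≤-maxFin : ∀ {n} (f : Fin n → ℕ) i → f i ≤ maxFin n f
≤-maxFin f zero = ℕₚ.m≤m⊔n _ _
≤-maxFin f (suc i) = ℕₚ.≤-trans (≤-maxFin (λ i → f (suc i)) i) (ℕₚ.m≤n⊔m (f zero) _)

kindConst : ∀ {m} → Kind m → ℕ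
kindConst progress = 0
kindConst (reset R C) = maxConst C

module _ {nS m k l} (A : Automaton nS m k l) where
  open Automaton A

  edge : Fin (length edges) → Edge nS m k l
  edge = List.lookup edges

  -- The successor provides the strict inequality that `⊨-α` asks for.
  clockBound : ℕ
  clockBound = suc (maxFin nS (λ s → maxConst (Inv s)) ⊔ maxFin (length edges) (λ x → kindConst (Edge.kind (edge x))))

  Inv-bound : ∀ s → maxConst (Inv s) < clockBound
  Inv-bound s = s≤s (ℕₚ.≤-trans (≤-maxFin (λ s → maxConst (Inv s)) s) (ℕₚ.m≤m⊔n _ _))

  edge-bound : ∀ x → kindConst (Edge.kind (edge x)) < clockBound
  edge-bound x = s≤s (ℕₚ.≤-trans (≤-maxFin (λ x → kindConst (Edge.kind (edge x))) x) (ℕₚ.m≤n⊔m (maxFin nS _) _))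

-- Phased runs and the machines that simulate them

data Sign : Set where
  negative null positive : Sign

HasSign : Sign → ℤ → Set
HasSign negative v = v <ᶻ 0ℤ
HasSign null v = v ≡ 0ℤ
HasSign positive v = 0ℤ <ᶻ v

Stage : Set
Stage = Mode × Sign

TestOK : Sign → CtrTest → Set
TestOK s noTest = ⊤
TestOK null isZero = ⊤
TestOK _ isZero = ⊥
TestOK null nonZero = ⊥
TestOK _ nonZero = ⊤

UpdOK : Mode → CtrUpd → Set
UpdOK nondecr decr = ⊥
UpdOK nonincr incr = ⊥
UpdOK _ _ = ⊤

TestOK? : ∀ s t → Dec (TestOK s t)
TestOK? s noTest = yes tt
TestOK? negative isZero = no λ ()
TestOK? null isZero = yes tt
TestOK? positive isZero = no λ ()
TestOK? negative nonZero = yes tt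
TestOK? null nonZero = no λ ()
TestOK? positive nonZero = yes tt

UpdOK? : ∀ μ u → Dec (UpdOK μ u)
UpdOK? nondecr incr = yes tt
UpdOK? nondecr decr = no λ ()
UpdOK? nondecr keep = yes tt
UpdOK? nonincr incr = no λ ()
UpdOK? nonincr decr = yes tt
UpdOK? nonincr keep = yes tt

TestOK-sound : ∀ s t v → HasSign s v → TestOK s t → ctrTest t v
TestOK-sound s noTest v h ok = tt
TestOK-sound null isZero v h ok = h
TestOK-sound negative nonZero v h ok = ℤₚ.<⇒≢ h
TestOK-sound positive nonZero v h ok e = ℤₚ.<⇒≢ h (sym e)

TestOK-complete : ∀ s t v → HasSign s v → ctrTest t v → TestOK s t
TestOK-complete s noTest v h ok = tt
TestOK-complete negative isZero v h refl = ℤₚ.<-irrefl refl h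
TestOK-complete null isZero v h ok = tt
TestOK-complete positive isZero v h refl = ℤₚ.<-irrefl refl h
TestOK-complete negative nonZero v h ok = tt
TestOK-complete null nonZero v h ok = ok h
TestOK-complete positive nonZero v h ok = tt

-- An initP phase guesses a stack word by pushing; a oneP phase is a single move from counters of
-- the given signs; in a segP phase the counters keep their signs and are monotone.
data PKind : Set where
  initP oneP segP : PKind

isInit? : ∀ κ → Dec (κ ≡ initP)
isInit? initP = yes refl
isInit? oneP = no λ ()
isInit? segP = no λ ()

finite-ConfVar : ∀ m k l → Finite (ConfVar m k l)
finite-ConfVar m k l = finite-retract to from from-to
  (finite-⊎ (finite-Fin 1) (finite-⊎ (finite-Fin m) (finite-⊎ (finite-Fin k) (finite-Fin l))))
  where
  to : ConfVar m k l → Fin 1 ⊎ Fin m ⊎ Fin k ⊎ Fin l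
  to stateV = inj₁ zero
  to (clockV i) = inj₂ (inj₁ i)
  to (ctrV j) = inj₂ (inj₂ (inj₁ j))
  to (countV g) = inj₂ (inj₂ (inj₂ g))
  from : Fin 1 ⊎ Fin m ⊎ Fin k ⊎ Fin l → ConfVar m k l
  from (inj₁ _) = stateV
  from (inj₂ (inj₁ i)) = clockV i
  from (inj₂ (inj₂ (inj₁ j))) = ctrV j
  from (inj₂ (inj₂ (inj₂ g))) = countV g
  from-to : ∀ y → from (to y) ≡ y
  from-to stateV = refl
  from-to (clockV i) = refl
  from-to (ctrV j) = refl
  from-to (countV g) = refl

EffOK : ∀ {l} → StackOp l → Eff l → Set
EffOK nop (look t) = ⊤
EffOK nop _ = ⊥
EffOK (push a) (psh g) = g ≡ a
EffOK (push a) _ = ⊥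
EffOK pop (pul g) = ⊤
EffOK pop _ = ⊥
EffOK (topIs a) (look t) = t ≡ just a
EffOK (topIs a) _ = ⊥
EffOK topIsBot (look t) = t ≡ nothing
EffOK topIsBot _ = ⊥

Top≟ : ∀ {l} (s t : Maybe (Fin l)) → Dec (s ≡ t)
Top≟ {l} = ≟-finite (finite-Maybe (finite-Fin l))

EffOK? : ∀ {l} (o : StackOp l) f → Dec (EffOK o f)
EffOK? nop (look t) = yes tt
EffOK? nop (psh g) = no λ ()
EffOK? nop (pul g) = no λ ()
EffOK? (push a) (look t) = no λ ()
EffOK? (push a) (psh g) = g Finₚ.≟ a
EffOK? (push a) (pul g) = no λ ()
EffOK? pop (look t) = no λ ()
EffOK? pop (psh g) = no λ ()
EffOK? pop (pul g) = yes tt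
EffOK? (topIs a) (look t) = Top≟ t (just a)
EffOK? (topIs a) (psh g) = no λ ()
EffOK? (topIs a) (pul g) = no λ ()
EffOK? topIsBot (look t) = Top≟ t nothing
EffOK? topIsBot (psh g) = no λ ()
EffOK? topIsBot (pul g) = no λ ()

unit : ∀ {l} → Fin l → Fin l → ℤ
unit g h with g Finₚ.≟ h
... | yes _ = 1ℤ
... | no _ = 0ℤ

effδ : ∀ {l} → Eff l → Fin l → ℤ
effδ (look t) h = 0ℤ
effδ (psh g) h = unit g h
effδ (pul g) h = -ᶻ unit g h

count-∷ : ∀ {l} (h g : Fin l) w → + count h (g ∷ w) ≡ + count h w +ᶻ unit g h
count-∷ h g w with g Finₚ.≟ h
... | yes _ = ℤₚ.+-comm 1ℤ (+ count h w)
... | no _ = sym (ℤₚ.+-identityʳ (+ count h w))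

module _ {l : ℕ} {W : List (Fin l)} {t : Maybe (Fin l)} (hd : List.head W ≡ t) where

  top-head : ∀ U → top t U ≡ List.head (U ++ W)
  top-head [] = sym hd
  top-head (g ∷ U) = refl

  App-count : ∀ f {U U′} → App t f U U′ → ∀ h → + count h (U ++ W) +ᶻ effδ f h ≡ + count h (U′ ++ W)
  App-count (look s) {U} (_ , refl) h = ℤₚ.+-identityʳ (+ count h (U ++ W))
  App-count (psh g) {U} refl h = sym (count-∷ h g (U ++ W))
  App-count (pul g) {U′ = U′} refl h = trans (cong (_+ᶻ -ᶻ unit g h) (count-∷ h g (U′ ++ W))) (lem (+ count h (U′ ++ W)) (unit g h))
    where
    lem : ∀ c u → c +ᶻ u +ᶻ -ᶻ u ≡ c
    lem = solve-∀

  head⇒∷ : ∀ {w : List (Fin l)} {a} → List.head w ≡ just a → Σ (List (Fin l)) λ u → w ≡ a ∷ u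
  head⇒∷ {a ∷ u} refl = u , refl

  App-sound : ∀ o f {U U′} → EffOK o f → App t f U U′ → StackRel o (U ++ W) (U′ ++ W)
  App-sound nop (look s) ok (_ , refl) = refl
  App-sound (push a) (psh .a) refl refl = refl
  App-sound pop (pul g) ok refl = g , refl
  App-sound (topIs a) (look s) {U} ok (e , refl) = head⇒∷ (trans (sym (top-head U)) (trans e ok)) , refl
  App-sound topIsBot (look s) {U} ok (e , refl) = empty (U ++ W) (trans (sym (top-head U)) (trans e ok)) , refl
    where
    empty : ∀ (w : List (Fin l)) → List.head w ≡ nothing → w ≡ []
    empty [] _ = refl

  App-complete : ∀ o U U′ → StackRel o (U ++ W) (U′ ++ W) → Σ (Eff l) λ f → EffOK o f × App t f U U′
  App-complete nop U U′ e = look (top t U) , tt , refl , Listₚ.++-cancelʳ W U′ U e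
  App-complete (push a) U U′ e = psh a , refl , Listₚ.++-cancelʳ W U′ (a ∷ U) e
  -- Popping a symbol of `W` itself is impossible, because the result still ends with all of `W`.
  App-complete pop [] U′ (a , e) = ⊥-elim (ℕₚ.<-irrefl (cong length e) (s≤s (subst (length W ≤_) (sym (Listₚ.length-++ U′)) (ℕₚ.m≤n+m (length W) (length U′)))))
  App-complete pop (g ∷ U) U′ (a , e) = pul g , tt , cong (g ∷_) (Listₚ.++-cancelʳ W U U′ (Listₚ.∷-injectiveʳ e))
  App-complete (topIs a) U U′ ((u , e) , e′) =
    look (just a) , refl , trans (top-head U) (cong List.head e) , Listₚ.++-cancelʳ W U′ U e′
  App-complete topIsBot U U′ (e , e′) =
    look nothing , refl , trans (top-head U) (cong List.head e) , Listₚ.++-cancelʳ W U′ U e′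

updδ : CtrUpd → ℤ
updδ incr = 1ℤ
updδ decr = -1ℤ
updδ keep = 0ℤ

upd-δ : ∀ u v → v +ᶻ updδ u ≡ ctrUpd u v
upd-δ incr v = refl
upd-δ decr v = refl
upd-δ keep v = ℤₚ.+-identityʳ v

module Phased {nS m k l : ℕ} (A : Automaton nS m k l) where

  open Automaton A
  open ClockAbstraction m (clockBound A) public

  CV : Set
  CV = ConfVar m k l

  finCV : Finite CV
  finCV = finite-ConfVar m k l

  Cfg : Set
  Cfg = Config nS m k l

  Flags : Set
  Flags = Vec Bool m

  allTrue : Flags
  allTrue = replicate m true

  -- kept flags the clocks that are not reset during the phase.
  record Phase : Set where
    constructor mkPhase
    field
      pkind : PKind
      stage : Vec Stage k
      kept  : Flags
      end   : Fin nS
      post  : QF CV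

  open Phase

  Allowed : PKind → Vec Stage k → Edge nS m k l → Set
  Allowed initP σ e = ⊥
  Allowed oneP σ e = ∀ j → TestOK (proj₂ (lookup σ j)) (ctest e j)
  Allowed segP σ e = ∀ j → TestOK (proj₂ (lookup σ j)) (ctest e j) × UpdOK (proj₁ (lookup σ j)) (cupd e j)

  Allowed? : ∀ κ σ e → Dec (Allowed κ σ e)
  Allowed? initP σ e = no λ ()
  Allowed? oneP σ e = Finₚ.all? λ j → TestOK? _ _
  Allowed? segP σ e = Finₚ.all? λ j → TestOK? _ _ ×-dec UpdOK? _ _

  -- The counter tests are left out: in a phase they follow from the signs of the counters at its ends.
  Move : Edge nS m k l → Cfg → Cfg → Set
  Move e c c′ =
    state c ≡ src e × state c′ ≡ tgt e × ClockStep A e c c′ ×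
    (∀ j → counters c′ j ≡ ctrUpd (cupd e j) (counters c j)) × StackRel (stack e) (stackW c) (stackW c′)

  -- Flags are propagated backwards: a clock survives the rest of a phase if this edge does not
  -- reset it and it survives what follows. A machine that runs forwards guesses at each reset of a
  -- clock whether it is the last one.
  before : Kind m → Flags → Flags
  before progress f = f
  before (reset R C) f = tabulate λ i → lookup f i ∧ not (R i)

  pushed : Fin l → Cfg → Cfg
  pushed g c = conf (state c) (clocks c) (counters c) (g ∷ stackW c)

  Above : List (Fin l) → Cfg → Set
  Above W c = Σ (List (Fin l)) λ U → stackW c ≡ U ++ W

  data PhRun (W : List (Fin l)) (ph : Phase) : Flags → ℕ → Cfg → Cfg → Set where
    pdone : ∀ {c} → Above W c → PhRun W ph allTrue 0 c c
    pedge : ∀ x {f n c c₁ c′} → Allowed (pkind ph) (stage ph) (edge A x) → Move (edge A x) c c₁ → Above W c →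
            PhRun W ph f n c₁ c′ → PhRun W ph (before (kind (edge A x)) f) (suc n) c c′
    pinit : pkind ph ≡ initP → ∀ g {f n c c′} → Above W c → PhRun W ph f n (pushed g c) c′ → PhRun W ph f n c c′

  -- The control state is tracked by the machine, which frees stateV to count steps.
  pre : Flags → (CV → ℤ) → CV → ℤ
  pre f x stateV = 0ℤ
  pre f x (clockV i) = if lookup f i then x (clockV i) else 0ℤ
  pre f x (ctrV j) = x (ctrV j)
  pre f x (countV g) = x (countV g)

  tally : ℕ → (CV → ℤ) → CV → ℤ
  tally n x stateV = + n
  tally n x (clockV i) = x (clockV i)
  tally n x (ctrV j) = x (ctrV j)
  tally n x (countV g) = x (countV g)

  -- The invariant that links labels to values, with `u` the sum of the labels up to the end of the
  -- phase. For a clock that is still to be reset the old value is dropped, and `u` counts only the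
  -- time after its last reset, since `tickδ` is 0 as long as the flag is false.
  Num : Flags → (CV → ℤ) → (CV → ℤ) → ℕ → (CV → ℤ) → Set
  Num f x u n x′ = ∀ y → tally n x′ y ≡ pre f x y +ᶻ u y

  steps : ℕ → CV → ℤ
  steps n stateV = + n
  steps n _ = 0ℤ

  Shift : Flags → (CV → ℤ) → (CV → ℤ) → ℕ → Flags → (CV → ℤ) → Set
  Shift f x d n f′ x′ = ∀ y → pre f x y +ᶻ d y ≡ pre f′ x′ y +ᶻ steps n y

  tally-+ : ∀ a n x y → tally (a + n) x y ≡ steps a y +ᶻ tally n x y
  tally-+ a n x stateV = ℤₚ.pos-+ a n
  tally-+ a n x (clockV i) = sym (ℤₚ.+-identityˡ _)
  tally-+ a n x (ctrV j) = sym (ℤₚ.+-identityˡ _)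
  tally-+ a n x (countV g) = sym (ℤₚ.+-identityˡ _)

  Num-shift : ∀ {f x d a f′ x₁ u v n x′} → Shift f x d a f′ x₁ → (∀ y → v y ≡ d y +ᶻ u y) →
              Num f′ x₁ u n x′ → Num f x v (a + n) x′
  Num-shift {f} {x} {d} {a} {f′} {x₁} {u} {v} {n} {x′} sh e num y = begin
    tally (a + n) x′ y                    ≡⟨ tally-+ a n x′ y ⟩
    steps a y +ᶻ tally n x′ y             ≡⟨ cong (steps a y +ᶻ_) (num y) ⟩
    steps a y +ᶻ (pre f′ x₁ y +ᶻ u y)     ≡⟨ lem (steps a y) (pre f′ x₁ y) (u y) ⟩
    pre f′ x₁ y +ᶻ steps a y +ᶻ u y       ≡⟨ cong (_+ᶻ u y) (sym (sh y)) ⟩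
    pre f x y +ᶻ d y +ᶻ u y               ≡⟨ trans (ℤₚ.+-assoc (pre f x y) (d y) (u y)) (cong (pre f x y +ᶻ_) (sym (e y))) ⟩
    pre f x y +ᶻ v y ∎
    where
    open ≡-Reasoning
    lem : ∀ s p u → s +ᶻ (p +ᶻ u) ≡ p +ᶻ s +ᶻ u
    lem = solve-∀

  Num-done : ∀ {x u} → (∀ y → u y ≡ 0ℤ) → Num allTrue x u 0 x
  Num-done {x} {u} z y = trans (same y) (trans (sym (ℤₚ.+-identityʳ _)) (cong (pre allTrue x y +ᶻ_) (sym (z y))))
    where
    same : ∀ y → tally 0 x y ≡ pre allTrue x y
    same stateV = refl
    same (clockV i) = sym (cong (λ b → if b then x (clockV i) else 0ℤ) (Vecₚ.lookup-replicate i true))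
    same (ctrV j) = refl
    same (countV g) = refl

  nxt : Phase → (CV → ℤ) → (CV → ℤ) → CV → ℤ
  nxt ph x u stateV = + toℕ (end ph)
  nxt ph x u y = pre (kept ph) x y +ᶻ u y

  Signs : Vec Stage k → (CV → ℤ) → Set
  Signs σ x = ∀ j → HasSign (proj₂ (lookup σ j)) (x (ctrV j))

  KindOK : PKind → Vec Stage k → (CV → ℤ) → ℤ → (CV → ℤ) → Set
  KindOK initP σ x n x′ = ⊤
  KindOK oneP σ x n x′ = Signs σ x × n ≡ 1ℤ
  KindOK segP σ x n x′ = Signs σ x × Signs σ x′

  Cons : Phase → (CV → ℤ) → ℤ → (CV → ℤ) → Set
  Cons ph x n x′ = KindOK (pkind ph) (stage ph) x n x′ × ⟦ post ph ⟧ᵠ x′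

  Cons-cong : ∀ ph {x y n n′ x′ y′} → (∀ z → x z ≡ y z) → n ≡ n′ → (∀ z → x′ z ≡ y′ z) → Cons ph x n x′ → Cons ph y n′ y′
  Cons-cong ph {x} {y} {x′ = x′} {y′} e refl e′ (ko , po) = go (pkind ph) ko , proj₁ (eval-cong e′ (post ph)) po
    where
    signs : ∀ {u v : CV → ℤ} → (∀ z → u z ≡ v z) → Signs (stage ph) u → Signs (stage ph) v
    signs e h j = subst (HasSign _) (e (ctrV j)) (h j)
    go : ∀ p {n} → KindOK p (stage ph) x n x′ → KindOK p (stage ph) y n y′
    go initP _ = tt
    go oneP (s , n) = signs e s , n
    go segP (s , s′) = signs e s , signs e′ s′

  module _ {V : Set} where

    signQ : Sign → Lin V → QF V
    signQ negative t = ltᵠ t (lcon 0ℤ)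
    signQ null t = eqᵠ t (lcon 0ℤ)
    signQ positive t = ltᵠ (lcon 0ℤ) t

    signQ-spec : ∀ ρ s t → ⟦ signQ s t ⟧ᵠ ρ ⟷ HasSign s (⟦ t ⟧ˡ ρ)
    signQ-spec ρ negative t = lt-spec ρ t (lcon 0ℤ)
    signQ-spec ρ null t = eq-spec ρ t (lcon 0ℤ)
    signQ-spec ρ positive t = lt-spec ρ (lcon 0ℤ) t

    signsQ : Vec Stage k → (CV → Lin V) → QF V
    signsQ σ x = andFin k λ j → signQ (proj₂ (lookup σ j)) (x (ctrV j))

    evalAll : (V → ℤ) → (CV → Lin V) → CV → ℤ
    evalAll ρ x y = ⟦ x y ⟧ˡ ρ

    signsQ-spec : ∀ ρ σ x → ⟦ signsQ σ x ⟧ᵠ ρ ⟷ Signs σ (evalAll ρ x)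
    signsQ-spec ρ σ x = ⟷-trans (andFin-spec ρ k _)
      ((λ h j → proj₁ (signQ-spec ρ _ (x (ctrV j))) (h j)) , λ h j → proj₂ (signQ-spec ρ _ (x (ctrV j))) (h j))

    kindQ : PKind → Vec Stage k → (CV → Lin V) → Lin V → (CV → Lin V) → QF V
    kindQ initP σ x n x′ = ttᵠ
    kindQ oneP σ x n x′ = and (signsQ σ x) (eqᵠ n (lcon 1ℤ))
    kindQ segP σ x n x′ = and (signsQ σ x) (signsQ σ x′)

    kindQ-spec : ∀ ρ p σ x n x′ → ⟦ kindQ p σ x n x′ ⟧ᵠ ρ ⟷ KindOK p σ (evalAll ρ x) (⟦ n ⟧ˡ ρ) (evalAll ρ x′)
    kindQ-spec ρ initP σ x n x′ = (λ _ → tt) , λ _ → tt-holds {ρ = ρ}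
    kindQ-spec ρ oneP σ x n x′ = ×-⟷ (signsQ-spec ρ σ x) (eq-spec ρ n (lcon 1ℤ))
    kindQ-spec ρ segP σ x n x′ = ×-⟷ (signsQ-spec ρ σ x) (signsQ-spec ρ σ x′)

    consQ : Phase → (CV → Lin V) → Lin V → (CV → Lin V) → QF V
    consQ ph x n x′ = and (kindQ (pkind ph) (stage ph) x n x′) (sub x′ (post ph))

    consQ-spec : ∀ ρ ph x n x′ → ⟦ consQ ph x n x′ ⟧ᵠ ρ ⟷ Cons ph (evalAll ρ x) (⟦ n ⟧ˡ ρ) (evalAll ρ x′)
    consQ-spec ρ ph x n x′ = ×-⟷ (kindQ-spec ρ (pkind ph) (stage ph) x n x′) (sub-eval x′ ρ (evalAll ρ x′) (λ _ → refl) (post ph))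

    preT : Flags → (CV → Lin V) → CV → Lin V
    preT f x stateV = lcon 0ℤ
    preT f x (clockV i) = if lookup f i then x (clockV i) else lcon 0ℤ
    preT f x (ctrV j) = x (ctrV j)
    preT f x (countV g) = x (countV g)

    preT-eval : ∀ ρ f x y → ⟦ preT f x y ⟧ˡ ρ ≡ pre f (evalAll ρ x) y
    preT-eval ρ f x stateV = refl
    preT-eval ρ f x (clockV i) with lookup f i
    ... | true = refl
    ... | false = refl
    preT-eval ρ f x (ctrV j) = refl
    preT-eval ρ f x (countV g) = refl

    nxtT : Phase → (CV → Lin V) → (CV → Lin V) → CV → Lin V
    nxtT ph x u stateV = lcon (+ toℕ (end ph))
    nxtT ph x u y = preT (kept ph) x y ⊞ u y

    nxtT-eval : ∀ ρ ph x u y → ⟦ nxtT ph x u y ⟧ˡ ρ ≡ nxt ph (evalAll ρ x) (evalAll ρ u) y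
    nxtT-eval ρ ph x u stateV = refl
    nxtT-eval ρ ph x u (clockV i) = cong (_+ᶻ ⟦ u (clockV i) ⟧ˡ ρ) (preT-eval ρ (kept ph) x (clockV i))
    nxtT-eval ρ ph x u (ctrV j) = refl
    nxtT-eval ρ ph x u (countV g) = refl

  pre-cong : ∀ f {x x₁ : CV → ℤ} → (∀ z → x z ≡ x₁ z) → ∀ y → pre f x y ≡ pre f x₁ y
  pre-cong f e stateV = refl
  pre-cong f e (clockV i) = cong (λ z → if lookup f i then z else 0ℤ) (e (clockV i))
  pre-cong f e (ctrV j) = e (ctrV j)
  pre-cong f e (countV g) = e (countV g)

  nxt-cong : ∀ ph {x x₁ u u₁ : CV → ℤ} → (∀ z → x z ≡ x₁ z) → (∀ z → u z ≡ u₁ z) → ∀ y → nxt ph x u y ≡ nxt ph x₁ u₁ y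
  nxt-cong ph e e′ stateV = refl
  nxt-cong ph e e′ (clockV i) = cong₂ _+ᶻ_ (pre-cong (kept ph) e (clockV i)) (e′ (clockV i))
  nxt-cong ph e e′ (ctrV j) = cong₂ _+ᶻ_ (e (ctrV j)) (e′ (ctrV j))
  nxt-cong ph e e′ (countV g) = cong₂ _+ᶻ_ (e (countV g)) (e′ (countV g))

  -- The numerical content of n phases from x to y with labels v.
  Bd : (ℕ → Phase) → ℕ → (CV → ℤ) → (ℕ → CV → ℤ) → (CV → ℤ) → Set
  Bd Φ zero x v y = ∀ z → x z ≡ y z
  Bd Φ (suc n) x v y = Σ (CV → ℤ) λ x′ → (∀ z → x′ z ≡ nxt (Φ n) x (v n) z) × Cons (Φ n) x (v n stateV) x′ × Bd Φ n x′ v y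

  Bd-cong : ∀ Φ n {x x₁ v v₁ y} → (∀ z → x z ≡ x₁ z) → (∀ i z → i < n → v i z ≡ v₁ i z) → Bd Φ n x v y → Bd Φ n x₁ v₁ y
  Bd-cong Φ zero e e′ h z = trans (sym (e z)) (h z)
  Bd-cong Φ (suc n) e e′ (x′ , ex , co , h) =
    x′ , (λ z → trans (ex z) (nxt-cong (Φ n) e (λ z → e′ n z ℕₚ.≤-refl) z)) , Cons-cong (Φ n) e (e′ n stateV ℕₚ.≤-refl) (λ _ → refl) co ,
    Bd-cong Φ n (λ _ → refl) (λ i z i< → e′ i z (ℕₚ.m≤n⇒m≤1+n i<)) h

  -- The tuples between the phases need no quantifiers: each of them is a linear term in the first
  -- tuple and the labels.
  BdQ : ∀ {V} → (ℕ → Phase) → ℕ → (CV → Lin V) → (ℕ → CV → Lin V) → (CV → Lin V) → QF V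
  BdQ Φ zero x v y = andF finCV λ z → eqᵠ (x z) (y z)
  BdQ Φ (suc n) x v y = and (consQ (Φ n) x (v n stateV) (nxtT (Φ n) x (v n))) (BdQ Φ n (nxtT (Φ n) x (v n)) v y)

  BdQ-spec : ∀ {V} (ρ : V → ℤ) Φ n x v y → ⟦ BdQ Φ n x v y ⟧ᵠ ρ ⟷ Bd Φ n (evalAll ρ x) (λ i → evalAll ρ (v i)) (evalAll ρ y)
  BdQ-spec ρ Φ zero x v y = ⟷-trans (andF-spec finCV ρ (λ z → eqᵠ (x z) (y z)))
    ((λ h z → proj₁ (eq-spec ρ (x z) (y z)) (h z)) , λ h z → proj₂ (eq-spec ρ (x z) (y z)) (h z))
  BdQ-spec ρ Φ (suc n) x v y =
    (λ (co , h) → evalAll ρ x₁ , nxtT-eval ρ (Φ n) x (v n) , proj₁ (consQ-spec ρ (Φ n) x (v n stateV) x₁) co , proj₁ (BdQ-spec ρ Φ n x₁ v y) h) ,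
    (λ (x′ , ex , co , h) →
      proj₂ (consQ-spec ρ (Φ n) x (v n stateV) x₁) (Cons-cong (Φ n) (λ _ → refl) refl (same x′ ex) co) ,
      proj₂ (BdQ-spec ρ Φ n x₁ v y) (Bd-cong Φ n (same x′ ex) (λ _ _ _ → refl) h))
    where
    x₁ = nxtT (Φ n) x (v n)
    same : ∀ x′ → (∀ z → x′ z ≡ nxt (Φ n) (evalAll ρ x) (evalAll ρ (v n)) z) → ∀ z → x′ z ≡ evalAll ρ x₁ z
    same x′ ex z = trans (ex z) (sym (nxtT-eval ρ (Φ n) x (v n) z))

  PhaseOK : List (Fin l) → Phase → Cfg → Cfg → Set
  PhaseOK W ph c c′ = Σ ℕ λ n → PhRun W ph (kept ph) n c c′ × state c′ ≡ end ph × Cons ph (confVal c) (+ n) (confVal c′)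

  PhasedRun : (ℕ → Phase) → List (Fin l) → ℕ → Cfg → Cfg → Set
  PhasedRun Φ W zero c d = c ≡ d
  PhasedRun Φ W (suc n) c d = Σ Cfg λ c′ → PhaseOK W (Φ n) c c′ × PhasedRun Φ W n c′ d

  -- Actions and labels of the simulating machine

  data Act : Set where
    edgeA : Fin (length edges) → Act
    tickA exitA nextA pushA endA drainA : Act

  finAct : Finite Act
  finAct = finite-retract to from from-to (finite-⊎ (finite-Fin (length edges)) (finite-Fin 6))
    where
    to : Act → Fin (length edges) ⊎ Fin 6
    to (edgeA x) = inj₁ x
    to tickA = inj₂ zero
    to exitA = inj₂ (suc zero)
    to nextA = inj₂ (suc (suc zero))
    to pushA = inj₂ (suc (suc (suc zero)))
    to endA = inj₂ (suc (suc (suc (suc zero))))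
    to drainA = inj₂ (suc (suc (suc (suc (suc zero)))))
    from : Fin (length edges) ⊎ Fin 6 → Act
    from (inj₁ x) = edgeA x
    from (inj₂ zero) = tickA
    from (inj₂ (suc zero)) = exitA
    from (inj₂ (suc (suc zero))) = nextA
    from (inj₂ (suc (suc (suc zero)))) = pushA
    from (inj₂ (suc (suc (suc (suc zero))))) = endA
    from (inj₂ (suc (suc (suc (suc (suc zero)))))) = drainA
    from-to : ∀ a → from (to a) ≡ a
    from-to (edgeA x) = refl
    from-to tickA = refl
    from-to exitA = refl
    from-to nextA = refl
    from-to pushA = refl
    from-to endA = refl
    from-to drainA = refl

  tickδ : Flags → Fin m → ℤ
  tickδ f i = if lookup f i then 1ℤ else 0ℤ

  clockδ : Kind m → Flags → Fin m → ℤ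
  clockδ progress f i = tickδ f i
  clockδ (reset R C) f i = 0ℤ

  δ : Act → Eff l → Flags → CV → ℤ
  δ (edgeA x) f g stateV = 1ℤ
  δ (edgeA x) f g (clockV i) = clockδ (kind (edge A x)) g i
  δ (edgeA x) f g (ctrV j) = updδ (cupd (edge A x) j)
  δ (edgeA x) f g (countV h) = effδ f h
  δ tickA f g (clockV i) = tickδ g i
  δ pushA f g (countV h) = effδ f h
  δ _ f g y = 0ℤ

  clock-carry : ∀ (b : Bool) n → (if b then + n else 0ℤ) +ᶻ (if b then 1ℤ else 0ℤ) ≡ (if b then + suc n else 0ℤ)
  clock-carry true n = ℤₚ.+-comm (+ n) 1ℤ
  clock-carry false n = refl

  Shift-tick : ∀ f g (c : Cfg) clk → (∀ i → clk i ≡ suc (clocks c i)) →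
               Shift f (confVal c) (δ tickA g f) 0 f (confVal (conf (state c) clk (counters c) (stackW c)))
  Shift-tick f g c clk h stateV = refl
  Shift-tick f g c clk h (clockV i) = trans (clock-carry (lookup f i) (clocks c i))
    (trans (cong (λ n → if lookup f i then + n else 0ℤ) (sym (h i))) (sym (ℤₚ.+-identityʳ _)))
  Shift-tick f g c clk h (ctrV j) = refl
  Shift-tick f g c clk h (countV a) = refl

  Shift-edge : ∀ x g f′ (c c₁ : Cfg) →
               (∀ i → (if lookup (before (kind (edge A x)) f′) i then + clocks c i else 0ℤ) +ᶻ clockδ (kind (edge A x)) (before (kind (edge A x)) f′) i
                        ≡ (if lookup f′ i then + clocks c₁ i else 0ℤ)) →
               (∀ j → counters c₁ j ≡ ctrUpd (cupd (edge A x) j) (counters c j)) →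
               (∀ h → + count h (stackW c) +ᶻ effδ g h ≡ + count h (stackW c₁)) →
               Shift (before (kind (edge A x)) f′) (confVal c) (δ (edgeA x) g (before (kind (edge A x)) f′)) 1 f′ (confVal c₁)
  Shift-edge x g f′ c c₁ hc hj hs stateV = refl
  Shift-edge x g f′ c c₁ hc hj hs (clockV i) = trans (hc i) (sym (ℤₚ.+-identityʳ _))
  Shift-edge x g f′ c c₁ hc hj hs (ctrV j) = trans (upd-δ (cupd (edge A x) j) (counters c j)) (trans (sym (hj j)) (sym (ℤₚ.+-identityʳ _)))
  Shift-edge x g f′ c c₁ hc hj hs (countV h) = trans (hs h) (sym (ℤₚ.+-identityʳ _))

  reset-carry : ∀ R C f (x y : Clocks m) → (∀ i → y i ≡ (if R i then 0 else x i)) → ∀ i →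
                (if lookup (before (reset R C) f) i then + x i else 0ℤ) +ᶻ 0ℤ ≡ (if lookup f i then + y i else 0ℤ)
  reset-carry R C f x y h i = trans (ℤₚ.+-identityʳ _) (trans (cong (λ b → if b then + x i else 0ℤ) (Vecₚ.lookup∘tabulate (λ i → lookup f i ∧ not (R i)) i)) (go (lookup f i) (R i) (h i)))
    where
    go : ∀ b r → y i ≡ (if r then 0 else x i) → (if b ∧ not r then + x i else 0ℤ) ≡ (if b then + y i else 0ℤ)
    go true true e = cong +_ (sym e)
    go true false e = cong +_ (sym e)
    go false r e = refl

  -- ClockStep is stuck on the kind of the edge; this version takes the kind as an argument.
  ClockStepK : Kind m → Edge nS m k l → Cfg → Cfg → Set
  ClockStepK progress e c c′ =
    tgt e ≡ src e × Σ ℕ λ d → 1 ≤ d × (∀ i → clocks c′ i ≡ clocks c i + d) × (∀ t → t ≤ d → (λ i → clocks c i + t) ⊨ᶜ Inv (src e))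
  ClockStepK (reset R C) e c c′ =
    (clocks c ⊨ᶜ Inv (src e)) × (clocks c ⊨ᶜ C) × (∀ i → clocks c′ i ≡ (if R i then 0 else clocks c i)) × (clocks c′ ⊨ᶜ Inv (tgt e))

  ClockStep⟷K : ∀ e c c′ → ClockStep A e c c′ ⟷ ClockStepK (kind e) e c c′
  ClockStep⟷K e c c′ with kind e
  ... | progress = ⟷-refl
  ... | reset R C = ⟷-refl

  -- A machine state: phase, control state, whether a progress step is under way, clock abstraction,
  -- and the clocks that will not be reset any more in the phase.
  record St (κ : ℕ) : Set where
    constructor ⟪_,_,_,_,_⟫
    field
      ix  : Fin (suc κ)
      st  : Fin nS
      tk  : Bool
      mat : Mat
      flg : Flags

  open St

  finSt : ∀ κ → Finite (St κ)
  finSt κ = finite-retract (λ r → ix r , st r , tk r , mat r , flg r) (λ (i , s , b , D , f) → ⟪ i , s , b , D , f ⟫) (λ _ → refl)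
    (finite-× (finite-Fin (suc κ)) (finite-× (finite-Fin nS) (finite-× finite-Bool (finite-× finMat (finite-Vec finite-Bool m)))))

  IsLook IsPsh IsPul : Eff l → Set
  IsLook (look _) = ⊤
  IsLook _ = ⊥
  IsPsh (psh _) = ⊤
  IsPsh _ = ⊥
  IsPul (pul _) = ⊤
  IsPul _ = ⊥

  IsLook? : ∀ f → Dec (IsLook f)
  IsLook? (look _) = yes tt
  IsLook? (psh _) = no λ ()
  IsLook? (pul _) = no λ ()
  IsPsh? : ∀ f → Dec (IsPsh f)
  IsPsh? (look _) = no λ ()
  IsPsh? (psh _) = yes tt
  IsPsh? (pul _) = no λ ()
  IsPul? : ∀ f → Dec (IsPul f)
  IsPul? (look _) = no λ ()
  IsPul? (psh _) = no λ ()
  IsPul? (pul _) = yes tt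

  On : ∀ {R : Set} → (R → R → Set) → Maybe R → Maybe R → Set
  On P (just r) (just r′) = P r r′
  On P (just r) nothing = ⊥
  On P nothing q′ = ⊥

  On? : ∀ {R : Set} {P : R → R → Set} → (∀ r r′ → Dec (P r r′)) → ∀ q q′ → Dec (On P q q′)
  On? P? (just r) (just r′) = P? r r′
  On? P? (just r) nothing = no λ ()
  On? P? nothing q′ = no λ ()

  mat≟ : (D E : Mat) → Dec (D ≡ E)
  mat≟ = ≟-finite finMat

  flg≟ : (f g : Flags) → Dec (f ≡ g)
  flg≟ = ≟-finite (finite-Vec finite-Bool m)

  -- The phases are numbered downwards: phase κ comes first and phase 0 last.
  module Simulation (Φ : ℕ → Phase) (κ : ℕ) (Dend : Mat) (tend : Maybe (Fin l)) where

    phaseOf : St κ → Phase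
    phaseOf r = Φ (toℕ (ix r))

    -- A progress step of arbitrary duration is cut into units: the edge itself takes the first unit
    -- together with the counter and stack operations, `tickA` takes the others, and `exitA` ends
    -- the step. The invariant is tested after each unit, and the duration is at least 1.
    ClockMove : Kind m → Edge nS m k l → St κ → St κ → Set
    ClockMove progress e r r′ =
      tk r′ ≡ true × tgt e ≡ src e × mat r ⊨ᵃ Inv (src e) × mat r′ ≡ tickM (mat r) × mat r′ ⊨ᵃ Inv (src e) × flg r ≡ flg r′
    ClockMove (reset R C) e r r′ =
      tk r′ ≡ false × mat r ⊨ᵃ Inv (src e) × mat r ⊨ᵃ C × mat r′ ≡ resetM R (mat r) × mat r′ ⊨ᵃ Inv (tgt e) × flg r ≡ before (reset R C) (flg r′)

    EdgeMove : Fin (length edges) → Eff l → St κ → St κ → Set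
    EdgeMove x f r r′ =
      ix r′ ≡ ix r × st r ≡ src (edge A x) × st r′ ≡ tgt (edge A x) × tk r ≡ false ×
      Allowed (pkind (phaseOf r)) (stage (phaseOf r)) (edge A x) × EffOK (stack (edge A x)) f × ClockMove (kind (edge A x)) (edge A x) r r′

    TickMove ExitMove NextMove PushMove : St κ → St κ → Set
    TickMove r r′ = ix r′ ≡ ix r × st r′ ≡ st r × tk r ≡ true × tk r′ ≡ true × mat r′ ≡ tickM (mat r) × mat r′ ⊨ᵃ Inv (st r) × flg r′ ≡ flg r
    ExitMove r r′ = ix r′ ≡ ix r × st r′ ≡ st r × tk r ≡ true × tk r′ ≡ false × mat r′ ≡ mat r × flg r′ ≡ flg r
    NextMove r r′ = toℕ (ix r) ≡ suc (toℕ (ix r′)) × st r′ ≡ st r × tk r ≡ false × tk r′ ≡ false × mat r′ ≡ mat r ×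
                    flg r ≡ allTrue × flg r′ ≡ kept (phaseOf r′) × st r ≡ end (phaseOf r)
    PushMove r r′ = pkind (phaseOf r) ≡ initP × ix r′ ≡ ix r × st r′ ≡ st r × tk r ≡ false × tk r′ ≡ false × mat r′ ≡ mat r × flg r′ ≡ flg r

    EndMove : Eff l → Maybe (St κ) → Set
    EndMove (look t) (just r) = t ≡ tend × toℕ (ix r) ≡ 0 × tk r ≡ false × mat r ≡ Dend × flg r ≡ allTrue × st r ≡ end (phaseOf r)
    EndMove _ _ = ⊥

    IsNothing : Maybe (St κ) → Set
    IsNothing nothing = ⊤
    IsNothing (just _) = ⊥

    -- From nothing, entered at the end of the last phase, the remaining stack is popped, so that a
    -- run which raises the stack becomes a balanced one.
    tr : Act → Eff l → Maybe (St κ) → Maybe (St κ) → Set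
    tr (edgeA x) f q q′ = On (EdgeMove x f) q q′
    tr tickA f q q′ = IsLook f × On TickMove q q′
    tr exitA f q q′ = IsLook f × On ExitMove q q′
    tr nextA f q q′ = IsLook f × On NextMove q q′
    tr pushA f q q′ = IsPsh f × On PushMove q q′
    tr endA f q q′ = EndMove f q × IsNothing q′
    tr drainA f q q′ = IsPul f × IsNothing q × IsNothing q′

    ClockMove? : ∀ K e r r′ → Dec (ClockMove K e r r′)
    ClockMove? progress e r r′ =
      (tk r′ Boolₚ.≟ true) ×-dec (tgt e Finₚ.≟ src e) ×-dec (mat r ⊨ᵃ? Inv (src e)) ×-dec mat≟ _ _ ×-dec (mat r′ ⊨ᵃ? Inv (src e)) ×-dec flg≟ _ _
    ClockMove? (reset R C) e r r′ =
      (tk r′ Boolₚ.≟ false) ×-dec (mat r ⊨ᵃ? Inv (src e)) ×-dec (mat r ⊨ᵃ? C) ×-dec mat≟ _ _ ×-dec (mat r′ ⊨ᵃ? Inv (tgt e)) ×-dec flg≟ _ _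

    IsNothing? : ∀ q → Dec (IsNothing q)
    IsNothing? nothing = yes tt
    IsNothing? (just _) = no λ ()

    EndMove? : ∀ f q → Dec (EndMove f q)
    EndMove? (look t) (just r) =
      Top≟ t tend ×-dec (toℕ (ix r) ℕₚ.≟ 0) ×-dec (tk r Boolₚ.≟ false) ×-dec mat≟ _ _ ×-dec flg≟ _ _ ×-dec (st r Finₚ.≟ _)
    EndMove? (look t) nothing = no λ ()
    EndMove? (psh _) q = no λ ()
    EndMove? (pul _) q = no λ ()

    tr? : ∀ a f q q′ → Dec (tr a f q q′)
    tr? (edgeA x) f = On? λ r r′ →
      (ix r′ Finₚ.≟ ix r) ×-dec (st r Finₚ.≟ _) ×-dec (st r′ Finₚ.≟ _) ×-dec (tk r Boolₚ.≟ false) ×-dec Allowed? _ _ _ ×-dec EffOK? _ f ×-dec ClockMove? _ _ r r′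
    tr? tickA f q q′ = IsLook? f ×-dec On? (λ r r′ →
      (ix r′ Finₚ.≟ ix r) ×-dec (st r′ Finₚ.≟ st r) ×-dec (tk r Boolₚ.≟ true) ×-dec (tk r′ Boolₚ.≟ true) ×-dec mat≟ _ _ ×-dec (mat r′ ⊨ᵃ? Inv (st r)) ×-dec flg≟ _ _) q q′
    tr? exitA f q q′ = IsLook? f ×-dec On? (λ r r′ →
      (ix r′ Finₚ.≟ ix r) ×-dec (st r′ Finₚ.≟ st r) ×-dec (tk r Boolₚ.≟ true) ×-dec (tk r′ Boolₚ.≟ false) ×-dec mat≟ _ _ ×-dec flg≟ _ _) q q′
    tr? nextA f q q′ = IsLook? f ×-dec On? (λ r r′ →
      (toℕ (ix r) ℕₚ.≟ _) ×-dec (st r′ Finₚ.≟ st r) ×-dec (tk r Boolₚ.≟ false) ×-dec (tk r′ Boolₚ.≟ false) ×-dec mat≟ _ _ ×-dec flg≟ _ _ ×-dec flg≟ _ _ ×-dec (st r Finₚ.≟ _)) q q′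
    tr? pushA f q q′ = IsPsh? f ×-dec On? (λ r r′ →
      isInit? _ ×-dec (ix r′ Finₚ.≟ ix r) ×-dec (st r′ Finₚ.≟ st r) ×-dec (tk r Boolₚ.≟ false) ×-dec (tk r′ Boolₚ.≟ false) ×-dec mat≟ _ _ ×-dec flg≟ _ _) q q′
    tr? endA f q q′ = EndMove? f q ×-dec IsNothing? q′
    tr? drainA f q q′ = IsPul? f ×-dec IsNothing? q ×-dec IsNothing? q′

    finX : Finite (Fin (suc κ) × CV)
    finX = finite-× (finite-Fin (suc κ)) finCV

    dim : ℕ
    dim = Finite.size finX

    -- Each phase has coordinates of its own. The label of a run is a single sum in a commutative
    -- monoid, and this keeps the contributions of the phases apart in it.
    inPhase : Fin (suc κ) → (CV → ℤ) → Fin (suc κ) × CV → ℤ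
    inPhase i d (j , y) with i Finₚ.≟ j
    ... | yes _ = d y
    ... | no _ = 0ℤ

    abstract
      lab : Act → Eff l → Maybe (St κ) → Vec ℤ dim
      lab a f (just r) = tabulate λ p → inPhase (ix r) (δ a f (flg r)) (Finite.dec finX p)
      lab a f nothing = 0ᵛ

      get : Vec ℤ dim → ℕ → CV → ℤ
      get v n y = lookup v (Finite.enc finX (cap κ n , y))

      get-lookup : ∀ v n y → get v n y ≡ lookup v (Finite.enc finX (cap κ n , y))
      get-lookup v n y = refl

      get-+ : ∀ u v n y → get (u +ᵛ v) n y ≡ get u n y +ᶻ get v n y
      get-+ u v n y = Vecₚ.lookup-zipWith _+ᶻ_ _ u v

      get-0 : ∀ n y → get 0ᵛ n y ≡ 0ℤ
      get-0 n y = Vecₚ.lookup-replicate (Finite.enc finX (cap κ n , y)) 0ℤ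

      get-lab : ∀ a f r n y → get (lab a f (just r)) n y ≡ inPhase (ix r) (δ a f (flg r)) (cap κ n , y)
      get-lab a f r n y = trans (Vecₚ.lookup∘tabulate (λ p → inPhase (ix r) (δ a f (flg r)) (Finite.dec finX p)) (Finite.enc finX (cap κ n , y)))
        (cong (inPhase (ix r) (δ a f (flg r))) (Finite.dec-enc finX (cap κ n , y)))

      lab-nothing : ∀ a f n y → get (lab a f nothing) n y ≡ 0ℤ
      lab-nothing a f n y = get-0 n y

      get-lab-same : ∀ a f r y → get (lab a f (just r)) (toℕ (ix r)) y ≡ δ a f (flg r) y
      get-lab-same a f r y = trans (get-lab a f r (toℕ (ix r)) y) (go (cap κ (toℕ (ix r))) (cap-toℕ κ (ix r)))
        where
        go : ∀ j → j ≡ ix r → inPhase (ix r) (δ a f (flg r)) (j , y) ≡ δ a f (flg r) y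
        go j e with ix r Finₚ.≟ j
        ... | yes _ = refl
        ... | no ¬p = ⊥-elim (¬p (sym e))

      get-lab-other : ∀ a f r n y → n ≤ κ → n ≢ toℕ (ix r) → get (lab a f (just r)) n y ≡ 0ℤ
      get-lab-other a f r n y n≤κ n≢ = trans (get-lab a f r n y) (go (cap κ n) (trans (toℕ-cap κ n) (ℕₚ.m≤n⇒m⊓n≡m n≤κ)))
        where
        go : ∀ j → toℕ j ≡ n → inPhase (ix r) (δ a f (flg r)) (j , y) ≡ 0ℤ
        go j e with ix r Finₚ.≟ j
        ... | yes refl = ⊥-elim (n≢ (sym e))
        ... | no _ = refl

    open Machine (finite-Maybe (finSt κ)) finAct tr tr? lab public

    height : Maybe (St κ) → ℕ
    height (just r) = suc (toℕ (ix r))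
    height nothing = 0

    tr-height : ∀ a f q q′ → tr a f q q′ → height q′ ≤ height q
    tr-height (edgeA x) f (just r) (just r′) (e , _) = ℕₚ.≤-reflexive (cong (suc ∘ toℕ) e)
    tr-height tickA f (just r) (just r′) (_ , e , _) = ℕₚ.≤-reflexive (cong (suc ∘ toℕ) e)
    tr-height exitA f (just r) (just r′) (_ , e , _) = ℕₚ.≤-reflexive (cong (suc ∘ toℕ) e)
    tr-height nextA f (just r) (just r′) (_ , e , _) = s≤s (ℕₚ.≤-trans (ℕₚ.n≤1+n _) (ℕₚ.≤-reflexive (sym e)))
    tr-height pushA f (just r) (just r′) (_ , _ , e , _) = ℕₚ.≤-reflexive (cong (suc ∘ toℕ) e)
    tr-height endA f q nothing h = z≤n
    tr-height drainA f q nothing h = z≤n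

    -- Phase numbers never increase along a run, so a finished phase receives no further
    -- contributions.
    get-above : ∀ {t q U v q′ U′} → Run t q U v q′ U′ → ∀ n y → height q ≤ n → n ≤ κ → get v n y ≡ 0ℤ
    get-above stop n y h h′ = get-0 n y
    get-above (step a f {q = q} {q₁ = q₁} {v = v} x _ r) n y h h′ = trans (get-+ (lab a f q) v n y)
      (cong₂ _+ᶻ_ (first q h) (get-above r n y (ℕₚ.≤-trans (tr-height a f q q₁ x) h) h′))
      where
      first : ∀ q → height q ≤ n → get (lab a f q) n y ≡ 0ℤ
      first (just r) h = get-lab-other a f r n y h′ (λ e → ℕₚ.<-irrefl (sym e) h)
      first nothing h = lab-nothing a f n y

    start : Fin nS → Mat → Maybe (St κ)
    start s D = just ⟪ Fin.fromℕ κ , s , false , D , kept (Φ κ) ⟫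

    labelT : ∀ {V : Set} → ℕ → CV → Lin (V ⊎ Fin dim)
    labelT n y = lvar (inj₂ (Finite.enc finX (cap κ n , y)))

    abstract
      phasedQ : Top → Fin nS → Mat → QF (CV ⊎ CV)
      phasedQ t s D = exFin dim (and (runQ t (start s D) nothing (λ i → lvar (inj₂ i)))
                                     (BdQ Φ (suc κ) (λ y → lvar (inj₁ (inj₁ y))) labelT (λ y → lvar (inj₁ (inj₂ y)))))

      phasedQ-spec : ∀ t s D x y → ⟦ phasedQ t s D ⟧ᵠ [ x , y ]′ ⟷
                     (Σ (Vec ℤ dim) λ v → Run t (start s D) [] v nothing [] × Bd Φ (suc κ) x (get v) y)
      phasedQ-spec t s D x y = ⟷-trans (exFin-spec [ x , y ]′ dim _)
        ((λ (f , r , b) → let v , run , e = proj₁ (runQ-spec t (start s D) nothing (λ i → lvar (inj₂ i)) [ [ x , y ]′ , f ]′) r in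
            v , run , Bd-cong Φ (suc κ) {v = λ i → evalAll [ [ x , y ]′ , f ]′ (labelT i)} {get v} (λ _ → refl)
              (λ i z _ → sym (trans (get-lookup v i z) (e (Finite.enc finX (cap κ i , z))))) (proj₁ (BdQ-spec [ [ x , y ]′ , f ]′ Φ (suc κ) _ labelT _) b)) ,
         (λ (v , run , b) → (λ i → lookup v i) , proj₂ (runQ-spec t (start s D) nothing (λ i → lvar (inj₂ i)) [ [ x , y ]′ , (λ i → lookup v i) ]′) (v , run , λ i → refl) ,
            proj₂ (BdQ-spec [ [ x , y ]′ , (λ i → lookup v i) ]′ Φ (suc κ) _ labelT _)
              (Bd-cong Φ (suc κ) {v = get v} (λ _ → refl) (λ i z _ → get-lookup v i z) b)))

-- Correctness of the simulation

module SimulationCorrect {nS m k l : ℕ} (A : Automaton nS m k l)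
                         (Φ : ℕ → Phased.Phase A) (κ : ℕ) (Dend : Phased.Mat A) (tend : Maybe (Fin l))
                         (W : List (Fin l)) (t : Maybe (Fin l)) (hd : List.head W ≡ t) where

  open Automaton A
  open Phased A
  open Phase
  open St
  open Simulation Φ κ Dend tend

  Labels : Set
  Labels = ℕ → CV → ℤ

  Tail Mid : ℕ → Labels → Cfg → Cfg → Set
  MidFrom : ℕ → Flags → Labels → Cfg → Cfg → Cfg → Set

  Tail zero v c d = c ≡ d
  Tail (suc n) v c d = Mid n v c d
  Mid n v c d = MidFrom n (kept (Φ n)) v c c d
  -- The numbers are counted from c, while the rest of the run starts at c₁.
  MidFrom n f v c c₁ d = Σ Cfg λ c′ → Σ ℕ λ i →
    PhRun W (Φ n) f i c₁ c′ × Num f (confVal c) (v n) i (confVal c′) × state c′ ≡ end (Φ n) × Tail n v c′ d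

  Tail-cong : ∀ n {v v′ c d} → (∀ i y → i < n → v i y ≡ v′ i y) → Tail n v c d → Tail n v′ c d
  Tail-cong zero h e = e
  Tail-cong (suc n) h (c′ , i , r , num , e , tl) =
    c′ , i , r , (λ y → trans (num y) (cong (pre _ _ y +ᶻ_) (h n y ℕₚ.≤-refl))) , e ,
    Tail-cong n (λ i y i<n → h i y (ℕₚ.m≤n⇒m≤1+n i<n)) tl

  EndOK : Cfg → Set
  EndOK d = α (clocks d) ≡ Dend × List.head (stackW d) ≡ tend

  ix≤κ : ∀ (i : Fin (suc κ)) → toℕ i ≤ κ
  ix≤κ = Finₚ.toℕ≤pred[n]

  inv-cong : ∀ {x y : Clocks m} s → α x ≡ α y → x ⊨ᶜ Inv s → y ⊨ᶜ Inv s
  inv-cong {x} {y} s e h = proj₂ (⊨-α y (Inv s) (Inv-bound A s)) (subst (_⊨ᵃ Inv s) e (proj₁ (⊨-α x (Inv s) (Inv-bound A s)) h))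

  inv-from : ∀ {x : Clocks m} {D} s → α x ≡ D → D ⊨ᵃ Inv s → x ⊨ᶜ Inv s
  inv-from {x} s e h = proj₂ (⊨-α x (Inv s) (Inv-bound A s)) (subst (_⊨ᵃ Inv s) (sym e) h)

  split-get : ∀ a f r v y → get (lab a f (just r) +ᵛ v) (toℕ (ix r)) y ≡ δ a f (flg r) y +ᶻ get v (toℕ (ix r)) y
  split-get a f r v y = trans (get-+ (lab a f (just r)) v (toℕ (ix r)) y) (cong (_+ᶻ get v (toℕ (ix r)) y) (get-lab-same a f r y))

  below-get : ∀ a f r v n y → n < toℕ (ix r) → get v n y ≡ get (lab a f (just r) +ᵛ v) n y
  below-get a f r v n y n< = sym (trans (get-+ (lab a f (just r)) v n y)
    (trans (cong (_+ᶻ get v n y) (get-lab-other a f r n y (ℕₚ.≤-trans (ℕₚ.<⇒≤ n<) (ix≤κ (ix r))) (ℕₚ.<⇒≢ n<))) (ℤₚ.+-identityˡ _)))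

  pre-step : ∀ {a f i s b D g v c c₁ c₂ d a′ g′} → Shift g (confVal c) (δ a f g) a′ g′ (confVal c₁) →
             (∀ {n c′} → PhRun W (Φ (toℕ i)) g′ n c₁ c′ → PhRun W (Φ (toℕ i)) g (a′ + n) c₂ c′) →
             MidFrom (toℕ i) g′ (get v) c₁ c₁ d → MidFrom (toℕ i) g (get (lab a f (just ⟪ i , s , b , D , g ⟫) +ᵛ v)) c c₂ d
  pre-step {a} {f} {i} {s} {b} {D} {g} {v} sh ext (c′ , n , r , num , e , tl) =
    c′ , _ , ext r , Num-shift sh (split-get a f r₀ v) num , e , Tail-cong (toℕ i) (λ n y → below-get a f r₀ v n y) tl
    where r₀ = ⟪ i , s , b , D , g ⟫

  advance : (c : Cfg) → Clocks m → Cfg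
  advance c clk = conf (state c) clk (counters c) (stackW c)

  Elapsed : Fin nS → Cfg → Clocks m → Set
  Elapsed s c clk = Σ ℕ λ d → (∀ i → clk i ≡ clocks c i + d) × (∀ u → u ≤ d → (λ i → clocks c i + u) ⊨ᶜ Inv s)

  after : Fin (length edges) → Cfg → Clocks m → List (Fin l) → Cfg
  after x c clk w = conf (tgt (edge A x)) clk (λ j → ctrUpd (cupd (edge A x) j) (counters c j)) w

  -- An actual configuration whose clocks abstract to the matrix of the machine is carried along the
  -- run; this succeeds because the matrix evolves deterministically. In the middle of a delay
  -- `soundTick` also returns the clocks at its end: the unit moves of the machine form a single
  -- move of the automaton, which can be stated only when its full duration is known.
  sound : ∀ {i D f U v} c → Run t (just ⟪ i , state c , false , D , f ⟫) U v nothing [] →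
          α (clocks c) ≡ D → stackW c ≡ U ++ W → Σ Cfg λ d → MidFrom (toℕ i) f (get v) c c d × EndOK d
  soundTick : ∀ {i D f U v} c → Run t (just ⟪ i , state c , true , D , f ⟫) U v nothing [] →
          α (clocks c) ≡ D → stackW c ≡ U ++ W → clocks c ⊨ᶜ Inv (state c) →
          Σ (Clocks m) λ clk → Elapsed (state c) c clk × Σ Cfg λ d → MidFrom (toℕ i) f (get v) c (advance c clk) d × EndOK d

  soundEdge : ∀ K x f {i D g U U₁ v r′} c → kind (edge A x) ≡ K →
          state c ≡ src (edge A x) → st r′ ≡ tgt (edge A x) → ix r′ ≡ i →
          Allowed (pkind (Φ (toℕ i))) (stage (Φ (toℕ i))) (edge A x) → EffOK (stack (edge A x)) f → App t f U U₁ →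
          ClockMove K (edge A x) ⟪ i , state c , false , D , g ⟫ r′ →
          Run t (just r′) U₁ v nothing [] → α (clocks c) ≡ D → stackW c ≡ U ++ W →
          Σ Cfg λ d → MidFrom (toℕ i) g (get (lab (edgeA x) f (just ⟪ i , state c , false , D , g ⟫) +ᵛ v)) c c d × EndOK d

  sound {i} {D} {g} {U} c (step (edgeA x) f {q₁ = just r′} (e , e₁ , e₂ , _ , al , ok , cm) app r) eα ew =
    soundEdge (kind (edge A x)) x f c refl e₁ e₂ e al ok app cm r eα ew
  sound c (step tickA (look s) {q₁ = just r′} (_ , _ , _ , () , _) app r) eα ew
  sound c (step exitA (look s) {q₁ = just r′} (_ , _ , _ , () , _) app r) eα ew
  sound {i} {D} {.allTrue} {U} c (step nextA (look s) {q₁ = just ⟪ i′ , _ , _ , _ , _ ⟫} {v = v} (_ , e , refl , _ , refl , refl , refl , refl , e′) (_ , refl) r) eα ew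
    with sound c r eα ew
  ... | d , tl , ok = d , subst (λ n → MidFrom n allTrue (get (lab nextA (look s) (just r₀) +ᵛ v)) c c d) (sym e)
        (c , 0 , pdone (U , ew) ,
         Num-done (λ y → trans (cong (λ n → get (lab nextA (look s) (just r₀) +ᵛ v) n y) (sym e)) (trans (split-get nextA (look s) r₀ v y)
           (trans (ℤₚ.+-identityˡ _) (get-above r (toℕ i) y (ℕₚ.≤-reflexive (sym e)) (ix≤κ i))))) ,
         subst (λ n → state c ≡ end (Φ n)) e e′ ,
         Tail-cong (suc (toℕ i′)) {v = get v} {v′ = get (lab nextA (look s) (just r₀) +ᵛ v)} (λ n y n< → below-get nextA (look s) r₀ v n y (subst (n <_) (sym e) n<)) tl) , ok
    where r₀ = ⟪ i , state c , false , D , allTrue ⟫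
  sound {i} {D} {g} {U} c (step pushA (psh a) {q₁ = just ⟪ _ , _ , _ , _ , _ ⟫} {v = v} (_ , e , refl , refl , _ , refl , refl , refl) refl r) eα ew
    with sound (pushed a c) r eα (cong (a ∷_) ew)
  ... | d , md , ok = d , pre-step {a = pushA} {f = psh a} {s = state c} {b = false} {D = D} {v = v} {c = c} {c₁ = pushed a c} shift (λ r → pinit e a (U , ew) r) md , ok
    where
    shift : Shift g (confVal c) (δ pushA (psh a) g) 0 g (confVal (pushed a c))
    shift stateV = refl
    shift (clockV i) = refl
    shift (ctrV j) = refl
    shift (countV h) = trans (sym (count-∷ h a (stackW c))) (sym (ℤₚ.+-identityʳ _))
  sound {i} {D} {U = U} c (step endA (look s) {q₁ = nothing} {v = v} ((refl , e , _ , refl , refl , e′) , _) (et , refl) r) eα ew =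
    c , subst (λ n → MidFrom n allTrue (get (lab endA (look s) (just r₀) +ᵛ v)) c c c) (sym e)
        (c , 0 , pdone (U , ew) ,
         Num-done (λ y → trans (cong (λ n → get (lab endA (look s) (just r₀) +ᵛ v) n y) (sym e)) (trans (split-get endA (look s) r₀ v y) (trans (ℤₚ.+-identityˡ _) (get-above r (toℕ i) y z≤n (ix≤κ i))))) ,
         subst (λ n → state c ≡ end (Φ n)) e e′ , refl) ,
    eα , trans (cong List.head ew) (trans (sym (top-head hd U)) et)
    where r₀ = ⟪ i , state c , false , D , allTrue ⟫
  sound c (step drainA (pul a) (_ , () , _) app r) eα ew

  soundTick {i} {D} {g} {U} c (step tickA (look s) {q₁ = just ⟪ _ , _ , _ , _ , _ ⟫} {v = v} (_ , refl , refl , _ , refl , refl , inv , refl) (_ , refl) r) eα ew inv₀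
    with soundTick (advance c (λ i → suc (clocks c i))) r eα₁ ew (inv-from (state c) eα₁ inv)
    where
    eα₁ : α (λ i → suc (clocks c i)) ≡ tickM D
    eα₁ = trans (α-tick (λ i → refl)) (cong tickM eα)
  ... | clk , (u , eclk , invs) , d , (c′ , n , rr , num , e , tl) , ok =
    clk , (suc u , (λ i → trans (eclk i) (sym (ℕₚ.+-suc (clocks c i) u))) , invs′) ,
    d , (c′ , n , rr , Num-shift (Shift-tick g (look s) c (λ i → suc (clocks c i)) (λ i → refl)) (split-get tickA (look s) r₀ v) num , e ,
         Tail-cong (toℕ i) (λ n y → below-get tickA (look s) r₀ v n y) tl) , ok
    where
    r₀ = ⟪ i , state c , true , D , g ⟫
    invs′ : ∀ w → w ≤ suc u → (λ i → clocks c i + w) ⊨ᶜ Inv (state c)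
    invs′ zero _ = inv-cong (state c) (α-cong (λ i → sym (ℕₚ.+-identityʳ (clocks c i)))) inv₀
    invs′ (suc w) (s≤s w≤) = inv-cong (state c) (α-cong (λ i → sym (ℕₚ.+-suc (clocks c i) w))) (invs w w≤)
  soundTick {i} {D} {g} {U} c (step exitA (look s) {q₁ = just ⟪ _ , _ , _ , _ , _ ⟫} {v = v} (_ , refl , refl , _ , refl , refl , refl) (_ , refl) r) eα ew inv₀
    with sound c r eα ew
  ... | d , md , ok = clocks c , (0 , (λ i → sym (ℕₚ.+-identityʳ (clocks c i))) ,
          λ { zero _ → inv-cong (state c) (α-cong (λ i → sym (ℕₚ.+-identityʳ (clocks c i)))) inv₀ }) ,
        d , pre-step {a = exitA} {f = look s} {s = state c} {b = true} {D = D} {v = v} {c = c} {c₁ = c} (λ y → cong (pre g (confVal c) y +ᶻ_) (zero-steps y)) id md , ok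
    where
    zero-steps : ∀ y → 0ℤ ≡ steps 0 y
    zero-steps stateV = refl
    zero-steps (clockV i) = refl
    zero-steps (ctrV j) = refl
    zero-steps (countV h) = refl
  soundTick c (step (edgeA x) f {q₁ = just r′} (_ , _ , _ , () , _) app r) eα ew inv₀
  soundTick c (step nextA (look s) {q₁ = just r′} (_ , _ , _ , () , _) app r) eα ew inv₀
  soundTick c (step pushA (psh a) {q₁ = just r′} (_ , _ , _ , _ , () , _) app r) eα ew inv₀
  soundTick c (step endA (look s) {q₁ = nothing} ((_ , _ , () , _) , _) app r) eα ew inv₀
  soundTick c (step drainA (pul a) (_ , () , _) app r) eα ew inv₀

  soundEdge progress x f {i} {D} {g} {U} {U₁} {v} {⟪ _ , _ , _ , _ , _ ⟫} c ek e₁ refl refl al ok app (refl , et , inv , refl , inv′ , refl) r eα ew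
    with soundTick (after x c (λ i → suc (clocks c i)) (U₁ ++ W)) r eα₁ refl (subst (λ s → (λ i → suc (clocks c i)) ⊨ᶜ Inv s) (sym et) (inv-from (src (edge A x)) eα₁ inv′))
    where
    eα₁ : α (λ i → suc (clocks c i)) ≡ tickM D
    eα₁ = trans (α-tick (λ i → refl)) (cong tickM eα)
  ... | clk , (u , eclk , invs) , d , (c′ , n , rr , num , e , tl) , okd =
    d , (c′ , suc n , subst (λ K → PhRun W (Φ (toℕ i)) K (suc n) c c′) (cong (λ K → before K g) ek) (pedge x al move (U , ew) rr) ,
         Num-shift {d = δ (edgeA x) f g} {a = 1} {f′ = g} {x₁ = confVal c₁} shift (split-get (edgeA x) f r₀ v) num , e ,
         Tail-cong (toℕ i) (λ n y → below-get (edgeA x) f r₀ v n y) tl) , okd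
    where
    r₀ = ⟪ i , state c , false , D , g ⟫
    c₁ = after x c (λ i → suc (clocks c i)) (U₁ ++ W)
    invs′ : ∀ w → w ≤ suc u → (λ i → clocks c i + w) ⊨ᶜ Inv (src (edge A x))
    invs′ zero _ = inv-cong (src (edge A x)) (α-cong (λ i → sym (ℕₚ.+-identityʳ (clocks c i)))) (inv-from (src (edge A x)) eα inv)
    invs′ (suc w) (s≤s w≤) = inv-cong (src (edge A x)) (α-cong (λ i → sym (ℕₚ.+-suc (clocks c i) w))) (subst (λ s → (λ i → suc (clocks c i + w)) ⊨ᶜ Inv s) et (invs w w≤))
    move : Move (edge A x) c (advance c₁ clk)
    move = e₁ , refl , proj₂ (ClockStep⟷K (edge A x) c (advance c₁ clk)) (subst (λ K → ClockStepK K (edge A x) c (advance c₁ clk)) (sym ek)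
             (et , suc u , s≤s z≤n , (λ i → trans (eclk i) (sym (ℕₚ.+-suc (clocks c i) u))) , invs′)) ,
           (λ j → refl) , subst (λ w → StackRel (stack (edge A x)) w (U₁ ++ W)) (sym ew) (App-sound hd (stack (edge A x)) f ok app)
    shift : Shift g (confVal c) (δ (edgeA x) f g) 1 g (confVal c₁)
    shift = subst (λ K → Shift K (confVal c) (δ (edgeA x) f K) 1 g (confVal c₁)) (cong (λ K → before K g) ek)
      (Shift-edge x f g c c₁ (subst (λ K → ∀ i → (if lookup (before K g) i then + clocks c i else 0ℤ) +ᶻ clockδ K (before K g) i ≡ (if lookup g i then + suc (clocks c i) else 0ℤ)) (sym ek) (λ i → clock-carry (lookup g i) (clocks c i)))
        (λ j → refl) (λ h → trans (cong (λ w → + count h w +ᶻ effδ f h) ew) (App-count hd f app h)))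
  soundEdge (reset R C) x f {i} {D} {g} {U} {U₁} {v} {⟪ _ , _ , _ , _ , g′ ⟫} c ek e₁ refl refl al ok app (refl , inv , inC , refl , inv′ , refl) r eα ew
    with sound (after x c (λ i → if R i then 0 else clocks c i) (U₁ ++ W)) r eα₁ refl
    where
    eα₁ : α (λ i → if R i then 0 else clocks c i) ≡ resetM R D
    eα₁ = trans (α-reset R (λ i → refl)) (cong (resetM R) eα)
  ... | d , (c′ , n , rr , num , e , tl) , okd =
    d , (c′ , suc n , subst (λ K → PhRun W (Φ (toℕ i)) K (suc n) c c′) (cong (λ K → before K g′) ek) (pedge x al move (U , ew) rr) ,
         Num-shift {d = δ (edgeA x) f g} {a = 1} {f′ = g′} {x₁ = confVal c₁} shift (split-get (edgeA x) f r₀ v) num , e ,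
         Tail-cong (toℕ i) (λ n y → below-get (edgeA x) f r₀ v n y) tl) , okd
    where
    r₀ = ⟪ i , state c , false , D , g ⟫
    c₁ = after x c (λ i → if R i then 0 else clocks c i) (U₁ ++ W)
    C-bound : maxConst C < clockBound A
    C-bound = subst (λ K → kindConst K < clockBound A) ek (edge-bound A x)
    move : Move (edge A x) c c₁
    move = e₁ , refl , proj₂ (ClockStep⟷K (edge A x) c c₁) (subst (λ K → ClockStepK K (edge A x) c c₁) (sym ek)
             (inv-from (src (edge A x)) eα inv , proj₂ (⊨-α (clocks c) C C-bound) (subst (_⊨ᵃ C) (sym eα) inC) , (λ i → refl) ,
              inv-from (tgt (edge A x)) (trans (α-reset R (λ i → refl)) (cong (resetM R) eα)) inv′)) ,
           (λ j → refl) , subst (λ w → StackRel (stack (edge A x)) w (U₁ ++ W)) (sym ew) (App-sound hd (stack (edge A x)) f ok app)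
    shift : Shift g (confVal c) (δ (edgeA x) f g) 1 g′ (confVal c₁)
    shift = subst (λ K → Shift K (confVal c) (δ (edgeA x) f K) 1 g′ (confVal c₁)) (cong (λ K → before K g′) ek)
      (Shift-edge x f g′ c c₁ (subst (λ K → ∀ i → (if lookup (before K g′) i then + clocks c i else 0ℤ) +ᶻ clockδ K (before K g′) i ≡ (if lookup g′ i then + clocks c₁ i else 0ℤ)) (sym ek)
          (reset-carry R C g′ (clocks c) (clocks c₁) (λ i → refl)))
        (λ j → refl) (λ h → trans (cong (λ w → + count h w +ᶻ effδ f h) ew) (App-count hd f app h)))

  Carried : ℕ → Vec ℤ dim → Vec ℤ dim → Set
  Carried n v v′ = ∀ j y → j < n → get v j y ≡ get v′ j y

  run-above : ∀ {ph f n c c′} → PhRun W ph f n c c′ → Above W c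
  run-above (pdone a) = a
  run-above (pedge x _ _ a _) = a
  run-above (pinit _ g a _) = a

  -- Converse of `soundTick`: the machine run from the end of the delay is extended backwards by `d`
  -- unit moves and an exit.
  tickRun : ∀ d {i f U v n x′} c clk → Run t (just ⟪ i , state c , false , α clk , f ⟫) U v nothing [] →
            (∀ j → clk j ≡ clocks c j + d) → (∀ u → u ≤ d → (λ j → clocks c j + u) ⊨ᶜ Inv (state c)) →
            Num f (confVal (advance c clk)) (get v (toℕ i)) n x′ →
            Σ (Vec ℤ dim) λ v′ → Run t (just ⟪ i , state c , true , α (clocks c) , f ⟫) U v′ nothing [] ×
              Num f (confVal c) (get v′ (toℕ i)) n x′ × Carried (toℕ i) v v′
  tickRun zero {i} {f} {U} {v} {n} {x′} c clk r eclk invs num =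
    lab exitA g (just r₀) +ᵛ v , step exitA g {q = just r₀} {q₁ = just ⟪ i , state c , false , α clk , f ⟫} (tt , refl , refl , refl , refl , α-cong same , refl) (refl , refl) r ,
    Num-shift {f} {confVal c} {δ exitA g f} {0} {f} {confVal (advance c clk)} {get v (toℕ i)} {get (lab exitA g (just r₀) +ᵛ v) (toℕ i)} {n} {x′} shift (split-get exitA g r₀ v) num ,
    λ j y → below-get exitA g r₀ v j y
    where
    same : ∀ j → clk j ≡ clocks c j
    same j = trans (eclk j) (ℕₚ.+-identityʳ (clocks c j))
    g = look (top t U)
    r₀ = ⟪ i , state c , true , α (clocks c) , f ⟫
    shift : Shift f (confVal c) (δ exitA g f) 0 f (confVal (advance c clk))
    shift stateV = refl
    shift (clockV j) = cong (λ n → (if lookup f j then + n else 0ℤ) +ᶻ 0ℤ) (sym (same j))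
    shift (ctrV j) = refl
    shift (countV g) = refl
  tickRun (suc d) {i} {f} {U} {v₀} {n} {x′} c clk r eclk invs num =
    lab tickA g (just r₀) +ᵛ v , step tickA g {q = just r₀} {q₁ = just ⟪ i , state c , true , α clk₁ , f ⟫} (tt , refl , refl , refl , refl , α-tick (λ j → refl) , inv₁ , refl) (refl , refl) r′ ,
    Num-shift {f} {confVal c} {δ tickA g f} {0} {f} {confVal (advance c clk₁)} {get v (toℕ i)} {get (lab tickA g (just r₀) +ᵛ v) (toℕ i)} {n} {x′}
      (Shift-tick f g c clk₁ (λ j → refl)) (split-get tickA g r₀ v) num′ ,
    λ j y j< → trans (ca j y j<) (below-get tickA g r₀ v j y j<)
    where
    g = look (top t U)
    r₀ = ⟪ i , state c , true , α (clocks c) , f ⟫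
    clk₁ : Clocks m
    clk₁ j = suc (clocks c j)
    rec = tickRun d {i} {f} {U} {v₀} {n} {x′} (advance c clk₁) clk r (λ j → trans (eclk j) (ℕₚ.+-suc (clocks c j) d))
           (λ u u≤ → inv-cong (state c) (α-cong (λ j → ℕₚ.+-suc (clocks c j) u)) (invs (suc u) (s≤s u≤))) num
    v = proj₁ rec
    r′ = proj₁ (proj₂ rec)
    num′ = proj₁ (proj₂ (proj₂ rec))
    ca = proj₂ (proj₂ (proj₂ rec))
    inv₁ : α clk₁ ⊨ᵃ Inv (state c)
    inv₁ = proj₁ (⊨-α clk₁ (Inv (state c)) (Inv-bound A (state c)))
      (inv-cong (state c) (α-cong (λ j → trans (ℕₚ.+-suc (clocks c j) 0) (cong suc (ℕₚ.+-identityʳ (clocks c j))))) (invs 1 (s≤s z≤n)))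

  Extended : Fin (suc κ) → Flags → List (Fin l) → Cfg → ℕ → (CV → ℤ) → Vec ℤ dim → Set
  Extended i g U c n x′ v = Σ (Vec ℤ dim) λ v′ → Run t (just ⟪ i , state c , false , α (clocks c) , g ⟫) U v′ nothing [] ×
    Num g (confVal c) (get v′ (toℕ i)) n x′ × Carried (toℕ i) v v′

  Shift-kind : ∀ {K} x f {g U U₁} {c c₁ : Cfg} → kind (edge A x) ≡ K →
    (∀ i → (if lookup (before K g) i then + clocks c i else 0ℤ) +ᶻ clockδ K (before K g) i ≡ (if lookup g i then + clocks c₁ i else 0ℤ)) →
    (∀ j → counters c₁ j ≡ ctrUpd (cupd (edge A x) j) (counters c j)) → App t f U U₁ → stackW c ≡ U ++ W → stackW c₁ ≡ U₁ ++ W →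
    Shift (before K g) (confVal c) (δ (edgeA x) f (before K g)) 1 g (confVal c₁)
  Shift-kind x f {g} {c = c} {c₁} refl carry ctr app ew ew₁ = Shift-edge x f g c c₁ carry ctr
    (λ h → trans (cong (λ w → + count h w +ᶻ effδ f h) ew) (trans (App-count hd f app h) (cong (λ w → + count h w) (sym ew₁))))

  progressRun : ∀ x f d {i g n U U₁ v c c₁ x′} → kind (edge A x) ≡ progress → Allowed (pkind (Φ (toℕ i))) (stage (Φ (toℕ i))) (edge A x) →
    state c ≡ src (edge A x) → state c₁ ≡ tgt (edge A x) → (∀ j → counters c₁ j ≡ ctrUpd (cupd (edge A x) j) (counters c j)) →
    stackW c ≡ U ++ W → stackW c₁ ≡ U₁ ++ W → EffOK (stack (edge A x)) f → App t f U U₁ →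
    tgt (edge A x) ≡ src (edge A x) → (∀ j → clocks c₁ j ≡ clocks c j + suc d) → (∀ u → u ≤ suc d → (λ j → clocks c j + u) ⊨ᶜ Inv (src (edge A x))) →
    Run t (just ⟪ i , state c₁ , false , α (clocks c₁) , g ⟫) U₁ v nothing [] → Num g (confVal c₁) (get v (toℕ i)) n x′ →
    Extended i g U c (suc n) x′ v
  progressRun x f d {i} {g} {n} {U} {U₁} {v} {c} {c₁} {x′} ek al e₁ e₂ ctr ew ew₁ ok app et eclk invs r num =
    lab (edgeA x) f (just r₀) +ᵛ proj₁ rec ,
    step (edgeA x) f {q = just r₀} {q₁ = just r₁} move app (proj₁ (proj₂ rec)) ,
    Num-shift {g} {confVal c} {δ (edgeA x) f g} {1} {g} {confVal c½} {get (proj₁ rec) (toℕ i)} {get (lab (edgeA x) f (just r₀) +ᵛ proj₁ rec) (toℕ i)} {n} {x′}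
      shift (split-get (edgeA x) f r₀ (proj₁ rec)) (proj₁ (proj₂ (proj₂ rec))) ,
    λ j y j< → trans (proj₂ (proj₂ (proj₂ rec)) j y j<) (below-get (edgeA x) f r₀ (proj₁ rec) j y j<)
    where
    s₀ = src (edge A x)
    c½ = advance c₁ (λ j → suc (clocks c j))
    r₀ r₁ : St κ
    r₀ = ⟪ i , state c , false , α (clocks c) , g ⟫
    r₁ = ⟪ i , state c₁ , true , α (λ j → suc (clocks c j)) , g ⟫
    rec = tickRun d {i} {g} {U₁} {v} {n} {x′} c½ (clocks c₁) r (λ j → trans (eclk j) (ℕₚ.+-suc (clocks c j) d))
      (λ u u≤ → subst (λ s → (λ j → suc (clocks c j) + u) ⊨ᶜ Inv s) (sym (trans e₂ et)) (inv-cong s₀ (α-cong (λ j → ℕₚ.+-suc (clocks c j) u)) (invs (suc u) (s≤s u≤)))) num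
    inv-at : ∀ u → u ≤ suc d → (y : Clocks m) → (∀ j → y j ≡ clocks c j + u) → α y ⊨ᵃ Inv s₀
    inv-at u u≤ y e = proj₁ (⊨-α y (Inv s₀) (Inv-bound A s₀)) (inv-cong s₀ (α-cong (λ j → sym (e j))) (invs u u≤))
    shift : Shift g (confVal c) (δ (edgeA x) f g) 1 g (confVal c½)
    shift = Shift-kind x f {g} {U} {U₁} {c} {c½} ek (λ i → clock-carry (lookup g i) (clocks c i)) ctr app ew ew₁
    move : EdgeMove x f r₀ r₁
    move = refl , e₁ , e₂ , refl , al , ok , subst (λ K → ClockMove K (edge A x) r₀ r₁) (sym ek)
      (refl , et , inv-at 0 z≤n (clocks c) (λ j → sym (ℕₚ.+-identityʳ _)) , α-tick (λ j → refl) ,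
       inv-at 1 (s≤s z≤n) (λ j → suc (clocks c j)) (λ j → sym (ℕₚ.+-comm (clocks c j) 1)) , refl)

  resetRun : ∀ R C x f {i g n U U₁ v c c₁ x′} → kind (edge A x) ≡ reset R C → Allowed (pkind (Φ (toℕ i))) (stage (Φ (toℕ i))) (edge A x) →
    state c ≡ src (edge A x) → state c₁ ≡ tgt (edge A x) → (∀ j → counters c₁ j ≡ ctrUpd (cupd (edge A x) j) (counters c j)) →
    stackW c ≡ U ++ W → stackW c₁ ≡ U₁ ++ W → EffOK (stack (edge A x)) f → App t f U U₁ →
    ClockStepK (reset R C) (edge A x) c c₁ →
    Run t (just ⟪ i , state c₁ , false , α (clocks c₁) , g ⟫) U₁ v nothing [] → Num g (confVal c₁) (get v (toℕ i)) n x′ →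
    Extended i (before (reset R C) g) U c (suc n) x′ v
  resetRun R C x f {i} {g} {n} {U} {U₁} {v} {c} {c₁} {x′} ek al e₁ e₂ ctr ew ew₁ ok app (inv , inC , eclk , inv′) r num =
    lab (edgeA x) f (just r₀) +ᵛ v , step (edgeA x) f {q = just r₀} {q₁ = just r₁} move app r ,
    Num-shift {g₀} {confVal c} {δ (edgeA x) f g₀} {1} {g} {confVal c₁} {get v (toℕ i)} {get (lab (edgeA x) f (just r₀) +ᵛ v) (toℕ i)} {n} {x′}
      (Shift-kind x f {g} {U} {U₁} {c} {c₁} ek (reset-carry R C g (clocks c) (clocks c₁) eclk) ctr app ew ew₁) (split-get (edgeA x) f r₀ v) num ,
    λ j y → below-get (edgeA x) f r₀ v j y
    where
    g₀ = before (reset R C) g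
    r₀ r₁ : St κ
    r₀ = ⟪ i , state c , false , α (clocks c) , g₀ ⟫
    r₁ = ⟪ i , state c₁ , false , α (clocks c₁) , g ⟫
    C-bound : maxConst C < clockBound A
    C-bound = subst (λ K → kindConst K < clockBound A) ek (edge-bound A x)
    move : EdgeMove x f r₀ r₁
    move = refl , e₁ , e₂ , refl , al , ok , subst (λ K → ClockMove K (edge A x) r₀ r₁) (sym ek)
      (refl , proj₁ (⊨-α (clocks c) (Inv (src (edge A x))) (Inv-bound A _)) inv , proj₁ (⊨-α (clocks c) C C-bound) inC , α-reset R eclk ,
       proj₁ (⊨-α (clocks c₁) (Inv (tgt (edge A x))) (Inv-bound A _)) inv′ , refl)

  edgeRun : ∀ K x {i g n U U₁ v c c₁ x′} → kind (edge A x) ≡ K → Allowed (pkind (Φ (toℕ i))) (stage (Φ (toℕ i))) (edge A x) →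
    state c ≡ src (edge A x) → state c₁ ≡ tgt (edge A x) → (∀ j → counters c₁ j ≡ ctrUpd (cupd (edge A x) j) (counters c j)) →
    stackW c ≡ U ++ W → stackW c₁ ≡ U₁ ++ W → (Σ (Eff l) λ f → EffOK (stack (edge A x)) f × App t f U U₁) →
    ClockStepK K (edge A x) c c₁ →
    Run t (just ⟪ i , state c₁ , false , α (clocks c₁) , g ⟫) U₁ v nothing [] → Num g (confVal c₁) (get v (toℕ i)) n x′ →
    Extended i (before K g) U c (suc n) x′ v
  edgeRun progress x {i} {g} {n} {U} {U₁} {v} {c} {c₁} {x′} ek al e₁ e₂ ctr ew ew₁ (f , ok , app) (et , suc d , _ , eclk , invs) r num =
    progressRun x f d {i} {g} {n} {U} {U₁} {v} {c} {c₁} {x′} ek al e₁ e₂ ctr ew ew₁ ok app et eclk invs r num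
  edgeRun (reset R C) x {i} {g} {n} {U} {U₁} {v} {c} {c₁} {x′} ek al e₁ e₂ ctr ew ew₁ (f , ok , app) cs r num =
    resetRun R C x f {i} {g} {n} {U} {U₁} {v} {c} {c₁} {x′} ek al e₁ e₂ ctr ew ew₁ ok app cs r num

  Completed : Fin (suc κ) → Flags → ℕ → Cfg → Cfg → List (Fin l) → (Vec ℤ dim → Set) → Set
  Completed i f n c c′ U Q = Σ (Vec ℤ dim) λ v → Run t (just ⟪ i , state c , false , α (clocks c) , f ⟫) U v nothing [] ×
    Num f (confVal c) (get v (toℕ i)) n (confVal c′) × Q v

  Remaining : Fin (suc κ) → Cfg → (Vec ℤ dim → Set) → Set
  Remaining i c′ Q = ∀ U′ → stackW c′ ≡ U′ ++ W → Σ (Vec ℤ dim) λ v → Run t (just ⟪ i , state c′ , false , α (clocks c′) , allTrue ⟫) U′ v nothing [] ×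
    (∀ y → get v (toℕ i) y ≡ 0ℤ) × Q v

  -- Labels are summed from the end of a run, so the later phases enter as a continuation. `Q` is
  -- what they guarantee about the label; it survives the moves added in front because it only looks
  -- at phases with smaller numbers.
  completePhase : ∀ i {f n c c′} → PhRun W (Φ (toℕ i)) f n c c′ → ∀ U → stackW c ≡ U ++ W → (Q : Vec ℤ dim → Set) →
    (∀ {v v′} → Carried (toℕ i) v v′ → Q v → Q v′) → Remaining i c′ Q → Completed i f n c c′ U Q
  completePhase i {c = c} (pdone a) U ew Q Q-cong k =
    proj₁ fin , proj₁ (proj₂ fin) , Num-done {confVal c} {get (proj₁ fin) (toℕ i)} (proj₁ (proj₂ (proj₂ fin))) , proj₂ (proj₂ (proj₂ fin))
    where fin = k U ew
  completePhase i {c = c} {c′} (pedge x {f = g} {n = n} {c₁ = c₁} al (e₁ , e₂ , clk , ctr , stk) a r) U ew Q Q-cong k =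
    proj₁ ext , proj₁ (proj₂ ext) , proj₁ (proj₂ (proj₂ ext)) , Q-cong (proj₂ (proj₂ (proj₂ ext))) (proj₂ (proj₂ (proj₂ rec)))
    where
    U₁ = proj₁ (run-above r)
    ew₁ = proj₂ (run-above r)
    rec : Completed i g n c₁ c′ U₁ Q
    rec = completePhase i r U₁ ew₁ Q Q-cong k
    ext : Extended i (before (kind (edge A x)) g) U c (suc n) (confVal c′) (proj₁ rec)
    ext = edgeRun (kind (edge A x)) x {i} {g} {n} {U} {U₁} {proj₁ rec} {c} {c₁} {confVal c′} refl al e₁ e₂ ctr ew ew₁
      (App-complete hd (stack (edge A x)) U U₁ (subst₂ (StackRel (stack (edge A x))) ew ew₁ stk))
      (proj₁ (ClockStep⟷K (edge A x) c c₁) clk) (proj₁ (proj₂ rec)) (proj₁ (proj₂ (proj₂ rec)))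
  completePhase i {f} {n} {c} {c′} (pinit e g a r) U ew Q Q-cong k =
    lab pushA (psh g) (just r₀) +ᵛ proj₁ rec ,
    step pushA (psh g) {q = just r₀} {q₁ = just r₀} (tt , e , refl , refl , refl , refl , refl , refl) refl (proj₁ (proj₂ rec)) ,
    Num-shift {f} {confVal c} {δ pushA (psh g) f} {0} {f} {confVal (pushed g c)} {get (proj₁ rec) (toℕ i)} {get (lab pushA (psh g) (just r₀) +ᵛ proj₁ rec) (toℕ i)} {n} {confVal c′}
      shift (split-get pushA (psh g) r₀ (proj₁ rec)) (proj₁ (proj₂ (proj₂ rec))) ,
    Q-cong (λ j y → below-get pushA (psh g) r₀ (proj₁ rec) j y) (proj₂ (proj₂ (proj₂ rec)))
    where
    r₀ : St κ
    r₀ = ⟪ i , state c , false , α (clocks c) , f ⟫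
    rec : Completed i f n (pushed g c) c′ (g ∷ U) Q
    rec = completePhase i r (g ∷ U) (cong (g ∷_) ew) Q Q-cong k
    shift : Shift f (confVal c) (δ pushA (psh g) f) 0 f (confVal (pushed g c))
    shift stateV = refl
    shift (clockV j) = refl
    shift (ctrV j) = refl
    shift (countV h) = trans (sym (count-∷ h g (stackW c))) (sym (ℤₚ.+-identityʳ _))

  drain : ∀ U → Σ (Vec ℤ dim) λ v → Run t nothing U v nothing []
  drain [] = 0ᵛ , stop
  drain (g ∷ U) = lab drainA (pul g) nothing +ᵛ proj₁ (drain U) , step drainA (pul g) {q = nothing} {q₁ = nothing} (tt , tt , tt) refl (proj₂ (drain U))

  Num⇒nxt : ∀ ph {x u n c} → Num (kept ph) x u n (confVal c) → state c ≡ end ph → ∀ z → confVal c z ≡ nxt ph x u z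
  Num⇒nxt ph num e stateV = cong (+_ ∘ toℕ) e
  Num⇒nxt ph num e (clockV i) = num (clockV i)
  Num⇒nxt ph num e (ctrV j) = num (ctrV j)
  Num⇒nxt ph num e (countV g) = num (countV g)

  Num⇒steps : ∀ {f x u n x′} → Num f x u n x′ → + n ≡ u stateV
  Num⇒steps {u = u} num = trans (num stateV) (ℤₚ.+-identityˡ (u stateV))

  Tail⇒PhasedRun : ∀ n {v c d x y} → Tail n v c d → Bd Φ n x v y → (∀ z → confVal c z ≡ x z) →
                   PhasedRun Φ W n c d × (∀ z → confVal d z ≡ y z)
  Tail⇒PhasedRun zero refl b e = refl , λ z → trans (e z) (b z)
  Tail⇒PhasedRun (suc n) {v} {c} {d} {x} (c′ , i , r , num , es , tl) (x′ , ex , co , b) e =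
    (c′ , (i , r , es , Cons-cong (Φ n) (λ z → sym (e z)) (sym (Num⇒steps {x′ = confVal c′} num)) (λ z → sym (same z)) co) , proj₁ rec) , proj₂ rec
    where
    same : ∀ z → confVal c′ z ≡ x′ z
    same z = trans (Num⇒nxt (Φ n) num es z) (trans (nxt-cong (Φ n) {u = v n} e (λ _ → refl) z) (sym (ex z)))
    rec = Tail⇒PhasedRun n tl b same

  phasedQ-sound : ∀ {c x y D} → ⟦ phasedQ t (state c) D ⟧ᵠ [ x , y ]′ → (∀ z → confVal c z ≡ x z) → α (clocks c) ≡ D → stackW c ≡ W →
                  Σ Cfg λ d → PhasedRun Φ W (suc κ) c d × (∀ z → confVal d z ≡ y z) × EndOK d
  phasedQ-sound {c} {x} {y} {D} h e eα ew = d , proj₁ res , proj₂ res , proj₂ (proj₂ snd)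
    where
    spec : Σ (Vec ℤ dim) λ v → Run t (start (state c) D) [] v nothing [] × Bd Φ (suc κ) x (get v) y
    spec = proj₁ (phasedQ-spec t (state c) D x y) h
    v = proj₁ spec
    snd : Σ Cfg λ d → MidFrom (toℕ (Fin.fromℕ κ)) (kept (Φ κ)) (get v) c c d × EndOK d
    snd = sound {Fin.fromℕ κ} {D} {kept (Φ κ)} {[]} {v} c (proj₁ (proj₂ spec)) eα ew
    d = proj₁ snd
    res : PhasedRun Φ W (suc κ) c d × (∀ z → confVal d z ≡ y z)
    res = Tail⇒PhasedRun (suc κ) {get v} {c} {d} {x} {y} (subst (λ n → MidFrom n (kept (Φ κ)) (get v) c c d) (Finₚ.toℕ-fromℕ κ) (proj₁ (proj₂ snd))) (proj₂ (proj₂ spec)) e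

  Entered : Fin (suc κ) → ℕ → List (Fin l) → Cfg → Cfg → Set
  Entered i n U c d = Σ (Vec ℤ dim) λ v → Run t (just ⟪ i , state c , false , α (clocks c) , kept (Φ n) ⟫) U v nothing [] ×
    Bd Φ (suc n) (confVal c) (get v) (confVal d)

  enter : ∀ n i → toℕ i ≡ n → ∀ {c d} → PhasedRun Φ W (suc n) c d → EndOK d → ∀ U → stackW c ≡ U ++ W → Entered i n U c d
  leave : ∀ n i → toℕ i ≡ n → ∀ {c d} → PhasedRun Φ W n c d → state c ≡ end (Φ n) → EndOK d →
          Remaining i c (λ v → Bd Φ n (confVal c) (get v) (confVal d))

  enter n i e {c} {d} (c′ , (a , r , es , co) , pr) ok U ew =
    proj₁ rec , proj₁ (proj₂ rec) , confVal c′ , Num⇒nxt (Φ n) num es , Cons-cong (Φ n) (λ _ → refl) (Num⇒steps {x′ = confVal c′} num) (λ _ → refl) co , proj₂ (proj₂ (proj₂ rec))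
    where
    rec : Completed i (kept (Φ n)) a c c′ U (λ v → Bd Φ n (confVal c′) (get v) (confVal d))
    rec = completePhase i (subst (λ n′ → PhRun W (Φ n′) (kept (Φ n)) a c c′) (sym e) r) U ew _
      (λ {v} {v′} ca b → Bd-cong Φ n {v = get v} {get v′} (λ _ → refl) (λ j z j< → ca j z (subst (j <_) (sym e) j<)) b) (leave n i e pr es ok)
    num : Num (kept (Φ n)) (confVal c) (get (proj₁ rec) n) a (confVal c′)
    num = subst (λ n′ → Num (kept (Φ n)) (confVal c) (get (proj₁ rec) n′) a (confVal c′)) e (proj₁ (proj₂ (proj₂ rec)))

  leave zero i e {c} refl es (eα , et) U ew =
    lab endA (look tend) (just r₀) +ᵛ v ,
    step endA (look tend) {q = just r₀} {q₁ = nothing} ((refl , e , refl , eα , refl , subst (λ n → state c ≡ end (Φ n)) (sym e) es) , tt)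
      (trans (top-head hd U) (trans (cong List.head (sym ew)) et) , refl) (proj₂ (drain U)) ,
    (λ y → trans (split-get endA (look tend) r₀ v y) (trans (ℤₚ.+-identityˡ _) (get-above (proj₂ (drain U)) (toℕ i) y z≤n (ix≤κ i)))) ,
    λ z → refl
    where
    v = proj₁ (drain U)
    r₀ : St κ
    r₀ = ⟪ i , state c , false , α (clocks c) , allTrue ⟫
  leave (suc n) i e {c} {d} pr es ok U ew =
    lab nextA g (just r₀) +ᵛ proj₁ rec ,
    step nextA g {q = just r₀} {q₁ = just r₁} (tt , trans e (cong suc (sym e′)) , refl , refl , refl , refl , refl , cong (kept ∘ Φ) (sym e′) ,
      subst (λ n → state c ≡ end (Φ n)) (sym e) es) (refl , refl) (proj₁ (proj₂ rec)) ,
    (λ y → trans (split-get nextA g r₀ (proj₁ rec) y) (trans (ℤₚ.+-identityˡ _) (get-above (proj₁ (proj₂ rec)) (toℕ i) y (ℕₚ.≤-reflexive (trans (cong suc e′) (sym e))) (ix≤κ i)))) ,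
    Bd-cong Φ (suc n) {v = get (proj₁ rec)} (λ _ → refl) (λ j z j< → below-get nextA g r₀ (proj₁ rec) j z (subst (j <_) (sym e) j<)) (proj₂ (proj₂ rec))
    where
    n<κ : n < suc κ
    n<κ = s≤s (ℕₚ.≤-trans (ℕₚ.n≤1+n n) (subst (_≤ κ) e (ix≤κ i)))
    i′ = fromℕ< n<κ
    e′ : toℕ i′ ≡ n
    e′ = Finₚ.toℕ-fromℕ< n<κ
    g = look (top t U)
    r₀ r₁ : St κ
    r₀ = ⟪ i , state c , false , α (clocks c) , allTrue ⟫
    r₁ = ⟪ i′ , state c , false , α (clocks c) , kept (Φ n) ⟫
    rec : Entered i′ n U c d
    rec = enter n i′ e′ pr ok U ew

  phasedQ-complete : ∀ {c d} → PhasedRun Φ W (suc κ) c d → EndOK d → stackW c ≡ W →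
                     ⟦ phasedQ t (state c) (α (clocks c)) ⟧ᵠ [ confVal c , confVal d ]′
  phasedQ-complete {c} {d} pr ok ew = proj₂ (phasedQ-spec t (state c) (α (clocks c)) (confVal c) (confVal d)) (enter κ (Fin.fromℕ κ) (Finₚ.toℕ-fromℕ κ) pr ok [] ew)

-- From phases back to steps of the automaton

module _ {nS m k l : ℕ} (A : Automaton nS m k l) where

  open Automaton A
  open Phased A
  open Phase

  between : ∀ s {a b c} → HasSign s a → HasSign s c → a ≤ᶻ b → b ≤ᶻ c → HasSign s b
  between negative p q a≤b b≤c = ℤₚ.≤-<-trans b≤c q
  between null refl refl a≤b b≤c = ℤₚ.≤-antisym b≤c a≤b
  between positive p q a≤b b≤c = ℤₚ.<-≤-trans p a≤b

  Along : Mode → ℤ → ℤ → Set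
  Along nondecr a b = a ≤ᶻ b
  Along nonincr a b = b ≤ᶻ a

  along-refl : ∀ μ {a} → Along μ a a
  along-refl nondecr = ℤₚ.≤-refl
  along-refl nonincr = ℤₚ.≤-refl

  along-trans : ∀ μ {a b c} → Along μ a b → Along μ b c → Along μ a c
  along-trans nondecr p q = ℤₚ.≤-trans p q
  along-trans nonincr p q = ℤₚ.≤-trans q p

  along-between : ∀ μ s {a b c} → HasSign s a → HasSign s c → Along μ a b → Along μ b c → HasSign s b
  along-between nondecr s p q = between s p q
  along-between nonincr s p q ab bc = between s q p bc ab

  along-upd : ∀ μ u v → UpdOK μ u → Along μ v (ctrUpd u v)
  along-upd nondecr incr v ok = ℤₚ.i≤i+j v 1ℤ
  along-upd nondecr keep v ok = ℤₚ.≤-refl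
  along-upd nonincr decr v ok = ℤₚ.i-j≤i v 1ℤ
  along-upd nonincr keep v ok = ℤₚ.≤-refl

  seg-monotone : ∀ {W ph f n c c′} → pkind ph ≡ segP → PhRun W ph f n c c′ → ∀ j → Along (proj₁ (lookup (stage ph) j)) (counters c j) (counters c′ j)
  seg-monotone e (pdone _) j = along-refl _
  seg-monotone {ph = ph} e (pedge x {c = c} {c₁} al (_ , _ , _ , ctr , _) _ r) j =
    along-trans (proj₁ (lookup (stage ph) j)) (subst (Along _ (counters c j)) (sym (ctr j)) (along-upd _ _ (counters c j) (proj₂ (al′ j)))) (seg-monotone e r j)
    where
    al′ : Allowed segP (stage ph) (edge A x)
    al′ = subst (λ p → Allowed p (stage ph) (edge A x)) e al
  seg-monotone e (pinit e′ _ _ _) j with trans (sym e) e′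
  ... | ()

  mkStep : ∀ x {c c₁} → Move (edge A x) c c₁ → (∀ j → ctrTest (ctest (edge A x) j) (counters c j)) → Step A c c₁
  mkStep x (e₁ , e₂ , clk , ctr , stk) ts = edge A x , ∈ₚ.∈-lookup x , e₁ , e₂ , clk , ts , ctr , stk

  tests-hold : ∀ {σ} {e : Edge nS m k l} {c : Cfg} → (∀ j → TestOK (proj₂ (lookup σ j)) (ctest e j)) → Signs σ (confVal c) → ∀ j → ctrTest (ctest e j) (counters c j)
  tests-hold {σ} {e} {c} ok sg j = TestOK-sound (proj₂ (lookup σ j)) (ctest e j) (counters c j) (sg j) (ok j)

  -- The signs at the far end are carried unchanged through the induction: with the monotonicity of
  -- the remaining run they give the signs at the next configuration, and the signs give back the
  -- counter tests.
  seg-path : ∀ {W ph f n c c′} → pkind ph ≡ segP → PhRun W ph f n c c′ → Signs (stage ph) (confVal c) → Signs (stage ph) (confVal c′) → Path (Step A) c c′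
  seg-path e (pdone _) sg sg′ = halt
  seg-path {ph = ph} {c′ = c′} e (pedge x {c = c} {c₁} al mv _ r) sg sg′ =
    mkStep x mv (tests-hold {stage ph} {edge A x} {c} (proj₁ ∘ al′) sg) ◅ seg-path e r sg₁ sg′
    where
    al′ : Allowed segP (stage ph) (edge A x)
    al′ = subst (λ p → Allowed p (stage ph) (edge A x)) e al
    sg₁ : Signs (stage ph) (confVal c₁)
    sg₁ j = along-between (proj₁ (lookup (stage ph) j)) (proj₂ (lookup (stage ph) j)) (sg j) (sg′ j)
      (subst (Along _ (counters c j)) (sym (proj₁ (proj₂ (proj₂ (proj₂ mv))) j)) (along-upd _ _ (counters c j) (proj₂ (al′ j)))) (seg-monotone e r j)
  seg-path e (pinit e′ _ _ _) sg sg′ with trans (sym e) e′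
  ... | ()

  one-step : ∀ {W ph f n c c′} → pkind ph ≡ oneP → PhRun W ph f n c c′ → n ≡ 1 → Signs (stage ph) (confVal c) → Step A c c′
  one-step {ph = ph} e (pedge x {c = c} al mv _ (pdone _)) _ sg =
    mkStep x mv (tests-hold {stage ph} {edge A x} {c} (subst (λ p → Allowed p (stage ph) (edge A x)) e al) sg)
  one-step e (pedge x al mv _ (pinit e′ _ _ _)) _ sg with trans (sym e) e′
  ... | ()
  one-step e (pinit e′ _ _ _) _ sg with trans (sym e) e′
  ... | ()

  segPhase-path : ∀ {W ph c c′} → pkind ph ≡ segP → PhaseOK W ph c c′ → Path (Step A) c c′
  segPhase-path {ph = ph} {c} {c′} e (n , r , _ , ko , _) =
    let sg , sg′ = subst (λ p → KindOK p (stage ph) (confVal c) (+ n) (confVal c′)) e ko in seg-path e r sg sg′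

  onePhase-step : ∀ {W ph c c′} → pkind ph ≡ oneP → PhaseOK W ph c c′ → Step A c c′
  onePhase-step {ph = ph} {c} {c′} e (n , r , _ , ko , _) =
    let sg , n≡1 = subst (λ p → KindOK p (stage ph) (confVal c) (+ n) (confVal c′)) e ko in one-step e r (ℤₚ.+-injective n≡1) sg

-- Reversals, stages and a potential that bounds the changes of stage

sgn : ℤ → Sign
sgn (+ zero) = null
sgn (+ suc _) = positive
sgn -[1+ _ ] = negative

sgn-has : ∀ v → HasSign (sgn v) v
sgn-has (+ zero) = refl
sgn-has (+ suc n) = +<+ (s≤s z≤n)
sgn-has -[1+ n ] = -<+

nextMode : Mode → ℤ → ℤ → Mode
nextMode nondecr v w = if ⌊ w ℤₚ.<? v ⌋ then nonincr else nondecr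
nextMode nonincr v w = if ⌊ v ℤₚ.<? w ⌋ then nondecr else nonincr

turn : Mode → ℤ → ℤ → ℕ
turn nondecr v w = if ⌊ w ℤₚ.<? v ⌋ then 1 else 0
turn nonincr v w = if ⌊ v ℤₚ.<? w ⌋ then 1 else 0

revs : Mode → (ℕ → ℤ) → ℕ → ℕ
revs μ f zero = 0
revs μ f (suc n) = turn μ (f 0) (f 1) + revs (nextMode μ (f 0) (f 1)) (f ∘ suc) n

reversals-∷ : ∀ μ v w ws → reversals μ v (w ∷ ws) ≡ turn μ v w + reversals (nextMode μ v w) w ws
reversals-∷ nondecr v w ws with w ℤₚ.<? v
... | yes _ = refl
... | no _ = refl
reversals-∷ nonincr v w ws with v ℤₚ.<? w
... | yes _ = refl
... | no _ = refl

reversals-revs : ∀ (f : ℕ → ℤ) (g : ℕ → ℕ) μ n → reversals μ (f (g 0)) (map f (applyUpTo (g ∘ suc) n)) ≡ revs μ (f ∘ g) n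
reversals-revs f g μ zero = refl
reversals-revs f g μ (suc n) = trans (reversals-∷ μ (f (g 0)) (f (g 1)) (map f (applyUpTo (λ i → g (suc (suc i))) n)))
  (cong (λ r → turn μ (f (g 0)) (f (g 1)) + r) (reversals-revs f (g ∘ suc) (nextMode μ (f (g 0)) (f (g 1))) n))

turn-same : ∀ v → turn nondecr v v ≡ 0 × nextMode nondecr v v ≡ nondecr
turn-same v with v ℤₚ.<? v
... | yes p = ⊥-elim (ℤₚ.<-irrefl refl p)
... | no _ = refl , refl

-- The list of values starts with `f 0` again, and comparing this value with itself is not a turn.
reversalsUpTo-revs : ∀ f n → reversalsUpTo f n ≡ revs nondecr f n
reversalsUpTo-revs f n = trans (reversals-∷ nondecr (f 0) (f 0) (map f (applyUpTo suc n)))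
  (trans (cong₂ (λ a μ → a + reversals μ (f 0) (map f (applyUpTo suc n))) (proj₁ (turn-same (f 0))) (proj₂ (turn-same (f 0)))) (reversals-revs f id nondecr n))

-- The number of signs still ahead in a monotone phase.
rank : Mode → Sign → ℕ
rank nondecr negative = 2
rank nondecr null = 1
rank nondecr positive = 0
rank nonincr positive = 2
rank nonincr null = 1
rank nonincr negative = 0

rank≤2 : ∀ μ s → rank μ s ≤ 2
rank≤2 nondecr negative = ℕₚ.≤-refl
rank≤2 nondecr null = s≤s z≤n
rank≤2 nondecr positive = z≤n
rank≤2 nonincr positive = ℕₚ.≤-refl
rank≤2 nonincr null = s≤s z≤n
rank≤2 nonincr negative = z≤n

sgn-mono : ∀ {v w} → v ≤ᶻ w → sgn v ≡ sgn w ⊎ (suc (rank nondecr (sgn w)) ≤ rank nondecr (sgn v) × suc (rank nonincr (sgn v)) ≤ rank nonincr (sgn w))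
sgn-mono {+ zero} {+ zero} _ = inj₁ refl
sgn-mono {+ zero} {+ suc _} _ = inj₂ (s≤s z≤n , s≤s (s≤s z≤n))
sgn-mono {+ suc _} {+ zero} (+≤+ ())
sgn-mono {+ suc _} {+ suc _} _ = inj₁ refl
sgn-mono { -[1+ _ ]} {+ zero} _ = inj₂ (s≤s (s≤s z≤n) , s≤s z≤n)
sgn-mono { -[1+ _ ]} {+ suc _} _ = inj₂ (s≤s z≤n , s≤s z≤n)
sgn-mono { -[1+ _ ]} { -[1+ _ ]} _ = inj₁ refl

-- While the mode is kept, the sign can only move through the at most 2 values still ahead. A turn
-- may raise the rank by 2; the weight 3 of a reversal pays for this and leaves a decrease of at
-- least 1, so that every change of stage lowers the potential.
potential : Mode → (ℕ → ℤ) → ℕ → ℕ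
potential μ f n = 3 * revs μ f n + rank μ (sgn (f 0))

Drop : (old new : Stage) (before after : ℕ) → Set
Drop s s′ p p′ = (s′ ≡ s × p′ ≤ p) ⊎ suc p′ ≤ p

kept-mode : ∀ μ v w → (nextMode μ v w ≡ μ × turn μ v w ≡ 0 × (sgn v ≡ sgn w ⊎ suc (rank μ (sgn w)) ≤ rank μ (sgn v))) ⊎ turn μ v w ≡ 1
kept-mode nondecr v w with w ℤₚ.<? v
... | yes _ = inj₂ refl
... | no p = inj₁ (refl , refl , Sum.map₂ proj₁ (sgn-mono (ℤₚ.≮⇒≥ p)))
kept-mode nonincr v w with v ℤₚ.<? w
... | yes _ = inj₂ refl
... | no p = inj₁ (refl , refl , [ (λ e → inj₁ (sym e)) , (λ q → inj₂ (proj₂ q)) ]′ (sgn-mono (ℤₚ.≮⇒≥ p)))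

potential-step : ∀ μ f n → let μ′ = nextMode μ (f 0) (f 1) in
  Drop (μ , sgn (f 0)) (μ′ , sgn (f 1)) (potential μ f (suc n)) (potential μ′ (f ∘ suc) n)
potential-step μ f n with kept-mode μ (f 0) (f 1)
... | inj₁ (e , z , inj₁ s) = inj₁ (cong₂ _,_ e (sym s) ,
      ℕₚ.≤-reflexive (cong₂ (λ r p → 3 * r + p) (sym (cong (_+ revs (nextMode μ (f 0) (f 1)) (f ∘ suc) n) z)) (cong₂ rank e (sym s))))
... | inj₁ (e , z , inj₂ s) = inj₂ (begin
      suc (3 * R + rank μ′ (sgn (f 1)))           ≡⟨ sym (ℕₚ.+-suc (3 * R) _) ⟩
      3 * R + suc (rank μ′ (sgn (f 1)))           ≡⟨ cong (λ μ → 3 * R + suc (rank μ (sgn (f 1)))) e ⟩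
      3 * R + suc (rank μ (sgn (f 1)))            ≤⟨ ℕₚ.+-monoʳ-≤ (3 * R) s ⟩
      3 * R + rank μ (sgn (f 0))                  ≡⟨ cong (λ a → 3 * (a + R) + rank μ (sgn (f 0))) (sym z) ⟩
      3 * (turn μ (f 0) (f 1) + R) + rank μ (sgn (f 0)) ∎)
  where
  open ℕₚ.≤-Reasoning
  μ′ = nextMode μ (f 0) (f 1)
  R = revs μ′ (f ∘ suc) n
... | inj₂ o = inj₂ (begin
      suc (3 * R + rank μ′ (sgn (f 1)))           ≤⟨ s≤s (ℕₚ.+-monoʳ-≤ (3 * R) (rank≤2 μ′ (sgn (f 1)))) ⟩
      suc (3 * R + 2)                             ≡⟨ sym (ℕₚ.+-suc (3 * R) 2) ⟩
      3 * R + 3                                   ≡⟨ ℕₚ.+-comm (3 * R) 3 ⟩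
      3 + 3 * R                                   ≡⟨ sym (ℕₚ.*-suc 3 R) ⟩
      3 * (1 + R)                                 ≤⟨ ℕₚ.m≤m+n (3 * (1 + R)) _ ⟩
      3 * (1 + R) + rank μ (sgn (f 0))            ≡⟨ cong (λ a → 3 * (a + R) + rank μ (sgn (f 0))) (sym o) ⟩
      3 * (turn μ (f 0) (f 1) + R) + rank μ (sgn (f 0)) ∎)
  where
  open ℕₚ.≤-Reasoning
  μ′ = nextMode μ (f 0) (f 1)
  R = revs μ′ (f ∘ suc) n

upd-kept : ∀ μ u v → nextMode μ v (ctrUpd u v) ≡ μ → UpdOK μ u
upd-kept nondecr incr v e = tt
upd-kept nondecr keep v e = tt
upd-kept nonincr decr v e = tt
upd-kept nonincr keep v e = tt
upd-kept nondecr decr v e with (v +ᶻ -1ℤ) ℤₚ.<? v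
upd-kept nondecr decr v () | yes _
... | no p = p (1+≤⇒< (ℤₚ.≤-reflexive (lem v)))
  where
  lem : ∀ v → 1ℤ +ᶻ (v +ᶻ -1ℤ) ≡ v
  lem = solve-∀
upd-kept nonincr incr v e with v ℤₚ.<? (v +ᶻ 1ℤ)
upd-kept nonincr incr v () | yes _
... | no p = p (1+≤⇒< (ℤₚ.≤-reflexive (ℤₚ.+-comm 1ℤ v)))

sumFinℕ : ∀ n → (Fin n → ℕ) → ℕ
sumFinℕ zero f = 0
sumFinℕ (suc n) f = f zero + sumFinℕ n (λ i → f (suc i))

sumFinℕ-mono : ∀ n {f g : Fin n → ℕ} → (∀ i → f i ≤ g i) → sumFinℕ n f ≤ sumFinℕ n g
sumFinℕ-mono zero h = z≤n
sumFinℕ-mono (suc n) h = ℕₚ.+-mono-≤ (h zero) (sumFinℕ-mono n (λ i → h (suc i)))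

drop-≤ : ∀ {s s′ p p′} → Drop s s′ p p′ → p′ ≤ p
drop-≤ (inj₁ (_ , q)) = q
drop-≤ (inj₂ q) = ℕₚ.<⇒≤ q

drop-sum : ∀ n (s s′ : Fin n → Stage) (p p′ : Fin n → ℕ) → (∀ j → Drop (s j) (s′ j) (p j) (p′ j)) →
           (∀ j → s′ j ≡ s j) × sumFinℕ n p′ ≤ sumFinℕ n p ⊎ suc (sumFinℕ n p′) ≤ sumFinℕ n p
drop-sum zero s s′ p p′ h = inj₁ ((λ ()) , z≤n)
drop-sum (suc n) s s′ p p′ h with h zero | drop-sum n (s ∘ suc) (s′ ∘ suc) (p ∘ suc) (p′ ∘ suc) (h ∘ suc)
... | inj₂ q | _ = inj₂ (ℕₚ.+-mono-≤ q (sumFinℕ-mono n (λ j → drop-≤ (h (suc j)))))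
... | inj₁ (e , q) | inj₁ (e′ , q′) = inj₁ ((λ { zero → e ; (suc j) → e′ j }) , ℕₚ.+-mono-≤ q q′)
... | inj₁ (e , q) | inj₂ q′ = inj₂ (ℕₚ.≤-trans (ℕₚ.≤-reflexive (sym (ℕₚ.+-suc (p′ zero) _))) (ℕₚ.+-mono-≤ q q′))

finite-Stage : Finite Stage
finite-Stage = finite-× (finite-retract modeTo modeFrom modeRetract finite-Bool) (finite-retract signTo signFrom signRetract (finite-Fin 3))
  where
  modeTo : Mode → Bool
  modeTo nondecr = true
  modeTo nonincr = false
  modeFrom : Bool → Mode
  modeFrom true = nondecr
  modeFrom false = nonincr
  modeRetract : ∀ μ → modeFrom (modeTo μ) ≡ μ
  modeRetract nondecr = refl
  modeRetract nonincr = refl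
  signTo : Sign → Fin 3
  signTo negative = zero
  signTo null = suc zero
  signTo positive = suc (suc zero)
  signFrom : Fin 3 → Sign
  signFrom zero = negative
  signFrom (suc zero) = null
  signFrom (suc (suc zero)) = positive
  signRetract : ∀ s → signFrom (signTo s) ≡ s
  signRetract negative = refl
  signRetract null = refl
  signRetract positive = refl

dbl : ℕ → ℕ
dbl zero = zero
dbl (suc n) = suc (suc (dbl n))

upd : ∀ {X : Set} → (ℕ → X) → ℕ → X → ℕ → X
upd Φ n p i with i ℕₚ.≟ n
... | yes _ = p
... | no _ = Φ i

upd-same : ∀ {X : Set} (Φ : ℕ → X) n p → upd Φ n p n ≡ p
upd-same Φ n p with n ℕₚ.≟ n
... | yes _ = refl
... | no ¬e = ⊥-elim (¬e refl)

upd-below : ∀ {X : Set} (Φ : ℕ → X) n p i → i < n → upd Φ n p i ≡ Φ i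
upd-below Φ n p i i<n with i ℕₚ.≟ n
... | yes refl = ⊥-elim (ℕₚ.<-irrefl refl i<n)
... | no _ = refl

-- Decomposition of runs into phases

module Decomposition {nS m k l : ℕ} (A : Automaton nS m k l) where

  open Automaton A
  open Phased A
  open Phase

  PlainPhase : Set
  PlainPhase = Bool × Vec Stage k × Flags × Fin nS

  finPlain : Finite PlainPhase
  finPlain = finite-× finite-Bool (finite-× (finite-Vec finite-Stage k) (finite-× (finite-Vec finite-Bool m) (finite-Fin nS)))

  plain : PlainPhase → Phase
  plain (b , σ , f , s) = mkPhase (if b then segP else oneP) σ f s ttᵠ

  PhRun-cong : ∀ {W ph ph′ f n c c′} → pkind ph ≡ pkind ph′ → stage ph ≡ stage ph′ → PhRun W ph f n c c′ → PhRun W ph′ f n c c′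
  PhRun-cong e e′ (pdone a) = pdone a
  PhRun-cong e e′ (pedge x al mv a r) = pedge x (subst₂ (λ p σ → Allowed p σ (edge A x)) e e′ al) mv a (PhRun-cong e e′ r)
  PhRun-cong e e′ (pinit ei g a r) = pinit (trans (sym e) ei) g a (PhRun-cong e e′ r)

  PhasedRun-cong : ∀ {Φ Φ′ W} n {c d} → (∀ i → i < n → Φ i ≡ Φ′ i) → PhasedRun Φ W n c d → PhasedRun Φ′ W n c d
  PhasedRun-cong zero h e = e
  PhasedRun-cong {W = W} (suc n) h (c′ , ok , r) = c′ , subst (λ p → PhaseOK W p _ c′) (h n ℕₚ.≤-refl) ok , PhasedRun-cong n (λ i i< → h i (ℕₚ.m≤n⇒m≤1+n i<)) r

  extendRun : ∀ {Φ W} n ph {c c′ d} → PhaseOK W (plain ph) c c′ → PhasedRun (plain ∘ Φ) W n c′ d → PhasedRun (plain ∘ upd Φ n ph) W (suc n) c d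
  extendRun {Φ} {W} n ph {c} {c′} ok r =
    c′ , subst (λ p → PhaseOK W (plain p) c c′) (sym (upd-same Φ n ph)) ok ,
    PhasedRun-cong n (λ i i< → cong plain (sym (upd-below Φ n ph i i<))) r

  edgeOf : ∀ {c c₁} → Step A c c₁ → Σ (Fin (length edges)) λ x → Move (edge A x) c c₁ × (∀ j → ctrTest (ctest (edge A x) j) (counters c j))
  edgeOf {c} {c₁} (e , e∈ , st) = index e∈ , (proj₁ st′ , proj₁ (proj₂ st′) , proj₁ (proj₂ (proj₂ st′)) , proj₁ (proj₂ (proj₂ (proj₂ (proj₂ st′)))) , proj₂ (proj₂ (proj₂ (proj₂ (proj₂ st′))))) ,
    proj₁ (proj₂ (proj₂ (proj₂ st′)))
    where
    st′ : EdgeStep A (edge A (index e∈)) c c₁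
    st′ = subst (λ e → EdgeStep A e c c₁) (lookup-index e∈) st

  Modes : Set
  Modes = Fin k → Mode

  stageOf : Modes → Cfg → Vec Stage k
  stageOf μ c = tabulate λ j → μ j , sgn (counters c j)

  lookup-stage : ∀ μ c j → lookup (stageOf μ c) j ≡ (μ j , sgn (counters c j))
  lookup-stage μ c j = Vecₚ.lookup∘tabulate _ j

  signs-stage : ∀ μ c → Signs (stageOf μ c) (confVal c)
  signs-stage μ c j = subst (λ s → HasSign (proj₂ s) (counters c j)) (sym (lookup-stage μ c j)) (sgn-has (counters c j))

  nextModes : Modes → Cfg → Cfg → Modes
  nextModes μ c c₁ j = nextMode (μ j) (counters c j) (counters c₁ j)

  energy : Modes → (ℕ → Cfg) → ℕ → ℕ
  energy μ ρ n = sumFinℕ k λ j → potential (μ j) (λ i → counters (ρ i) j) n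

  energy-step : ∀ μ ρ n → let μ′ = nextModes μ (ρ 0) (ρ 1) in
    (stageOf μ′ (ρ 1) ≡ stageOf μ (ρ 0) × energy μ′ (ρ ∘ suc) n ≤ energy μ ρ (suc n)) ⊎ suc (energy μ′ (ρ ∘ suc) n) ≤ energy μ ρ (suc n)
  energy-step μ ρ n = Sum.map₁ (λ (e , p) → Vecₚ.tabulate-cong e , p)
    (drop-sum k _ _ _ _ (λ j → potential-step (μ j) (λ i → counters (ρ i) j) n))

  tests-allowed : ∀ {c : Cfg} σ (e : Edge nS m k l) → Signs σ (confVal c) → (∀ j → ctrTest (ctest e j) (counters c j)) → Allowed oneP σ e
  tests-allowed {c} σ e sg ts j = TestOK-complete (proj₂ (lookup σ j)) (ctest e j) (counters c j) (sg j) (ts j)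

  seg-allowed : ∀ {c c₁} μ e → Move e c c₁ → (∀ j → ctrTest (ctest e j) (counters c j)) →
                stageOf (nextModes μ c c₁) c₁ ≡ stageOf μ c → Allowed segP (stageOf μ c) e
  seg-allowed {c} {c₁} μ e (_ , _ , _ , ctr , _) ts same j = tests-allowed {c} (stageOf μ c) e (signs-stage μ c) ts j ,
    subst (λ s → UpdOK (proj₁ s) (cupd e j)) (sym (lookup-stage μ c j)) (upd-kept (μ j) (cupd e j) (counters c j)
      (trans (cong (nextMode (μ j) (counters c j)) (sym (ctr j)))
        (cong proj₁ (trans (sym (lookup-stage (nextModes μ c c₁) c₁ j)) (trans (cong (λ σ → lookup σ j) same) (lookup-stage μ c j))))))

  -- Empty segments pad a run to the maximal number of phases, so that the number is the same for
  -- all runs.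
  idle : ∀ {W} (c : Cfg) σ n → Above W c → Signs σ (confVal c) → PhasedRun (λ _ → plain (true , σ , allTrue , state c)) W n c c
  idle c σ zero a sg = refl
  idle c σ (suc n) a sg = c , (0 , pdone a , refl , (sg , sg) , tt-holds {ρ = confVal c}) , idle c σ n a sg

  -- A first segment, of stage σ, followed by 2B phases.
  Split : List (Fin l) → Vec Stage k → ℕ → Cfg → Cfg → Set
  Split W σ B c d = Σ Flags λ f → Σ (Fin nS) λ s → Σ (ℕ → PlainPhase) λ Φ → Σ Cfg λ c′ → Σ ℕ λ a →
    PhRun W (plain (true , σ , f , s)) f a c c′ × state c′ ≡ s × Signs σ (confVal c) × Signs σ (confVal c′) × PhasedRun (plain ∘ Φ) W (dbl B) c′ d

  join : ∀ {W σ B c d} → Split W σ B c d → Σ (ℕ → PlainPhase) λ Φ → PhasedRun (plain ∘ Φ) W (suc (dbl B)) c d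
  join {σ = σ} {B} (f , s , Φ , c′ , a , r , es , sg , sg′ , pr) =
    upd Φ (dbl B) (true , σ , f , s) , extendRun {Φ} (dbl B) (true , σ , f , s) (a , r , es , (sg , sg′) , tt-holds {ρ = confVal c′}) pr

  -- A step that keeps the stage is put in front of the first segment. A step that changes it lowers
  -- the energy and becomes a phase of its own, with an empty segment before it and the first
  -- segment of the rest after it; hence two further phases for each unit of energy.
  decompose : ∀ {W} n (ρ : ℕ → Cfg) μ B → (∀ i → i < n → Step A (ρ i) (ρ (suc i))) → (∀ i → i ≤ n → Above W (ρ i)) →
              energy μ ρ n ≤ B → Split W (stageOf μ (ρ 0)) B (ρ 0) (ρ n)
  decompose zero ρ μ B st ab en = allTrue , state (ρ 0) , _ , ρ 0 , 0 , pdone (ab 0 z≤n) , refl , signs-stage μ (ρ 0) , signs-stage μ (ρ 0) ,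
    idle (ρ 0) (stageOf μ (ρ 0)) (dbl B) (ab 0 z≤n) (signs-stage μ (ρ 0))
  decompose {W} (suc n) ρ μ B st ab en with energy-step μ ρ n | edgeOf (st 0 (s≤s z≤n))
  ... | inj₁ (same , less) | x , mv , ts
    with decompose n (ρ ∘ suc) (nextModes μ (ρ 0) (ρ 1)) B (λ i i< → st (suc i) (s≤s i<)) (λ i i≤ → ab (suc i) (s≤s i≤)) (ℕₚ.≤-trans less en)
  ... | f , s , Φ , c′ , a , r , es , sg , sg′ , pr =
    before (kind (edge A x)) f , s , Φ , c′ , suc a ,
    pedge x (seg-allowed {ρ 0} {ρ 1} μ (edge A x) mv ts same) mv (ab 0 z≤n) (PhRun-cong refl same r) , es , signs-stage μ (ρ 0) ,
    subst (λ σ → Signs σ (confVal c′)) same sg′ , pr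
  decompose {W} (suc n) ρ μ zero st ab en | inj₂ lt′ | _ with ℕₚ.≤-trans lt′ en
  ... | ()
  decompose {W} (suc n) ρ μ (suc B) st ab en | inj₂ lt′ | x , mv , ts
    with join {W} {_} {B} (decompose n (ρ ∘ suc) (nextModes μ (ρ 0) (ρ 1)) B (λ i i< → st (suc i) (s≤s i<)) (λ i i≤ → ab (suc i) (s≤s i≤)) (ℕₚ.≤-pred (ℕₚ.≤-trans lt′ en)))
  ... | Φ , pr = allTrue , state (ρ 0) , upd Φ (suc (dbl B)) ph , ρ 0 , 0 , pdone (ab 0 z≤n) , refl , signs-stage μ (ρ 0) , signs-stage μ (ρ 0) ,
      extendRun {Φ} (suc (dbl B)) ph
        (1 , pedge x (tests-allowed {ρ 0} (stageOf μ (ρ 0)) (edge A x) (signs-stage μ (ρ 0)) ts) mv (ab 0 z≤n) (pdone (ab 1 (s≤s z≤n))) ,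
         refl , (signs-stage μ (ρ 0) , refl) , tt-holds {ρ = confVal (ρ 1)}) pr
    where
    ph : PlainPhase
    ph = false , stageOf μ (ρ 0) , before (kind (edge A x)) allTrue , state (ρ 1)

  -- Eventually constant stages

  Steady : Vec Stage k → (ℕ → Cfg) → Set
  Steady σ ρ = ∀ i → Signs σ (confVal (ρ i)) × Σ (Fin (length edges)) λ x → Move (edge A x) (ρ i) (ρ (suc i)) × Allowed segP σ (edge A x)

  modesAt : Modes → (ℕ → Cfg) → ℕ → Modes
  modesAt μ ρ zero = μ
  modesAt μ ρ (suc i) = modesAt (nextModes μ (ρ 0) (ρ 1)) (ρ ∘ suc) i

  modesAt-suc : ∀ i μ ρ → ∀ j → modesAt μ ρ (suc i) j ≡ nextModes (modesAt μ ρ i) (ρ i) (ρ (suc i)) j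
  modesAt-suc zero μ ρ j = refl
  modesAt-suc (suc i) μ ρ j = modesAt-suc i (nextModes μ (ρ 0) (ρ 1)) (ρ ∘ suc) j

  stageAt : Modes → (ℕ → Cfg) → ℕ → Vec Stage k
  stageAt μ ρ i = stageOf (modesAt μ ρ i) (ρ i)

  energy-shift : ∀ i μ ρ n → energy (modesAt μ ρ i) (λ a → ρ (i + a)) n ≤ energy μ ρ (i + n)
  energy-shift zero μ ρ n = ℕₚ.≤-refl
  energy-shift (suc i) μ ρ n = ℕₚ.≤-trans (energy-shift i _ (ρ ∘ suc) n) ([ proj₂ , ℕₚ.<⇒≤ ]′ (energy-step μ ρ (i + n)))

  energy-drop : ∀ i μ ρ n → stageAt μ ρ i ≢ stageAt μ ρ 0 → suc (energy (modesAt μ ρ i) (λ a → ρ (i + a)) n) ≤ energy μ ρ (i + n)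
  energy-drop zero μ ρ n ne = ⊥-elim (ne refl)
  energy-drop (suc i) μ ρ n ne with energy-step μ ρ (i + n)
  ... | inj₁ (same , less) = ℕₚ.≤-trans (energy-drop i _ (ρ ∘ suc) n (λ e → ne (trans e same))) less
  ... | inj₂ lt′ = ℕₚ.≤-trans (s≤s (energy-shift i _ (ρ ∘ suc) n)) lt′

  steady-of : ∀ μ ρ → InfiniteExecution A ρ → (∀ i → stageAt μ ρ i ≡ stageAt μ ρ 0) → Steady (stageAt μ ρ 0) ρ
  steady-of μ ρ ex constant i with edgeOf (ex i)
  ... | x , mv , ts = subst (λ σ → Signs σ (confVal (ρ i))) (constant i) (signs-stage (modesAt μ ρ i) (ρ i)) , x , mv ,
      subst (λ σ → Allowed segP σ (edge A x)) (constant i) (seg-allowed {ρ i} {ρ (suc i)} (modesAt μ ρ i) (edge A x) mv ts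
        (trans (Vecₚ.tabulate-cong (λ j → cong (_, sgn (counters (ρ (suc i)) j)) (sym (modesAt-suc i μ ρ j)))) (trans (constant (suc i)) (sym (constant i)))))

  Steady-assoc : ∀ i N {σ} (ρ : ℕ → Cfg) → Steady σ (λ a → ρ (i + (N + a))) → Steady σ (λ a → ρ (i + N + a))
  Steady-assoc i N {σ} ρ s a = subst₂ (λ u v → Signs σ (confVal (ρ u)) × Σ (Fin (length edges)) λ x → Move (edge A x) (ρ u) (ρ v) × Allowed segP σ (edge A x))
        (sym (ℕₚ.+-assoc i N a)) (sym (ℕₚ.+-assoc i N (suc a))) (s a)

  -- Induction on `B`: a change of stage at `i` leaves a run with a smaller bound, which settles by
  -- induction; without such a change the run is steady from the start. Which of the two holds
  -- depends on the whole execution, hence the double negation.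
  eventually-steady : ∀ B μ ρ → InfiniteExecution A ρ → (∀ n → energy μ ρ n ≤ B) →
                      ¬ ¬ (Σ ℕ λ N → Σ (Vec Stage k) λ σ → Steady σ (λ i → ρ (N + i)))
  eventually-steady B μ ρ ex en never = never (0 , stageAt μ ρ 0 , steady-of μ ρ ex (λ i → constant B en i (≟-finite (finite-Vec finite-Stage k) (stageAt μ ρ i) (stageAt μ ρ 0))))
    where
    constant : ∀ B → (∀ n → energy μ ρ n ≤ B) → ∀ i → Dec (stageAt μ ρ i ≡ stageAt μ ρ 0) → stageAt μ ρ i ≡ stageAt μ ρ 0
    constant B en i (yes e) = e
    constant zero en i (no ne) = ⊥-elim (ℕₚ.<⇒≱ (energy-drop i μ ρ 0 ne) (ℕₚ.≤-trans (en (i + 0)) z≤n))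
    constant (suc B) en i (no ne) = ⊥-elim (eventually-steady B (modesAt μ ρ i) (λ a → ρ (i + a))
          (λ a → subst (λ b → Step A (ρ (i + a)) (ρ b)) (sym (ℕₚ.+-suc i a)) (ex (i + a)))
          (λ n → ℕₚ.≤-pred (ℕₚ.≤-trans (energy-drop i μ ρ n ne) (en (i + n))))
          (λ (N , σ , s) → never (i + N , σ , Steady-assoc i N {σ} ρ s)))

  segRun : ∀ {W σ s} n (ρ : ℕ → Cfg) → Steady σ ρ → (∀ i → i ≤ n → Above W (ρ i)) → Σ Flags λ f → PhRun W (mkPhase segP σ f s ttᵠ) f n (ρ 0) (ρ n)
  segRun {W} {σ} {s} zero ρ sd ab = allTrue , pdone (ab 0 z≤n)
  segRun {W} {σ} {s} (suc n) ρ sd ab with segRun {W} {σ} {s} n (ρ ∘ suc) (λ i → sd (suc i)) (λ i i≤ → ab (suc i) (s≤s i≤)) | sd 0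
  ... | f , r | _ , x , mv , al = before (kind (edge A x)) f , pedge x al mv (ab 0 z≤n) (PhRun-cong refl refl r)

-- Limits of formulas along arithmetic progressions

module Limits {V : Set} where

  part : (V ⊎ V → Lin V) → Lin (V ⊎ V) → Lin V
  part τ (lvar w) = τ w
  part τ (lcon c) = lcon 0ℤ
  part τ (t ⊞ u) = part τ t ⊞ part τ u
  part τ (c ⊠ t) = c ⊠ part τ t

  leftPart rightPart : Lin (V ⊎ V) → Lin V
  leftPart = part [ lvar , (λ _ → lcon 0ℤ) ]′
  rightPart = part [ (λ _ → lcon 0ℤ) , lvar ]′

  constPart : Lin (V ⊎ V) → ℤ
  constPart (lvar w) = 0ℤ
  constPart (lcon c) = c
  constPart (t ⊞ u) = constPart t +ᶻ constPart u
  constPart (c ⊠ t) = c *ᶻ constPart t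

  Lft Rgt : Lin (V ⊎ V) → (V → ℤ) → ℤ
  Lft t x = ⟦ leftPart t ⟧ˡ x
  Rgt t x = ⟦ rightPart t ⟧ˡ x

  parts-eval : ∀ t x y → ⟦ t ⟧ˡ [ x , y ]′ ≡ Lft t x +ᶻ Rgt t y +ᶻ constPart t
  parts-eval (lvar (inj₁ v)) x y = lem (x v)
    where
    lem : ∀ a → a ≡ a +ᶻ 0ℤ +ᶻ 0ℤ
    lem = solve-∀
  parts-eval (lvar (inj₂ v)) x y = lem (y v)
    where
    lem : ∀ a → a ≡ 0ℤ +ᶻ a +ᶻ 0ℤ
    lem = solve-∀
  parts-eval (lcon c) x y = lem c
    where
    lem : ∀ a → a ≡ 0ℤ +ᶻ 0ℤ +ᶻ a
    lem = solve-∀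
  parts-eval (t ⊞ u) x y = trans (cong₂ _+ᶻ_ (parts-eval t x y) (parts-eval u x y)) (lem (Lft t x) (Rgt t y) (constPart t) (Lft u x) (Rgt u y) (constPart u))
    where
    lem : ∀ a b c a′ b′ c′ → a +ᶻ b +ᶻ c +ᶻ (a′ +ᶻ b′ +ᶻ c′) ≡ a +ᶻ a′ +ᶻ (b +ᶻ b′) +ᶻ (c +ᶻ c′)
    lem = solve-∀
  parts-eval (k ⊠ t) x y = trans (cong (k *ᶻ_) (parts-eval t x y)) (lem k (Lft t x) (Rgt t y) (constPart t))
    where
    lem : ∀ k a b c → k *ᶻ (a +ᶻ b +ᶻ c) ≡ k *ᶻ a +ᶻ k *ᶻ b +ᶻ k *ᶻ c
    lem = solve-∀

  Additive : ((V → ℤ) → ℤ) → Set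
  Additive g = ∀ (x d : V → ℤ) n → g (λ v → x v +ᶻ n *ᶻ d v) ≡ g x +ᶻ n *ᶻ g d

  part-additive : ∀ τ → (∀ w → Additive ⟦ τ w ⟧ˡ) → ∀ t → Additive ⟦ part τ t ⟧ˡ
  part-additive τ h (lvar w) x d n = h w x d n
  part-additive τ h (lcon c) x d n = lem n
    where
    lem : ∀ n → 0ℤ ≡ 0ℤ +ᶻ n *ᶻ 0ℤ
    lem = solve-∀
  part-additive τ h (t ⊞ u) x d n = trans (cong₂ _+ᶻ_ (part-additive τ h t x d n) (part-additive τ h u x d n))
    (lem (⟦ part τ t ⟧ˡ x) (⟦ part τ t ⟧ˡ d) (⟦ part τ u ⟧ˡ x) (⟦ part τ u ⟧ˡ d) n)
    where
    lem : ∀ a b a′ b′ n → a +ᶻ n *ᶻ b +ᶻ (a′ +ᶻ n *ᶻ b′) ≡ a +ᶻ a′ +ᶻ n *ᶻ (b +ᶻ b′)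
    lem = solve-∀
  part-additive τ h (k ⊠ t) x d n = trans (cong (k *ᶻ_) (part-additive τ h t x d n)) (lem k (⟦ part τ t ⟧ˡ x) (⟦ part τ t ⟧ˡ d) n)
    where
    lem : ∀ k a b n → k *ᶻ (a +ᶻ n *ᶻ b) ≡ k *ᶻ a +ᶻ n *ᶻ (k *ᶻ b)
    lem = solve-∀

  zero-additive : Additive (λ _ → 0ℤ)
  zero-additive x d n = lem n
    where
    lem : ∀ n → 0ℤ ≡ 0ℤ +ᶻ n *ᶻ 0ℤ
    lem = solve-∀

  Lft-additive : ∀ t → Additive (Lft t)
  Lft-additive = part-additive _ λ { (inj₁ v) x d n → refl ; (inj₂ v) → zero-additive }

  Rgt-additive : ∀ t → Additive (Rgt t)
  Rgt-additive = part-additive _ λ { (inj₁ v) → zero-additive ; (inj₂ v) x d n → refl }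

  additive-diff : ∀ g → Additive g → (∀ {x y : V → ℤ} → (∀ v → x v ≡ y v) → g x ≡ g y) → ∀ x y → g (λ v → y v -ᶻ x v) ≡ g y -ᶻ g x
  additive-diff g add cong-g x y = trans (cong-g (λ v → lem (y v) (x v))) (trans (add y x -1ℤ) (sym (lem (g y) (g x))))
    where
    lem : ∀ a b → a -ᶻ b ≡ a +ᶻ -1ℤ *ᶻ b
    lem = solve-∀

  lin-cong : ∀ (t : Lin V) {x y : V → ℤ} → (∀ v → x v ≡ y v) → ⟦ t ⟧ˡ x ≡ ⟦ t ⟧ˡ y
  lin-cong (lvar v) e = e v
  lin-cong (lcon c) e = refl
  lin-cong (t ⊞ u) e = cong₂ _+ᶻ_ (lin-cong t e) (lin-cong u e)
  lin-cong (c ⊠ t) e = cong (c *ᶻ_) (lin-cong t e)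

  Lft-diff : ∀ t x y → Lft t (λ v → y v -ᶻ x v) ≡ Lft t y -ᶻ Lft t x
  Lft-diff t = additive-diff (Lft t) (Lft-additive t) (lin-cong (leftPart t))

  Rgt-diff : ∀ t x y → Rgt t (λ v → y v -ᶻ x v) ≡ Rgt t y -ᶻ Rgt t x
  Rgt-diff t = additive-diff (Rgt t) (Rgt-additive t) (lin-cong (rightPart t))

  onLeft onRight : Lin V → Lin (V ⊎ V)
  onLeft = subˡ (lvar ∘ inj₁)
  onRight = subˡ (lvar ∘ inj₂)

  diagonal : Lin (V ⊎ V) → Lin (V ⊎ V)
  diagonal t = onLeft (leftPart t) ⊞ onLeft (rightPart t) ⊞ lcon (constPart t)

  -- The truth value at (x, d) of Lim φ is that of φ at (x + n d, x + n′ d) when n′ ≫ n ≫ 0 are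
  -- multiples of the moduli of φ.
  Lim : QF (V ⊎ V) → QF (V ⊎ V)
  Lim (pos t) = or (pos a₂) (and (eqᵠ a₂ (lcon 0ℤ)) (or (pos a₁) (and (eqᵠ a₁ (lcon 0ℤ)) (pos (diagonal t)))))
    where
    a₁ = onRight (leftPart t)
    a₂ = onRight (rightPart t)
  Lim (dvd n t) = dvd n (diagonal t)
  Lim (neg φ) = neg (Lim φ)
  Lim (and φ ψ) = and (Lim φ) (Lim ψ)
  Lim (or φ ψ) = or (Lim φ) (Lim ψ)

  -- The condition that s + n a + n′ b is positive for n′ ≫ n ≫ 0: the triple (b, a, s) is
  -- lexicographically positive.
  LimPos : (a b s : ℤ) → Set
  LimPos a b s = 0ℤ <ᶻ b ⊎ (b ≡ 0ℤ × (0ℤ <ᶻ a ⊎ (a ≡ 0ℤ × 0ℤ <ᶻ s)))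

  Diag : Lin (V ⊎ V) → (V → ℤ) → ℤ
  Diag t x = Lft t x +ᶻ Rgt t x +ᶻ constPart t

  diagonal-eval : ∀ t x d → ⟦ diagonal t ⟧ˡ [ x , d ]′ ≡ Diag t x
  diagonal-eval t x d = cong₂ (λ a b → a +ᶻ b +ᶻ constPart t) (subˡ-eval _ [ x , d ]′ x (λ _ → refl) (leftPart t)) (subˡ-eval _ [ x , d ]′ x (λ _ → refl) (rightPart t))

  onRight-eval : ∀ t x d → ⟦ onRight t ⟧ˡ [ x , d ]′ ≡ ⟦ t ⟧ˡ d
  onRight-eval t x d = subˡ-eval _ [ x , d ]′ d (λ _ → refl) t

  Lim-pos : ∀ t x d → ⟦ Lim (pos t) ⟧ᵠ [ x , d ]′ ⟷ LimPos (Lft t d) (Rgt t d) (Diag t x)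
  Lim-pos t x d = ⊎-⟷ (≡⇒⟷ (cong (0ℤ <ᶻ_) (onRight-eval (rightPart t) x d)))
    (×-⟷ (⟷-trans (eq-spec [ x , d ]′ (onRight (rightPart t)) (lcon 0ℤ)) (≡⇒⟷ (cong (_≡ 0ℤ) (onRight-eval (rightPart t) x d))))
      (⊎-⟷ (≡⇒⟷ (cong (0ℤ <ᶻ_) (onRight-eval (leftPart t) x d)))
        (×-⟷ (⟷-trans (eq-spec [ x , d ]′ (onRight (leftPart t)) (lcon 0ℤ)) (≡⇒⟷ (cong (_≡ 0ℤ) (onRight-eval (leftPart t) x d))))
          (≡⇒⟷ (cong (0ℤ <ᶻ_) (diagonal-eval t x d))))))

  LimPos-b>0 : ∀ {a b s} → 0ℤ <ᶻ b → LimPos a b s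
  LimPos-b>0 p = inj₁ p

  LimPos-b<0 : ∀ {a b s} → b <ᶻ 0ℤ → ¬ LimPos a b s
  LimPos-b<0 p (inj₁ q) = ℤₚ.<-asym p q
  LimPos-b<0 p (inj₂ (q , _)) = ℤₚ.<⇒≢ p q

  LimPos-a>0 : ∀ {a b s} → b ≡ 0ℤ → 0ℤ <ᶻ a → LimPos a b s
  LimPos-a>0 e p = inj₂ (e , inj₁ p)

  LimPos-a<0 : ∀ {a b s} → b ≡ 0ℤ → a <ᶻ 0ℤ → ¬ LimPos a b s
  LimPos-a<0 e p (inj₁ q) = ℤₚ.<⇒≢ q (sym e)
  LimPos-a<0 e p (inj₂ (_ , inj₁ q)) = ℤₚ.<-asym p q
  LimPos-a<0 e p (inj₂ (_ , inj₂ (q , _))) = ℤₚ.<⇒≢ p q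

  LimPos-s : ∀ {a b s} → b ≡ 0ℤ → a ≡ 0ℤ → LimPos a b s ⟷ (0ℤ <ᶻ s)
  LimPos-s e e′ =
    (λ { (inj₁ q) → ⊥-elim (ℤₚ.<⇒≢ q (sym e)) ; (inj₂ (_ , inj₁ q)) → ⊥-elim (ℤₚ.<⇒≢ q (sym e′)) ; (inj₂ (_ , inj₂ (_ , q))) → q }) ,
    λ q → inj₂ (e , inj₂ (e′ , q))

  both : ∀ {A B : Set} → A → B → A ⟷ B
  both a b = (λ _ → b) , λ _ → a

  neither : ∀ {A B : Set} → ¬ A → ¬ B → A ⟷ B
  neither a b = (λ x → ⊥-elim (a x)) , λ x → ⊥-elim (b x)

  grow : ∀ z p n → 0ℤ <ᶻ p → suc ∣ z ∣ ≤ n → 0ℤ <ᶻ z +ᶻ + n *ᶻ p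
  grow z (+ suc p) n _ h = 1+≤⇒< (≤-by (ℤₚ.+-mono-≤ (ℤₚ.+-mono-≤ (+≤+ h) (-∣i∣≤i z)) (ℤₚ.*-monoʳ-≤-nonNeg (+ p) (+≤+ (z≤n {n})))) (lem z (+ n) (+ p) (+ ∣ z ∣)))
    where
    lem : ∀ z n p a → z +ᶻ n *ᶻ (1ℤ +ᶻ p) -ᶻ (1ℤ +ᶻ 0ℤ) ≡ n +ᶻ z +ᶻ n *ᶻ p -ᶻ (1ℤ +ᶻ a +ᶻ -ᶻ a +ᶻ 0ℤ *ᶻ p)
    lem = solve-∀
  grow z (+ zero) n (+<+ ()) h

  shrink : ∀ z p n → p <ᶻ 0ℤ → suc ∣ z ∣ ≤ n → ¬ (0ℤ <ᶻ z +ᶻ + n *ᶻ p)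
  shrink z p n p<0 h q = ℤₚ.<-asym q (subst (_<ᶻ 0ℤ) (lem z (+ n) p) (ℤₚ.neg-mono-< (grow (-ᶻ z) (-ᶻ p) n (ℤₚ.neg-mono-< p<0) (subst (λ a → suc a ≤ n) (sym (ℤₚ.∣-i∣≡∣i∣ z)) h))))
    where
    lem : ∀ z n p → -ᶻ (-ᶻ z +ᶻ n *ᶻ -ᶻ p) ≡ z +ᶻ n *ᶻ p
    lem = solve-∀

  module Progression (x d : V → ℤ) (L : ℕ) where

    term : ℕ → V → ℤ
    term n v = x v +ᶻ (+ n *ᶻ + suc L) *ᶻ d v

    Settles : (ℕ → ℕ → Set) → Set
    Settles G = Σ ℕ λ n₀ → ∀ n → n₀ ≤ n → Σ ℕ λ h → ∀ n′ → h ≤ n′ → G n n′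

    settles-map₂ : ∀ {F G H : ℕ → ℕ → Set} → (∀ n n′ → F n n′ → G n n′ → H n n′) → Settles F → Settles G → Settles H
    settles-map₂ f (a , p) (b , q) = a ⊔ b , λ n le′ →
      let h , p′ = p n (ℕₚ.≤-trans (ℕₚ.m≤m⊔n a b) le′)
          h′ , q′ = q n (ℕₚ.≤-trans (ℕₚ.m≤n⊔m a b) le′)
      in h ⊔ h′ , λ n′ le″ → f n n′ (p′ n′ (ℕₚ.≤-trans (ℕₚ.m≤m⊔n h h′) le″)) (q′ n′ (ℕₚ.≤-trans (ℕₚ.m≤n⊔m h h′) le″))

    value : ∀ t n n′ → ⟦ t ⟧ˡ [ term n , term n′ ]′ ≡ Diag t x +ᶻ + n *ᶻ (+ suc L *ᶻ Lft t d) +ᶻ + n′ *ᶻ (+ suc L *ᶻ Rgt t d)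
    value t n n′ = trans (parts-eval t (term n) (term n′)) (trans (cong₂ (λ a b → a +ᶻ b +ᶻ constPart t) (Lft-additive t x d (+ n *ᶻ + suc L)) (Rgt-additive t x d (+ n′ *ᶻ + suc L)))
      (lem (Lft t x) (Rgt t x) (constPart t) (+ n) (+ n′) (+ suc L) (Lft t d) (Rgt t d)))
      where
      lem : ∀ a b c n n′ L a′ b′ → a +ᶻ (n *ᶻ L) *ᶻ a′ +ᶻ (b +ᶻ (n′ *ᶻ L) *ᶻ b′) +ᶻ c ≡ a +ᶻ b +ᶻ c +ᶻ n *ᶻ (L *ᶻ a′) +ᶻ n′ *ᶻ (L *ᶻ b′)
      lem = solve-∀

    scale-pos : ∀ {a} → 0ℤ <ᶻ a → 0ℤ <ᶻ + suc L *ᶻ a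
    scale-pos {a} p = subst (_<ᶻ + suc L *ᶻ a) (ℤₚ.*-zeroʳ (+ suc L)) (ℤₚ.*-monoˡ-<-pos (+ suc L) p)

    scale-neg : ∀ {a} → a <ᶻ 0ℤ → + suc L *ᶻ a <ᶻ 0ℤ
    scale-neg {a} p = subst (+ suc L *ᶻ a <ᶻ_) (ℤₚ.*-zeroʳ (+ suc L)) (ℤₚ.*-monoˡ-<-pos (+ suc L) p)

    vanish : ∀ s n b → b ≡ 0ℤ → s +ᶻ n *ᶻ (+ suc L *ᶻ b) ≡ s
    vanish s n .0ℤ refl = lem s n (+ suc L)
      where
      lem : ∀ s n L → s +ᶻ n *ᶻ (L *ᶻ 0ℤ) ≡ s
      lem = solve-∀

    settles-pos : ∀ t → Settles λ n n′ → LimPos (Lft t d) (Rgt t d) (Diag t x) ⟷ (0ℤ <ᶻ Diag t x +ᶻ + n *ᶻ (+ suc L *ᶻ Lft t d) +ᶻ + n′ *ᶻ (+ suc L *ᶻ Rgt t d))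
    settles-pos t with ℤₚ.<-cmp (Rgt t d) 0ℤ
    ... | tri> _ _ b>0 = 0 , λ n _ → suc ∣ Diag t x +ᶻ + n *ᶻ (+ suc L *ᶻ Lft t d) ∣ , λ n′ h → both (LimPos-b>0 b>0) (grow (Diag t x +ᶻ + n *ᶻ (+ suc L *ᶻ Lft t d)) (+ suc L *ᶻ Rgt t d) n′ (scale-pos b>0) h)
    ... | tri< b<0 _ _ = 0 , λ n _ → suc ∣ Diag t x +ᶻ + n *ᶻ (+ suc L *ᶻ Lft t d) ∣ , λ n′ h → neither (LimPos-b<0 b<0) (shrink (Diag t x +ᶻ + n *ᶻ (+ suc L *ᶻ Lft t d)) (+ suc L *ᶻ Rgt t d) n′ (scale-neg b<0) h)
    ... | tri≈ _ b≡0 _ with ℤₚ.<-cmp (Lft t d) 0ℤ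
    ... | tri> _ _ a>0 = suc ∣ Diag t x ∣ , λ n h → 0 , λ n′ _ → both (LimPos-a>0 b≡0 a>0)
            (subst (0ℤ <ᶻ_) (sym (vanish (Diag t x +ᶻ + n *ᶻ (+ suc L *ᶻ Lft t d)) (+ n′) (Rgt t d) b≡0)) (grow (Diag t x) (+ suc L *ᶻ Lft t d) n (scale-pos a>0) h))
    ... | tri< a<0 _ _ = suc ∣ Diag t x ∣ , λ n h → 0 , λ n′ _ → neither (LimPos-a<0 b≡0 a<0)
            (λ q → shrink (Diag t x) (+ suc L *ᶻ Lft t d) n (scale-neg a<0) h (subst (0ℤ <ᶻ_) (vanish (Diag t x +ᶻ + n *ᶻ (+ suc L *ᶻ Lft t d)) (+ n′) (Rgt t d) b≡0) q))
    ... | tri≈ _ a≡0 _ = 0 , λ n _ → 0 , λ n′ _ → ⟷-trans (LimPos-s b≡0 a≡0)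
            (≡⇒⟷ (cong (0ℤ <ᶻ_) (sym (trans (vanish (Diag t x +ᶻ + n *ᶻ (+ suc L *ᶻ Lft t d)) (+ n′) (Rgt t d) b≡0) (vanish (Diag t x) (+ n) (Lft t d) a≡0)))))

    Lim-settles : ∀ φ → Per (+ suc L) φ → Settles λ n n′ → ⟦ Lim φ ⟧ᵠ [ x , d ]′ ⟷ ⟦ φ ⟧ᵠ [ term n , term n′ ]′
    Lim-settles (pos t) per with settles-pos t
    ... | n₀ , p = n₀ , λ n le′ → proj₁ (p n le′) , λ n′ le″ →
          ⟷-trans (Lim-pos t x d) (⟷-trans (proj₂ (p n le′) n′ le″) (≡⇒⟷ (cong (0ℤ <ᶻ_) (sym (value t n n′)))))
    Lim-settles (dvd k t) (divides q e) = 0 , λ n _ → 0 , λ n′ _ →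
      ⟷-trans (≡⇒⟷ (cong (+ suc k ∣_) (diagonal-eval t x d))) (⟷-sym (∣-shift (divides ((+ n *ᶻ Lft t d +ᶻ + n′ *ᶻ Rgt t d) *ᶻ q)
        (trans (cong (_-ᶻ Diag t x) (value t n n′)) (trans (cong (λ L → Diag t x +ᶻ + n *ᶻ (L *ᶻ Lft t d) +ᶻ + n′ *ᶻ (L *ᶻ Rgt t d) -ᶻ Diag t x) e)
          (lem (Diag t x) (+ n) (+ n′) q (+ suc k) (Lft t d) (Rgt t d)))))))
      where
      lem : ∀ s n n′ q k a b → s +ᶻ n *ᶻ (q *ᶻ k *ᶻ a) +ᶻ n′ *ᶻ (q *ᶻ k *ᶻ b) -ᶻ s ≡ (n *ᶻ a +ᶻ n′ *ᶻ b) *ᶻ q *ᶻ k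
      lem = solve-∀
    Lim-settles (neg φ) per with Lim-settles φ per
    ... | n₀ , p = n₀ , λ n le′ → proj₁ (p n le′) , λ n′ le″ → ¬-⟷ (proj₂ (p n le′) n′ le″)
    Lim-settles (and φ ψ) (per , per′) = settles-map₂ (λ _ _ → ×-⟷) (Lim-settles φ per) (Lim-settles ψ per′)
    Lim-settles (or φ ψ) (per , per′) = settles-map₂ (λ _ _ → ⊎-⟷) (Lim-settles φ per) (Lim-settles ψ per′)

-- Infinite sets of indices are predicates that are not bounded. The statements about them have ⊥ as
-- a conclusion, so no choice principle is needed to extract infinite subsets.

Subset : Set₁
Subset = ℕ → Set

Infinite : Subset → Set
Infinite X = ∀ n → ¬ (∀ j → n ≤ j → ¬ X j)

_⊑_ : Subset → Subset → Set
X ⊑ Y = ∀ i → X i → Y i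

⊑-trans : ∀ {X Y Z} → X ⊑ Y → Y ⊑ Z → X ⊑ Z
⊑-trans f g i x = g i (f i x)

-- The last colour is offered to `K`. Its infinity can be challenged only with an index beyond which
-- the colour does not occur, and beyond that index one colour fewer is left.
pigeonhole : ∀ N (f : ℕ → ℕ) X → Infinite X → (∀ i → X i → f i < N) → (∀ c → Infinite (λ i → X i × f i ≡ c) → ⊥) → ⊥
pigeonhole zero f X inf bd K = inf 0 λ j _ x → ℕₚ.n≮0 (bd j x)
pigeonhole (suc N) f X inf bd K = K N λ n none → pigeonhole N f (λ i → n ≤ i × X i)
  (λ n′ none′ → inf (n ⊔ n′) λ j le′ x → none′ j (ℕₚ.≤-trans (ℕₚ.m≤n⊔m n n′) le′) (ℕₚ.≤-trans (ℕₚ.m≤m⊔n n n′) le′ , x))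
  (λ i (n≤i , x) → ℕₚ.≤∧≢⇒< (ℕₚ.≤-pred (bd i x)) (λ e → none i n≤i (x , e)))
  (λ c inf′ → K c λ n′ none′ → inf′ n′ λ j le′ ((_ , x) , e) → none′ j le′ (x , e))

pigeonhole-finite : ∀ {W} (F : Finite W) (f : ℕ → W) X → Infinite X → (∀ w → Infinite (λ i → X i × f i ≡ w) → ⊥) → ⊥
pigeonhole-finite F f X inf K = pigeonhole (Finite.size F) (λ i → toℕ (Finite.enc F (f i))) X inf (λ i _ → Finₚ.toℕ<n _)
  λ c inf′ → inf′ 0 λ i₀ _ (_ , e₀) → K (f i₀) λ n none → inf′ n λ j le′ (x , e) →
    none j le′ (x , trans (sym (Finite.dec-enc F (f j))) (trans (cong (Finite.dec F) (Finₚ.toℕ-injective (trans e (sym e₀)))) (Finite.dec-enc F (f i₀))))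

-- Divergence is stated under a double negation, because the threshold for `b` cannot be computed
-- from mere unboundedness.
Increasing : (ℕ → ℤ) → Subset → Set
Increasing u X = (∀ i j → X i → X j → i < j → u i <ᶻ u j) × (∀ b → ¬ ¬ (Σ ℕ λ n → ∀ j → n ≤ j → X j → b <ᶻ u j))

Constant : (ℕ → ℤ) → Subset → Set
Constant u X = ∀ i j → X i → X j → u i ≡ u j

Tame : (ℕ → ℤ) → Subset → Set
Tame u X = Constant u X ⊎ (Increasing u X ⊎ Increasing (λ i → -ᶻ u i) X)

Unbounded : (ℕ → ℤ) → Subset → Set
Unbounded u X = ∀ b → ¬ (∀ j → X j → ¬ (b <ᶻ u j))

Records : (ℕ → ℤ) → Subset → Subset
Records u X j = X j × (∀ i → i < j → X i → u i <ᶻ u j)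

initial-bound : ∀ (u : ℕ → ℤ) n → Σ ℤ λ b → ∀ i → i < n → u i ≤ᶻ b
initial-bound u zero = 0ℤ , λ i ()
initial-bound u (suc n) with initial-bound u n
... | b , h = b ⊔ᶻ u n , λ i i< → [ (λ i<n → ℤₚ.≤-trans (h i i<n) (ℤₚ.i≤i⊔j b (u n))) , (λ { refl → ℤₚ.i≤j⊔i b (u n) }) ]′ (ℕₚ.m≤n⇒m<n∨m≡n (ℕₚ.≤-pred i<))

-- Let `b` bound the values at all indices below `n`. The first index in `X` whose value exceeds `b`
-- is a record and is at least `n`; well-founded induction takes the place of choosing it.
records-infinite : ∀ u X → Unbounded u X → Infinite (Records u X)
records-infinite u X ub n none with initial-bound u n
... | b , h = ub b (<-rec (λ j → X j → ¬ (b <ᶻ u j)) λ j ih x b<u → none j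
      (ℕₚ.≮⇒≥ (λ j<n → ℤₚ.<⇒≱ b<u (h j j<n)))
      (x , λ i i<j xi → ℤₚ.≤-<-trans (ℤₚ.≮⇒≥ (λ b<ui → ih i<j xi b<ui)) b<u))

records-increasing : ∀ u X → Unbounded u X → Increasing u (Records u X)
records-increasing u X ub =
  (λ i j (xi , _) (_ , r) i<j → r i i<j xi) ,
  λ b k → ub b λ j xj b<u → k (suc j , λ j′ j<j′ (_ , r) → ℤₚ.<-trans b<u (r j j<j′ xj))

-- If `u` is unbounded on one side, the records on that side are strictly monotone and diverge.
-- Otherwise `u` takes finitely many values, and one of them infinitely often.
tame : ∀ u X → Infinite X → (∀ Y → Y ⊑ X → Infinite Y → Tame u Y → ⊥) → ⊥
tame u X inf K = not-above u (λ Y s i t → K Y s i (inj₂ (inj₁ t))) λ b above →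
  not-above (λ i → -ᶻ u i) (λ Y s i t → K Y s i (inj₂ (inj₂ t))) λ b′ below →
  -- The values of `u` lie between `- b′` and `b`, so after adding `b′` they lie between 0 and
  -- `b + b′`.
  pigeonhole (suc ∣ b +ᶻ b′ ∣) (λ i → ∣ u i +ᶻ b′ ∣) X inf
    (λ i x → s≤s (∣∣-mono (low b′ below i x) (ℤₚ.+-monoˡ-≤ b′ (ℤₚ.≮⇒≥ (above i x)))))
    λ c inf′ → K (λ i → X i × ∣ u i +ᶻ b′ ∣ ≡ c) (λ i → proj₁) inf′ (inj₁ λ i j (xi , ei) (xj , ej) →
      cancel b′ (u i) (u j) (trans (sym (ℤₚ.0≤i⇒+∣i∣≡i (low b′ below i xi))) (trans (cong +_ (trans ei (sym ej))) (ℤₚ.0≤i⇒+∣i∣≡i (low b′ below j xj)))))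
  where
  not-above : ∀ v → (∀ Y → Y ⊑ X → Infinite Y → Increasing v Y → ⊥) → (∀ b → (∀ j → X j → ¬ (b <ᶻ v j)) → ⊥) → ⊥
  not-above v K′ K″ = K′ (Records v X) (λ i → proj₁) (records-infinite v X K″) (records-increasing v X K″)
  cancel : ∀ b a c → a +ᶻ b ≡ c +ᶻ b → a ≡ c
  cancel b a c e = trans (lem a b) (trans (cong (_-ᶻ b) e) (sym (lem c b)))
    where
    lem : ∀ a b → a ≡ a +ᶻ b -ᶻ b
    lem = solve-∀
  low : ∀ b′ → (∀ j → X j → ¬ (b′ <ᶻ -ᶻ u j)) → ∀ i → X i → 0ℤ ≤ᶻ u i +ᶻ b′
  low b′ below i x = ≤-by (ℤₚ.≮⇒≥ (below i x)) (lem (u i) b′)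
    where
    lem : ∀ u b → u +ᶻ b -ᶻ 0ℤ ≡ b -ᶻ -ᶻ u
    lem = solve-∀
  ∣∣-mono : ∀ {a c} → 0ℤ ≤ᶻ a → a ≤ᶻ c → ∣ a ∣ ≤ ∣ c ∣
  ∣∣-mono {a} {c} p q = ℤₚ.drop‿+≤+ (subst (_≤ᶻ + ∣ c ∣) (sym (ℤₚ.0≤i⇒+∣i∣≡i p)) (ℤₚ.≤-trans q (i≤∣i∣ c)))

-- Thinning of sequences of tuples

module LimitPairs {V : Set} (x : ℕ → V → ℤ) where

  open Limits {V}

  diff : ℕ → ℕ → V → ℤ
  diff i j v = x j v -ᶻ x i v

  Agree : QF (V ⊎ V) → ℕ → ℕ → Set
  Agree φ i j = ⟦ Lim φ ⟧ᵠ [ x i , diff i j ]′ ⟷ ⟦ φ ⟧ᵠ [ x i , x j ]′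

  Eventually : Subset → (ℕ → ℕ → Set) → Set
  Eventually X G = Σ ℕ λ n → ∀ i → n ≤ i → X i → ¬ ¬ (Σ ℕ λ h → ∀ j → h ≤ j → X j → G i j)

  eventually-⊑ : ∀ {X Y G} → X ⊑ Y → Eventually Y G → Eventually X G
  eventually-⊑ s (n , p) = n , λ i le′ xi k → p i le′ (s i xi) λ (h , q) → k (h , λ j le″ xj → q j le″ (s j xj))

  eventually-map₂ : ∀ {X F G H} → (∀ i j → F i j → G i j → H i j) → Eventually X F → Eventually X G → Eventually X H
  eventually-map₂ f (a , p) (b , q) = a ⊔ b , λ i le′ xi k →
    p i (ℕₚ.≤-trans (ℕₚ.m≤m⊔n a b) le′) xi λ (h , p′) → q i (ℕₚ.≤-trans (ℕₚ.m≤n⊔m a b) le′) xi λ (h′ , q′) →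
    k (h ⊔ h′ , λ j le″ xj → f i j (p′ j (ℕₚ.≤-trans (ℕₚ.m≤m⊔n h h′) le″) xj) (q′ j (ℕₚ.≤-trans (ℕₚ.m≤n⊔m h h′) le″) xj))

  module _ (t : Lin (V ⊎ V)) where

    u w : ℕ → ℤ
    u i = Lft t (x i)
    w i = Rgt t (x i)
    c = constPart t

    AgreePos : ℕ → ℕ → Set
    AgreePos i j = LimPos (u j -ᶻ u i) (w j -ᶻ w i) (u i +ᶻ w i +ᶻ c) ⟷ (0ℤ <ᶻ u i +ᶻ w j +ᶻ c)

    agree-pos : ∀ i j → AgreePos i j → Agree (pos t) i j
    agree-pos i j h = ⟷-trans (Lim-pos t (x i) (diff i j))
      (⟷-trans (≡⇒⟷ (cong₂ (λ a b → LimPos a b (u i +ᶻ w i +ᶻ c)) (Lft-diff t (x i) (x j)) (Rgt-diff t (x i) (x j))))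
        (⟷-trans h (≡⇒⟷ (cong (0ℤ <ᶻ_) (sym (parts-eval t (x i) (x j)))))))

    diff-pos : ∀ {a b} → a <ᶻ b → 0ℤ <ᶻ b -ᶻ a
    diff-pos {a} {b} p = <-by p (lem a b)
      where
      lem : ∀ a b → b -ᶻ a -ᶻ 0ℤ ≡ b -ᶻ a
      lem = solve-∀

    diff-neg : ∀ {a b} → -ᶻ a <ᶻ -ᶻ b → b -ᶻ a <ᶻ 0ℤ
    diff-neg {a} {b} p = <-by p (lem a b)
      where
      lem : ∀ a b → 0ℤ -ᶻ (b -ᶻ a) ≡ -ᶻ b -ᶻ -ᶻ a
      lem = solve-∀

    diff-zero : ∀ {a b} → a ≡ b → b -ᶻ a ≡ 0ℤ
    diff-zero {a} refl = ℤₚ.+-inverseʳ a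

    large : ∀ a b v → -ᶻ (a +ᶻ b) <ᶻ v → 0ℤ <ᶻ a +ᶻ v +ᶻ b
    large a b v p = <-by p (lem a b v)
      where
      lem : ∀ a b v → a +ᶻ v +ᶻ b -ᶻ 0ℤ ≡ v -ᶻ -ᶻ (a +ᶻ b)
      lem = solve-∀

    small : ∀ a b v → a +ᶻ b <ᶻ -ᶻ v → ¬ (0ℤ <ᶻ a +ᶻ v +ᶻ b)
    small a b v p q = ℤₚ.<-asym q (<-by p (lem a b v))
      where
      lem : ∀ a b v → 0ℤ -ᶻ (a +ᶻ v +ᶻ b) ≡ -ᶻ v -ᶻ (a +ᶻ b)
      lem = solve-∀

    swap-sum : ∀ a v b → v +ᶻ a +ᶻ b ≡ a +ᶻ v +ᶻ b
    swap-sum a v b = cong (_+ᶻ b) (ℤₚ.+-comm v a)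

    -- The cases follow the lexicographic order in `LimPos`. If the right part `w` diverges, it
    -- decides the sign for `j` far beyond `i`. If it is constant and the left part `u` diverges,
    -- `u` decides for large `i`. If both are constant, the values at (i, j) and (i, i) coincide.
    thin-pos : ∀ X → Infinite X → (∀ Y → Y ⊑ X → Infinite Y → Eventually Y AgreePos → ⊥) → ⊥
    thin-pos X inf K = tame w X inf λ Y s infY → λ
      { (inj₂ (inj₁ (inc , big))) → K Y s infY (0 , λ i _ yi k → big (-ᶻ (u i +ᶻ c)) λ (n , h) →
          k (n ⊔ suc i , λ j le′ yj → both (LimPos-b>0 (diff-pos (inc i j yi yj (ℕₚ.≤-trans (ℕₚ.m≤n⊔m n (suc i)) le′))))
            (large (u i) c (w j) (h j (ℕₚ.≤-trans (ℕₚ.m≤m⊔n n (suc i)) le′) yj))))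
      ; (inj₂ (inj₂ (dec , big))) → K Y s infY (0 , λ i _ yi k → big (u i +ᶻ c) λ (n , h) →
          k (n ⊔ suc i , λ j le′ yj → neither (LimPos-b<0 (diff-neg (dec i j yi yj (ℕₚ.≤-trans (ℕₚ.m≤n⊔m n (suc i)) le′))))
            (small (u i) c (w j) (h j (ℕₚ.≤-trans (ℕₚ.m≤m⊔n n (suc i)) le′) yj))))
      ; (inj₁ const) → tame u Y infY λ Z s′ infZ → λ
        { (inj₁ const′) → K Z (⊑-trans s′ s) infZ (0 , λ i _ zi k → k (0 , λ j _ zj →
            ⟷-trans (LimPos-s (diff-zero (const i j (s′ i zi) (s′ j zj))) (diff-zero (const′ i j zi zj)))
              (≡⇒⟷ (cong (λ z → 0ℤ <ᶻ u i +ᶻ z +ᶻ c) (const i j (s′ i zi) (s′ j zj))))))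
        -- Any member of `Z` supplies the constant value of `w`, so the threshold for `i` is fixed
        -- before `i` and `j` are given.
        ; (inj₂ (inj₁ (inc , big))) → infZ 0 λ i₀ _ z₀ → big (-ᶻ (w i₀ +ᶻ c)) λ (n , h) →
            K Z (⊑-trans s′ s) infZ (n , λ i n≤i zi k → k (suc i , λ j i<j zj →
              both (LimPos-a>0 (diff-zero (const i j (s′ i zi) (s′ j zj))) (diff-pos (inc i j zi zj i<j)))
                (subst (0ℤ <ᶻ_) (swap-sum (u i) (w j) c) (large (w j) c (u i) (subst (λ z → -ᶻ (z +ᶻ c) <ᶻ u i) (const i₀ j (s′ i₀ z₀) (s′ j zj)) (h i n≤i zi))))))
        ; (inj₂ (inj₂ (dec , big))) → infZ 0 λ i₀ _ z₀ → big (w i₀ +ᶻ c) λ (n , h) →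
            K Z (⊑-trans s′ s) infZ (n , λ i n≤i zi k → k (suc i , λ j i<j zj →
              neither (LimPos-a<0 (diff-zero (const i j (s′ i zi) (s′ j zj))) (diff-neg (dec i j zi zj i<j)))
                (λ q → small (w j) c (u i) (subst (λ z → z +ᶻ c <ᶻ -ᶻ u i) (const i₀ j (s′ i₀ z₀) (s′ j zj)) (h i n≤i zi)) (subst (0ℤ <ᶻ_) (sym (swap-sum (u i) (w j) c)) q)))) } }

    agree-dvd : ∀ n i j → (w i) %ℕ suc n ≡ (w j) %ℕ suc n → Agree (dvd n t) i j
    agree-dvd n i j e = ⟷-trans (≡⇒⟷ (cong (+ suc n ∣_) (diagonal-eval t (x i) (diff i j))))
      (⟷-trans (∣-shift (divides (w i /ℕ suc n -ᶻ w j /ℕ suc n) (trans (lem₁ (u i) (w i) (w j) c)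
        (trans (cong₂ _-ᶻ_ (a≡a%ℕn+[a/ℕn]*n (w i) (suc n)) (trans (a≡a%ℕn+[a/ℕn]*n (w j) (suc n)) (cong (λ r → + r +ᶻ (w j /ℕ suc n) *ᶻ + suc n) (sym e))))
          (lem₂ (+ (w i %ℕ suc n)) (w i /ℕ suc n) (w j /ℕ suc n) (+ suc n))))))
        (≡⇒⟷ (cong (+ suc n ∣_) (sym (parts-eval t (x i) (x j))))))
      where
      lem₁ : ∀ a b b′ c → a +ᶻ b +ᶻ c -ᶻ (a +ᶻ b′ +ᶻ c) ≡ b -ᶻ b′
      lem₁ = solve-∀
      lem₂ : ∀ r q q′ n → r +ᶻ q *ᶻ n -ᶻ (r +ᶻ q′ *ᶻ n) ≡ (q -ᶻ q′) *ᶻ n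
      lem₂ = solve-∀

  thin : ∀ φ X → Infinite X → (∀ Y → Y ⊑ X → Infinite Y → Eventually Y (Agree φ) → ⊥) → ⊥
  thin (pos t) X inf K = thin-pos t X inf λ Y s infY (n , p) → K Y s infY
    (n , λ i le′ yi k → p i le′ yi λ (h , q) → k (h , λ j le″ yj → agree-pos t i j (q j le″ yj)))
  thin (dvd n t) X inf K = pigeonhole (suc n) (λ i → w t i %ℕ suc n) X inf (λ i _ → n%ℕd<d (w t i) (suc n)) λ r inf′ →
    K _ (λ i → proj₁) inf′ (0 , λ i _ (_ , ei) k → k (0 , λ j _ (_ , ej) → agree-dvd t n i j (trans ei (sym ej))))
  thin (neg φ) X inf K = thin φ X inf λ Y s infY (n , p) → K Y s infY
    (n , λ i le′ yi k → p i le′ yi λ (h , q) → k (h , λ j le″ yj → ¬-⟷ (q j le″ yj)))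
  thin (and φ ψ) X inf K = thin φ X inf λ Y s infY ev → thin ψ Y infY λ Z s′ infZ ev′ →
    K Z (⊑-trans s′ s) infZ (eventually-map₂ (λ _ _ → ×-⟷) (eventually-⊑ s′ ev) ev′)
  thin (or φ ψ) X inf K = thin φ X inf λ Y s infY ev → thin ψ Y infY λ Z s′ infZ ev′ →
    K Z (⊑-trans s′ s) infZ (eventually-map₂ (λ _ _ → ⊎-⟷) (eventually-⊑ s′ ev) ev′)

  -- If φ holds at all pairs of an infinite set whose second index is large enough, then the limit
  -- of φ holds for some progression.
  limit-pair : ∀ φ X → Infinite X → (∀ i → X i → ¬ ¬ (Σ ℕ λ h → ∀ j → h ≤ j → X j → ⟦ φ ⟧ᵠ [ x i , x j ]′)) →
               (∀ y d → ⟦ Lim φ ⟧ᵠ [ y , d ]′ → ⊥) → ⊥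
  limit-pair φ X inf holds K = thin φ X inf λ Y s infY (n , p) → infY n λ i n≤i yi →
    p i n≤i yi λ (h , q) → holds i (s i yi) λ (h′ , r) → infY (h ⊔ h′) λ j le′ yj →
    K (x i) (diff i j) (proj₂ (q j (ℕₚ.≤-trans (ℕₚ.m≤m⊔n h h′) le′) yj) (r j (ℕₚ.≤-trans (ℕₚ.m≤n⊔m h h′) le′) (s j yj)))

-- Deciding liveness

-- Expresses an entry of the clock abstraction by linear inequalities: `e` may lie above the
-- difference only when it is truncated to 0, and below it only when it is capped at `M`.
capped-difference : ∀ a b e M → e ≤ M → ((e ≡ 0 ⊎ b + e ≤ a) × (e ≡ M ⊎ a ≤ b + e)) ⟷ (e ≡ (a ∸ b) ⊓ M)
capped-difference a b e M e≤M = to , from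
  where
  to : (e ≡ 0 ⊎ b + e ≤ a) × (e ≡ M ⊎ a ≤ b + e) → e ≡ (a ∸ b) ⊓ M
  to (p , q) = ℕₚ.≤-antisym (ℕₚ.⊓-glb low e≤M) (high q)
    where
    low : e ≤ a ∸ b
    low = [ (λ { refl → z≤n }) , (λ h → ℕₚ.m+n≤o⇒m≤o∸n e (subst (_≤ a) (ℕₚ.+-comm b e) h)) ]′ p
    high : e ≡ M ⊎ a ≤ b + e → (a ∸ b) ⊓ M ≤ e
    high (inj₁ refl) = ℕₚ.m⊓n≤n (a ∸ b) M
    high (inj₂ h) = ℕₚ.≤-trans (ℕₚ.m⊓n≤m (a ∸ b) M) (ℕₚ.m≤n+o⇒m∸n≤o a b h)
  from : e ≡ (a ∸ b) ⊓ M → (e ≡ 0 ⊎ b + e ≤ a) × (e ≡ M ⊎ a ≤ b + e)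
  from refl = low , high
    where
    low : (a ∸ b) ⊓ M ≡ 0 ⊎ b + (a ∸ b) ⊓ M ≤ a
    low with ℕₚ.≤-total a b
    ... | inj₁ a≤b = inj₁ (cong (_⊓ M) (ℕₚ.m≤n⇒m∸n≡0 a≤b))
    ... | inj₂ b≤a = inj₂ (ℕₚ.≤-trans (ℕₚ.+-monoʳ-≤ b (ℕₚ.m⊓n≤m (a ∸ b) M)) (ℕₚ.≤-reflexive (ℕₚ.m+[n∸m]≡n b≤a)))
    high : (a ∸ b) ⊓ M ≡ M ⊎ a ≤ b + (a ∸ b) ⊓ M
    high with ℕₚ.≤-total (a ∸ b) M
    ... | inj₁ p = inj₂ (ℕₚ.≤-trans (ℕₚ.m≤n+m∸n a b) (ℕₚ.≤-reflexive (cong (λ z → b + z) (sym (ℕₚ.m≤n⇒m⊓n≡m p)))))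
    ... | inj₂ p = inj₁ (ℕₚ.m≥n⇒m⊓n≡n p)

-- Formulas for loops and for reachability

module Liveness {nS m k l : ℕ} (A : Automaton nS m k l) (r : ℕ) (rb : ReversalBounded r A) (I P : PresburgerSet m k l) where

  open Automaton A
  open Phased A
  open Phase
  open Decomposition A

  Top : Set
  Top = Maybe (Fin l)

  Tuple : Set
  Tuple = CV → ℤ

  -- For each counter, 3 for every one of at most `r` reversals, and at most 2 for the initial rank.
  bound : ℕ
  bound = sumFinℕ k λ _ → 3 * r + 2

  energy-bound : ∀ (ρ : ℕ → Cfg) n → (∀ i → i < n → Step A (ρ i) (ρ (suc i))) → energy (λ _ → nondecr) ρ n ≤ bound
  energy-bound ρ n st = sumFinℕ-mono k λ j →
    ℕₚ.+-mono-≤ (ℕₚ.*-monoʳ-≤ 3 (subst (_≤ r) (reversalsUpTo-revs (λ i → counters (ρ i) j) n) (rb ρ n st j))) (rank≤2 nondecr _)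

  -- The loop from one minimal stack height to another: a first step, a visit to P, and the rest.
  LoopChoice : Set
  LoopChoice = (Flags × Fin nS) × (Flags × Fin nS) × Flags

  finLoop : Finite LoopChoice
  finLoop = finite-× (finite-× finFlags (finite-Fin nS)) (finite-× (finite-× finFlags (finite-Fin nS)) finFlags)
    where finFlags = finite-Vec finite-Bool m

  -- Phase 2, the first one, is a single move, so that no loop is empty and chained loops form an
  -- infinite execution. The visit to `P` is the condition at the end of phase 1.
  loopPhases : Vec Stage k → Fin nS → LoopChoice → ℕ → Phase
  loopPhases σ s (_ , _ , f₀) zero = mkPhase segP σ f₀ s ttᵠ
  loopPhases σ s (_ , (f₁ , s₁) , _) (suc zero) = mkPhase segP σ f₁ s₁ (qe P)
  loopPhases σ s ((f₂ , s₂) , _) (suc (suc _)) = mkPhase oneP σ f₂ s₂ ttᵠ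

  loopChoiceQ : Vec Stage k → Fin nS → Mat → Top → LoopChoice → QF (CV ⊎ CV)
  loopChoiceQ σ s D t p = Simulation.phasedQ (loopPhases σ s p) 2 D t t s D

  loopQ : Vec Stage k → Fin nS → Mat → Top → QF (CV ⊎ CV)
  loopQ σ s D t = orF finLoop (loopChoiceQ σ s D t)

  Located : Fin nS → Mat → Top → Tuple → Cfg → Set
  Located s D t x c = (∀ z → confVal c z ≡ x z) × state c ≡ s × α (clocks c) ≡ D × List.head (stackW c) ≡ t

  Loop : Cfg → Cfg → Set
  Loop c d = Σ Cfg λ c₁ → Σ Cfg λ p → Step A c c₁ × Path (Step A) c₁ p × p ∈ₚ P × Path (Step A) p d

  -- The configuration `c` is arbitrary up to its numbers and location: the run never pops below the
  -- stack of `c`, of which only the top symbol is visible. As `d` has the same location again,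
  -- loops can be chained.
  loopQ-sound : ∀ σ s D t x y c → ⟦ loopQ σ s D t ⟧ᵠ [ x , y ]′ → Located s D t x c → Σ Cfg λ d → Loop c d × Located s D t y d
  loopQ-sound σ s D t x y c h (e , refl , eα , et) =
    d , (c₁ , p , onePhase-step A refl ok₂ , segPhase-path A refl ok₁ , proj₁ (qe-spec P (confVal p)) (proj₂ (proj₂ (proj₂ (proj₂ ok₁)))) , subst (Path (Step A) p) last (segPhase-path A refl ok₀)) ,
    proj₁ (proj₂ (proj₂ sim)) , subst (λ d → state d ≡ s) last (proj₁ (proj₂ (proj₂ ok₀))) , proj₁ (proj₂ (proj₂ (proj₂ sim))) , proj₂ (proj₂ (proj₂ (proj₂ sim)))
    where
    choice : Σ LoopChoice λ p → ⟦ loopChoiceQ σ s D t p ⟧ᵠ [ x , y ]′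
    choice = proj₁ (orF-spec finLoop [ x , y ]′ (loopChoiceQ σ s D t)) h
    Φ = loopPhases σ s (proj₁ choice)
    module C = SimulationCorrect A Φ 2 D t (stackW c) t et
    sim : Σ Cfg λ d → PhasedRun Φ (stackW c) 3 c d × (∀ z → confVal d z ≡ y z) × C.EndOK d
    sim = C.phasedQ-sound {c} {x} {y} {D} (proj₂ choice) e eα refl
    d = proj₁ sim
    run₂ = proj₁ (proj₂ sim)
    c₁ = proj₁ run₂
    ok₂ : PhaseOK (stackW c) (Φ 2) c c₁
    ok₂ = proj₁ (proj₂ run₂)
    run₁ = proj₂ (proj₂ run₂)
    p = proj₁ run₁
    ok₁ : PhaseOK (stackW c) (Φ 1) c₁ p
    ok₁ = proj₁ (proj₂ run₁)
    run₀ = proj₂ (proj₂ run₁)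
    ok₀ : PhaseOK (stackW c) (Φ 0) p (proj₁ run₀)
    ok₀ = proj₁ (proj₂ run₀)
    last : proj₁ run₀ ≡ d
    last = proj₂ (proj₂ run₀)

  Steady-shift : ∀ b {σ} (ρ : ℕ → Cfg) → Steady σ ρ → Steady σ (λ i → ρ (b + i))
  Steady-shift b {σ} ρ sd i = subst (λ z → Signs σ (confVal (ρ (b + i))) × Σ (Fin (length edges)) λ x → Move (edge A x) (ρ (b + i)) (ρ z) × Allowed segP σ (edge A x)) (sym (ℕₚ.+-suc b i)) (sd (b + i))

  segPhaseOK : ∀ {W σ} (ρ : ℕ → Cfg) → Steady σ ρ → ∀ a b (φ : QF CV) → (∀ i → Above W (ρ (a + i))) → ⟦ φ ⟧ᵠ (confVal (ρ (a + b))) →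
               Σ Flags λ f → PhaseOK W (mkPhase segP σ f (state (ρ (a + b))) φ) (ρ (a + 0)) (ρ (a + b))
  segPhaseOK {W} {σ} ρ sd a b φ ab h =
    proj₁ seg , b , PhRun-cong refl refl (proj₂ seg) , refl , (proj₁ (sd (a + 0)) , proj₁ (sd (a + b))) , h
    where
    seg : Σ Flags λ f → PhRun W (mkPhase segP σ f (state (ρ (a + b))) ttᵠ) f b (ρ (a + 0)) (ρ (a + b))
    seg = segRun {W} {σ} {state (ρ (a + b))} b (λ i → ρ (a + i)) (Steady-shift a {σ} ρ sd) (λ i _ → ab i)

  -- The lengths `a` and `b` are free, so a single visit to `P` after `i` serves all later indices
  -- of the same location. Only the stack at `i` has to be never undercut.
  loopQ-complete : ∀ σ s D t (ρ : ℕ → Cfg) → Steady σ ρ → ∀ i a b → (∀ j → i ≤ j → Above (stackW (ρ i)) (ρ j)) →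
    state (ρ i) ≡ s → α (clocks (ρ i)) ≡ D → List.head (stackW (ρ i)) ≡ t →
    state (ρ (suc i + a + b)) ≡ s → α (clocks (ρ (suc i + a + b))) ≡ D → List.head (stackW (ρ (suc i + a + b))) ≡ t →
    ρ (suc i + a) ∈ₚ P → ⟦ loopQ σ s D t ⟧ᵠ [ confVal (ρ i) , confVal (ρ (suc i + a + b)) ]′
  loopQ-complete σ s D t ρ sd i a b ab refl refl et es eα et′ hit =
    proj₂ (orF-spec finLoop [ confVal (ρ i) , confVal (ρ (suc i + a + b)) ]′ (loopChoiceQ σ s D t)) (p , C.phasedQ-complete {ρ i} {ρ (suc i + a + b)} run (eα , et′) refl)
    where
    W = stackW (ρ i)
    x₀ = proj₁ (proj₂ (sd i))
    mv = proj₁ (proj₂ (proj₂ (sd i)))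
    al = proj₂ (proj₂ (proj₂ (sd i)))
    above : ∀ c → i ≤ c → ∀ j → Above W (ρ (c + j))
    above c i≤c j = ab (c + j) (ℕₚ.≤-trans i≤c (ℕₚ.m≤m+n c j))
    seg₁ = segPhaseOK {W} {σ} ρ sd (suc i) a (qe P) (above (suc i) (ℕₚ.n≤1+n i)) (proj₂ (qe-spec P (confVal (ρ (suc i + a)))) hit)
    seg₀ = segPhaseOK {W} {σ} ρ sd (suc i + a) b ttᵠ (above (suc i + a) (ℕₚ.≤-trans (ℕₚ.n≤1+n i) (ℕₚ.m≤m+n (suc i) a))) (tt-holds {ρ = confVal (ρ (suc i + a + b))})
    f₂ = before (kind (edge A x₀)) allTrue
    p : LoopChoice
    p = (f₂ , state (ρ (suc i))) , (proj₁ seg₁ , state (ρ (suc i + a))) , proj₁ seg₀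
    module C = SimulationCorrect A (loopPhases σ s p) 2 D t W t et
    one : PhaseOK W (mkPhase oneP σ f₂ (state (ρ (suc i))) ttᵠ) (ρ i) (ρ (suc i))
    one = 1 , pedge x₀ (proj₁ ∘ al) mv (ab i ℕₚ.≤-refl) (pdone (ab (suc i) (ℕₚ.n≤1+n i))) , refl , (proj₁ (sd i) , refl) , tt-holds {ρ = confVal (ρ (suc i))}
    run : PhasedRun (loopPhases σ s p) W 3 (ρ i) (ρ (suc i + a + b))
    run = ρ (suc i) , one ,
          ρ (suc i + a) , subst (λ z → PhaseOK W (loopPhases σ s p 1) (ρ z) (ρ (suc i + a))) (ℕₚ.+-identityʳ (suc i)) (proj₂ seg₁) ,
          ρ (suc i + a + b) , subst₂ (λ z q → PhaseOK W (mkPhase segP σ (proj₁ seg₀) q ttᵠ) (ρ z) (ρ (suc i + a + b))) (ℕₚ.+-identityʳ (suc i + a)) es (proj₂ seg₀) , refl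

  -- Reachability from I, through a stack word that is first pushed.
  Prefix : Set
  Prefix = Vec PlainPhase (suc (dbl bound))

  finPrefix : Finite Prefix
  finPrefix = finite-Vec finPlain (suc (dbl bound))

  -- `I` sees only the symbol counts of the initial stack word, so the word has to be guessed: the
  -- machine starts with an empty stack, pushes the word in an `initP` phase and meets `I` at its
  -- end. The stages of this phase are placeholders, as `KindOK` and `Allowed` ignore them for
  -- `initP`.
  prefixPhases : Prefix → Fin nS → ℕ → Phase
  prefixPhases φs s n with n ℕₚ.≟ suc (dbl bound)
  ... | yes _ = mkPhase initP (replicate k (nondecr , null)) allTrue s (qe I)
  ... | no _ = plain (lookup φs (cap (dbl bound) n))

  prefix-init : ∀ φs s → prefixPhases φs s (suc (dbl bound)) ≡ mkPhase initP (replicate k (nondecr , null)) allTrue s (qe I)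
  prefix-init φs s with suc (dbl bound) ℕₚ.≟ suc (dbl bound)
  ... | yes _ = refl
  ... | no ne = ⊥-elim (ne refl)

  prefix-plain : ∀ φs s n → n < suc (dbl bound) → prefixPhases φs s n ≡ plain (lookup φs (cap (dbl bound) n))
  prefix-plain φs s n n< with n ℕₚ.≟ suc (dbl bound)
  ... | yes refl = ⊥-elim (ℕₚ.<-irrefl refl n<)
  ... | no _ = refl

  Start : Fin nS → Mat → Tuple → Set
  Start s D x = x stateV ≡ + toℕ s × (∀ i → 0ℤ ≤ᶻ x (clockV i)) × (∀ g → x (countV g) ≡ 0ℤ) × α (λ i → ∣ x (clockV i) ∣) ≡ D

  module _ {V : Set} (x : CV → Lin V) where

    clockT : Fin (suc m) → Lin V
    clockT zero = lcon 0ℤ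
    clockT (suc i) = x (clockV i)

    entryQ : ℕ → Fin (suc m) → Fin (suc m) → QF V
    entryQ e i j = and (or (eqᵠ (lcon (+ e)) (lcon 0ℤ)) (leᵠ (clockT j ⊞ lcon (+ e)) (clockT i)))
                       (or (eqᵠ (lcon (+ e)) (lcon (+ clockBound A))) (leᵠ (clockT i) (clockT j ⊞ lcon (+ e))))

    clockT-eval : ∀ ρ → (∀ i → 0ℤ ≤ᶻ ⟦ x (clockV i) ⟧ˡ ρ) → ∀ i → ⟦ clockT i ⟧ˡ ρ ≡ + clock₀ (λ i → ∣ ⟦ x (clockV i) ⟧ˡ ρ ∣) i
    clockT-eval ρ h zero = cong (+_) (sym clock₀-zero)
    clockT-eval ρ h (suc i) = trans (sym (ℤₚ.0≤i⇒+∣i∣≡i (h i))) (cong (+_) (sym (clock₀-suc i)))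

    entryQ-spec : ∀ ρ → (∀ i → 0ℤ ≤ᶻ ⟦ x (clockV i) ⟧ˡ ρ) → ∀ e → e ≤ clockBound A → ∀ i j → ⟦ entryQ e i j ⟧ᵠ ρ ⟷
      (e ≡ (clock₀ (λ i → ∣ ⟦ x (clockV i) ⟧ˡ ρ ∣) i ∸ clock₀ (λ i → ∣ ⟦ x (clockV i) ⟧ˡ ρ ∣) j) ⊓ clockBound A)
    entryQ-spec ρ h e e≤ i j = ⟷-trans
      (×-⟷ (⊎-⟷ (⟷-trans (eq-spec ρ (lcon (+ e)) (lcon 0ℤ)) (ℤₚ.+-injective , cong (+_)))
                 (⟷-trans (le-spec ρ (clockT j ⊞ lcon (+ e)) (clockT i)) (⟷-trans (≡⇒⟷ (cong₂ _≤ᶻ_ sum (clockT-eval ρ h i))) (ℤₚ.drop‿+≤+ , +≤+))))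
            (⊎-⟷ (⟷-trans (eq-spec ρ (lcon (+ e)) (lcon (+ clockBound A))) (ℤₚ.+-injective , cong (+_)))
                 (⟷-trans (le-spec ρ (clockT i) (clockT j ⊞ lcon (+ e))) (⟷-trans (≡⇒⟷ (cong₂ _≤ᶻ_ (clockT-eval ρ h i) sum)) (ℤₚ.drop‿+≤+ , +≤+)))))
      (capped-difference (c i) (c j) e (clockBound A) e≤)
      where
      c = clock₀ (λ i → ∣ ⟦ x (clockV i) ⟧ˡ ρ ∣)
      sum : ⟦ clockT j ⊞ lcon (+ e) ⟧ˡ ρ ≡ + (c j + e)
      sum = trans (cong (_+ᶻ + e) (clockT-eval ρ h j)) (sym (ℤₚ.pos-+ (c j) e))

    clockQ : Fin m → QF V
    clockQ i = leᵠ (lcon 0ℤ) (x (clockV i))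

    emptyQ : Fin l → QF V
    emptyQ g = eqᵠ (x (countV g)) (lcon 0ℤ)

    matQ : Mat → Fin (suc m) → Fin (suc m) → QF V
    matQ D i j = entryQ (entry D i j) i j

    rowQ : Mat → Fin (suc m) → QF V
    rowQ D i = andFin (suc m) (matQ D i)

    startQ : Fin nS → Mat → QF V
    startQ s D = and (eqᵠ (x stateV) (lcon (+ toℕ s))) (and (andFin m clockQ) (and (andFin l emptyQ) (andFin (suc m) (rowQ D))))

    startQ-spec : ∀ ρ s D → ⟦ startQ s D ⟧ᵠ ρ ⟷ Start s D (evalAll ρ x)
    startQ-spec ρ s D =
      (λ (a , b , c , d) →
         proj₁ (eq-spec ρ (x stateV) (lcon (+ toℕ s))) a , clocks≥0 b , (λ g → proj₁ (eq-spec ρ (x (countV g)) (lcon 0ℤ)) (proj₁ (andFin-spec ρ l emptyQ) c g)) ,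
         proj₁ (α-char clk D) (λ i j → proj₁ (entryQ-spec ρ (clocks≥0 b) (entry D i j) (entry≤ D i j) i j) (proj₁ (andFin-spec ρ (suc m) (matQ D i)) (proj₁ (andFin-spec ρ (suc m) (rowQ D)) d i) j))) ,
      (λ (a , b , c , d) →
         proj₂ (eq-spec ρ (x stateV) (lcon (+ toℕ s))) a , proj₂ (andFin-spec ρ m clockQ) (λ i → proj₂ (le-spec ρ (lcon 0ℤ) (x (clockV i))) (b i)) ,
         proj₂ (andFin-spec ρ l emptyQ) (λ g → proj₂ (eq-spec ρ (x (countV g)) (lcon 0ℤ)) (c g)) ,
         proj₂ (andFin-spec ρ (suc m) (rowQ D)) (λ i → proj₂ (andFin-spec ρ (suc m) (matQ D i)) (λ j → proj₂ (entryQ-spec ρ b (entry D i j) (entry≤ D i j) i j) (proj₂ (α-char clk D) d i j))))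
      where
      clk : Clocks m
      clk i = ∣ ⟦ x (clockV i) ⟧ˡ ρ ∣
      clocks≥0 : ⟦ andFin m clockQ ⟧ᵠ ρ → ∀ i → 0ℤ ≤ᶻ ⟦ x (clockV i) ⟧ˡ ρ
      clocks≥0 b i = proj₁ (le-spec ρ (lcon 0ℤ) (x (clockV i))) (proj₁ (andFin-spec ρ m clockQ) b i)

  PrefixChoice : Set
  PrefixChoice = Prefix × Fin nS × Mat

  finPrefixChoice : Finite PrefixChoice
  finPrefixChoice = finite-× finPrefix (finite-× (finite-Fin nS) finMat)

  -- In the body of preQ the variables inj₁ belong to the end of the run and inj₂ to its start.
  swapT : CV ⊎ CV → Lin (CV ⊎ CV)
  swapT (inj₁ z) = lvar (inj₂ z)
  swapT (inj₂ z) = lvar (inj₁ z)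

  prefixQ : Mat → Top → PrefixChoice → QF (CV ⊎ CV)
  prefixQ D t (φs , s₀ , D₀) = and (startQ (λ z → lvar (inj₂ z)) s₀ D₀)
    (sub swapT (Simulation.phasedQ (prefixPhases φs s₀) (suc (dbl bound)) D t nothing s₀ D₀))

  preQ : Fin nS → Mat → Top → QF CV
  preQ s D t = and (eqᵠ (lvar stateV) (lcon (+ toℕ s))) (orF finPrefixChoice λ p → exF finCV (prefixQ D t p))

  Pre : Fin nS → Mat → Top → Tuple → Set
  Pre s D t y = y stateV ≡ + toℕ s × Σ PrefixChoice λ (φs , s₀ , D₀) → Σ Tuple λ x → Start s₀ D₀ x ×
    ⟦ Simulation.phasedQ (prefixPhases φs s₀) (suc (dbl bound)) D t nothing s₀ D₀ ⟧ᵠ [ x , y ]′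

  preQ-spec : ∀ s D t y → ⟦ preQ s D t ⟧ᵠ y ⟷ Pre s D t y
  preQ-spec s D t y = ×-⟷ (eq-spec y (lvar stateV) (lcon (+ toℕ s))) (⟷-trans (orF-spec finPrefixChoice y (λ p → exF finCV (prefixQ D t p)))
    ((λ (p , h) → p , proj₁ (inner p) (proj₁ (exF-spec finCV y (prefixQ D t p)) h)) , λ (p , h) → p , proj₂ (exF-spec finCV y (prefixQ D t p)) (proj₂ (inner p) h)))
    where
    inner : ∀ p → (Σ Tuple λ x → ⟦ prefixQ D t p ⟧ᵠ [ y , x ]′) ⟷ (Σ Tuple λ x → Start (proj₁ (proj₂ p)) (proj₂ (proj₂ p)) x ×
      ⟦ Simulation.phasedQ (prefixPhases (proj₁ p) (proj₁ (proj₂ p))) (suc (dbl bound)) D t nothing (proj₁ (proj₂ p)) (proj₂ (proj₂ p)) ⟧ᵠ [ x , y ]′)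
    inner (φs , s₀ , D₀) =
      (λ (x , a , b) → x , proj₁ (startQ-spec (λ z → lvar (inj₂ z)) [ y , x ]′ s₀ D₀) a , proj₁ (swap x) b) ,
      (λ (x , a , b) → x , proj₂ (startQ-spec (λ z → lvar (inj₂ z)) [ y , x ]′ s₀ D₀) a , proj₂ (swap x) b)
      where
      φ = Simulation.phasedQ (prefixPhases φs s₀) (suc (dbl bound)) D t nothing s₀ D₀
      swap : ∀ x → ⟦ sub swapT φ ⟧ᵠ [ y , x ]′ ⟷ ⟦ φ ⟧ᵠ [ x , y ]′
      swap x = sub-eval swapT [ y , x ]′ [ x , y ]′ (λ { (inj₁ z) → refl ; (inj₂ z) → refl }) φ

  plainPath : ∀ {Φ W} n {c d} → (∀ i → i < n → Σ PlainPhase λ p → Φ i ≡ plain p) → PhasedRun Φ W n c d → Path (Step A) c d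
  plainPath zero h refl = halt
  plainPath {Φ} {W} (suc n) {c} h (c′ , ok , run) with h n ℕₚ.≤-refl
  ... | (true , ph) , e = segPhase-path A refl (subst (λ p → PhaseOK W p c c′) e ok) ◅◅ plainPath n (λ i i< → h i (ℕₚ.m≤n⇒m≤1+n i<)) run
  ... | (false , ph) , e = onePhase-step A refl (subst (λ p → PhaseOK W p c c′) e ok) ◅ plainPath n (λ i i< → h i (ℕₚ.m≤n⇒m≤1+n i<)) run

  Reached : Fin nS → Mat → Top → Tuple → Set
  Reached s D t y = Σ Cfg λ c → Σ Cfg λ d → c ∈ₚ I × Path (Step A) c d × Located s D t y d

  pre-sound : ∀ s D t y → Pre s D t y → Reached s D t y
  pre-sound s D t y (ey , (φs , s₀ , D₀) , x , (es , nonneg , emp , eα) , h) =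
    c′ , d , proj₁ (qe-spec I (confVal c′)) (proj₂ (proj₂ (proj₂ (proj₂ okI)))) ,
    plainPath (suc (dbl bound)) (λ i i< → _ , prefix-plain φs s₀ i i<) (proj₂ (proj₂ (proj₁ (proj₂ sim)))) ,
    ed , Finₚ.toℕ-injective (ℤₚ.+-injective (trans (ed stateV) ey)) , proj₂ (proj₂ (proj₂ sim))
    where
    c : Cfg
    c = conf s₀ (λ i → ∣ x (clockV i) ∣) (λ j → x (ctrV j)) []
    same : ∀ z → confVal c z ≡ x z
    same stateV = sym es
    same (clockV i) = ℤₚ.0≤i⇒+∣i∣≡i (nonneg i)
    same (ctrV j) = refl
    same (countV g) = sym (emp g)
    Φ = prefixPhases φs s₀
    module C = SimulationCorrect A Φ (suc (dbl bound)) D t [] nothing refl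
    sim : Σ Cfg λ d → PhasedRun Φ [] (suc (suc (dbl bound))) c d × (∀ z → confVal d z ≡ y z) × C.EndOK d
    sim = C.phasedQ-sound {c} {x} {y} {D₀} h same eα refl
    d = proj₁ sim
    ed = proj₁ (proj₂ (proj₂ sim))
    c′ = proj₁ (proj₁ (proj₂ sim))
    okI : PhaseOK [] (mkPhase initP (replicate k (nondecr , null)) allTrue s₀ (qe I)) c c′
    okI = subst (λ p → PhaseOK [] p c c′) (prefix-init φs s₀) (proj₁ (proj₂ (proj₁ (proj₂ sim))))

  above-[] : ∀ (c : Cfg) → Above [] c
  above-[] c = stackW c , sym (Listₚ.++-identityʳ (stackW c))

  pushAll : ∀ {ph} → pkind ph ≡ initP → ∀ ys s clk ctr u → PhRun [] ph allTrue 0 (conf s clk ctr u) (conf s clk ctr (ys ʳ++ u))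
  pushAll e [] s clk ctr u = pdone (above-[] (conf s clk ctr u))
  pushAll e (g ∷ ys) s clk ctr u = pinit e g (above-[] (conf s clk ctr u)) (pushAll e ys s clk ctr (g ∷ u))

  pre-complete : ∀ (ρ : ℕ → Cfg) n → (∀ i → i < n → Step A (ρ i) (ρ (suc i))) → ρ 0 ∈ₚ I →
    Pre (state (ρ n)) (α (clocks (ρ n))) (List.head (stackW (ρ n))) (confVal (ρ n))
  pre-complete ρ n st inI = refl , (φs , s₀ , α (clocks c)) , confVal c ,
    (refl , (λ i → +≤+ z≤n) , (λ g → refl) , refl) , C.phasedQ-complete {c} {ρ n} run (refl , refl) refl
    where
    s₀ = state (ρ 0)
    c : Cfg
    c = conf s₀ (clocks (ρ 0)) (counters (ρ 0)) []
    parts : Σ (ℕ → PlainPhase) λ Φ → PhasedRun (plain ∘ Φ) [] (suc (dbl bound)) (ρ 0) (ρ n)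
    parts = join {[]} {stageOf (λ _ → nondecr) (ρ 0)} {bound} (decompose n ρ (λ _ → nondecr) bound st (λ i _ → above-[] (ρ i)) (energy-bound ρ n st))
    φs : Prefix
    φs = tabulate (λ i → proj₁ parts (toℕ i))
    agree : ∀ i → i < suc (dbl bound) → plain (proj₁ parts i) ≡ prefixPhases φs s₀ i
    agree i i< = sym (trans (prefix-plain φs s₀ i i<) (cong plain (trans (Vecₚ.lookup∘tabulate (λ i → proj₁ parts (toℕ i)) (cap (dbl bound) i))
      (cong (proj₁ parts) (trans (toℕ-cap (dbl bound) i) (ℕₚ.m≤n⇒m⊓n≡m (ℕₚ.≤-pred i<)))))))
    ini : Phase
    ini = mkPhase initP (replicate k (nondecr , null)) allTrue s₀ (qe I)
    pushes : PhRun [] ini allTrue 0 c (ρ 0)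
    -- The head of a stack word is its top, so the word is pushed in reverse, bottom symbol first.
    pushes = subst (λ w → PhRun [] ini allTrue 0 c (conf s₀ (clocks (ρ 0)) (counters (ρ 0)) w)) (Listₚ.reverse-involutive (stackW (ρ 0)))
      (pushAll refl (List.reverse (stackW (ρ 0))) s₀ (clocks (ρ 0)) (counters (ρ 0)) [])
    module C = SimulationCorrect A (prefixPhases φs s₀) (suc (dbl bound)) (α (clocks (ρ n))) (List.head (stackW (ρ n))) [] nothing refl
    run : PhasedRun (prefixPhases φs s₀) [] (suc (suc (dbl bound))) c (ρ n)
    run = ρ 0 , subst (λ p → PhaseOK [] p c (ρ 0)) (sym (prefix-init φs s₀)) (0 , pushes , refl , tt , proj₂ (qe-spec I (confVal (ρ 0))) inI) ,
          PhasedRun-cong (suc (dbl bound)) agree (proj₂ parts)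

suffix-step : ∀ {l} o (U W w : List (Fin l)) → StackRel o (U ++ W) w → (Σ (List (Fin l)) λ U′ → w ≡ U′ ++ W) ⊎ length w < length W
suffix-step nop U W w e = inj₁ (U , e)
suffix-step (push a) U W w e = inj₁ (a ∷ U , e)
suffix-step pop [] .(a ∷ w) w (a , refl) = inj₂ ℕₚ.≤-refl
suffix-step pop (g ∷ U) W w (a , e) = inj₁ (U , sym (Listₚ.∷-injectiveʳ e))
suffix-step (topIs a) U W w (_ , e) = inj₁ (U , e)
suffix-step topIsBot U W w (_ , e) = inj₁ (U , e)

-- The decision procedure

module Decision {nS m k l : ℕ} (A : Automaton nS m k l) (r : ℕ) (rb : ReversalBounded r A) (I P : PresburgerSet m k l) where

  open Phased A
  open Decomposition A
  open Liveness A r rb I P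
  open Limits {CV}

  Location : Set
  Location = Fin nS × Mat × Top

  finLocation : Finite Location
  finLocation = finite-× (finite-Fin nS) (finite-× finMat (finite-Maybe (finite-Fin l)))

  abstract
    pairQ : Vec Stage k → Location → QF (CV ⊎ CV)
    pairQ σ (s , D , t) = and (loopQ σ s D t) (sub (λ z → lvar (inj₁ z)) (preQ s D t))

    pairQ-spec : ∀ σ s D t x y → ⟦ pairQ σ (s , D , t) ⟧ᵠ [ x , y ]′ ⟷ (⟦ loopQ σ s D t ⟧ᵠ [ x , y ]′ × Pre s D t x)
    pairQ-spec σ s D t x y = ×-⟷ ⟷-refl (⟷-trans (sub-eval (λ z → lvar (inj₁ z)) [ x , y ]′ x (λ _ → refl) (preQ s D t)) (preQ-spec s D t x))

  sentence : Vec Stage k × Location → QF ⊥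
  sentence (σ , θ) = exF (finite-⊎ finCV finCV) (sub (λ z → lvar (inj₂ z)) (Lim (pairQ σ θ)))

  Limiting : Vec Stage k × Location → Set
  Limiting (σ , θ) = Σ Tuple λ x → Σ Tuple λ d → ⟦ Lim (pairQ σ θ) ⟧ᵠ [ x , d ]′

  sentence-spec : ∀ p → ⟦ sentence p ⟧ᵠ (λ ()) ⟷ Limiting p
  sentence-spec (σ , θ) = ⟷-trans (exF-spec (finite-⊎ finCV finCV) (λ ()) (sub (λ z → lvar (inj₂ z)) φ))
    ((λ (f , h) → f ∘ inj₁ , f ∘ inj₂ , proj₁ (sub-eval (λ z → lvar (inj₂ z)) [ (λ ()) , f ]′ [ f ∘ inj₁ , f ∘ inj₂ ]′ (λ { (inj₁ z) → refl ; (inj₂ z) → refl }) φ) h) ,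
     (λ (x , d , h) → [ x , d ]′ , proj₂ (sub-eval (λ z → lvar (inj₂ z)) [ (λ ()) , [ x , d ]′ ]′ [ x , d ]′ (λ _ → refl) φ) h))
    where
    φ = Lim (pairQ σ θ)

  -- Concatenation of infinitely many loops

  module Glue (g : ℕ → Cfg) (loop : ∀ i → Loop (g i) (g (suc i))) where

    -- The execution is the iteration of `next` on a configuration with a finite path still to be
    -- followed. When the path is used up, the first step of the next loop is taken at once, so
    -- every iteration is a step.
    record Point : Set where
      constructor point
      field
        cfg  : Cfg
        goal : ℕ
        path : Path (Step A) cfg (g goal)

    open Point

    next : Point → Point
    next (point c i (_◅_ {j = c₁} s π)) = point c₁ i π
    next (point c i halt) with loop i
    ... | c₁ , p , st , π , _ , π′ = point c₁ (suc i) (π ◅◅ π′)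

    next-step : ∀ q → Step A (cfg q) (cfg (next q))
    next-step (point c i (s ◅ π)) = s
    next-step (point c i halt) with loop i
    ... | c₁ , p , st , π , _ , π′ = st

    iter : ℕ → Point → Point
    iter zero q = q
    iter (suc n) q = iter n (next q)

    iter-step : ∀ n q → Step A (cfg (iter n q)) (cfg (iter (suc n) q))
    iter-step zero q = next-step q
    iter-step (suc n) q = iter-step n (next q)

    along : ∀ {c p i} (π : Path (Step A) c p) (π′ : Path (Step A) p (g i)) → Σ ℕ λ j → cfg (iter j (point c i (π ◅◅ π′))) ≡ p
    along halt π′ = 0 , refl
    along (s ◅ π) π′ with along π π′
    ... | j , e = suc j , e

    hit : ∀ {c} i (π : Path (Step A) c (g i)) → Σ ℕ λ j → cfg (iter j (point c i π)) ∈ₚ P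
    hit i (s ◅ π) with hit i π
    ... | j , h = suc j , h
    hit i halt = suc (proj₁ at) , subst (_∈ₚ P) (sym (proj₂ at)) (proj₁ (proj₂ (proj₂ (proj₂ (proj₂ (loop i))))))
      where
      at : Σ ℕ λ j → cfg (iter j (next (point (g i) i halt))) ≡ proj₁ (proj₂ (loop i))
      at = along (proj₁ (proj₂ (proj₂ (proj₂ (loop i))))) (proj₂ (proj₂ (proj₂ (proj₂ (proj₂ (loop i))))))

    hits : ∀ N q → Σ ℕ λ j → N ≤ j × cfg (iter j q) ∈ₚ P
    hits zero q with hit (goal q) (path q)
    ... | j , h = j , z≤n , h
    hits (suc N) q with hits N (next q)
    ... | j , N≤j , h = suc j , s≤s N≤j , h

  module Build (σ : Vec Stage k) (s : Fin nS) (D : Mat) (t : Top) (x d : Tuple) (lim : ⟦ Lim (pairQ σ (s , D , t)) ⟧ᵠ [ x , d ]′) where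

    open Progression x d (pred-period (pairQ σ (s , D , t)))

    settled : Settles λ n n′ → ⟦ Lim (pairQ σ (s , D , t)) ⟧ᵠ [ x , d ]′ ⟷ ⟦ pairQ σ (s , D , t) ⟧ᵠ [ term n , term n′ ]′
    settled = Lim-settles (pairQ σ (s , D , t)) (Per-period (pairQ σ (s , D , t)))

    n₀ : ℕ
    n₀ = proj₁ settled

    -- Each position exceeds the threshold that belongs to its predecessor, which makes consecutive
    -- tuples satisfy the formula, and it stays beyond `n₀`, which provides the threshold for its
    -- successor.
    position : ℕ → Σ ℕ λ n → n₀ ≤ n
    position zero = n₀ , ℕₚ.≤-refl
    position (suc i) = proj₁ (proj₂ settled (proj₁ (position i)) (proj₂ (position i))) ⊔ n₀ , ℕₚ.m≤n⊔m (proj₁ (proj₂ settled (proj₁ (position i)) (proj₂ (position i)))) n₀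

    tuple : ℕ → Tuple
    tuple i = term (proj₁ (position i))

    pair : ∀ i → ⟦ loopQ σ s D t ⟧ᵠ [ tuple i , tuple (suc i) ]′ × Pre s D t (tuple i)
    pair i = proj₁ (pairQ-spec σ s D t (tuple i) (tuple (suc i))) (proj₁ (proj₂ h (proj₁ (position (suc i))) (ℕₚ.m≤m⊔n (proj₁ h) n₀)) lim)
      where
      h = proj₂ settled (proj₁ (position i)) (proj₂ (position i))

    reached : Reached s D t (tuple 0)
    reached = pre-sound s D t (tuple 0) (proj₂ (pair 0))

    node : ∀ i → Σ Cfg (Located s D t (tuple i))
    following : ∀ i → Σ Cfg λ d → Loop (proj₁ (node i)) d × Located s D t (tuple (suc i)) d
    node zero = proj₁ (proj₂ reached) , proj₂ (proj₂ (proj₂ (proj₂ reached)))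
    node (suc i) = proj₁ (following i) , proj₂ (proj₂ (following i))
    following i = loopQ-sound σ s D t (tuple i) (tuple (suc i)) (proj₁ (node i)) (proj₁ (pair i)) (proj₂ (node i))

    open Glue (λ i → proj₁ (node i)) (λ i → proj₁ (proj₂ (following i)))

    origin : Point
    origin = point (proj₁ reached) 0 (proj₁ (proj₂ (proj₂ (proj₂ reached))))

    live : PresburgerLive A I P
    live = (λ n → Point.cfg (iter n origin)) , (λ n → iter-step n origin) , proj₁ (proj₂ (proj₂ reached)) , λ N → hits N origin

  -- From `n` on, an index of least stack height has a stack that is never undercut. Well-founded
  -- induction on the height replaces the choice of such an index: a step that undercuts the stack
  -- leads to a smaller height.
  minimal-infinite : ∀ (ρ : ℕ → Cfg) → (∀ i → Σ (StackOp l) λ o → StackRel o (stackW (ρ i)) (stackW (ρ (suc i)))) →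
                     Infinite (λ i → ∀ j → i ≤ j → Above (stackW (ρ i)) (ρ j))
  minimal-infinite ρ st n none = <-rec (λ h → ∀ i → n ≤ i → length (stackW (ρ i)) ≡ h → ⊥) lowest _ n ℕₚ.≤-refl refl
    where
    lowest : ∀ h → (∀ {h′} → h′ < h → ∀ i → n ≤ i → length (stackW (ρ i)) ≡ h′ → ⊥) → ∀ i → n ≤ i → length (stackW (ρ i)) ≡ h → ⊥
    lowest h ih i n≤i refl = none i n≤i λ j i≤j → let o , e = ℕₚ.m≤n⇒∃[o]m+o≡n i≤j in subst (λ j → Above (stackW (ρ i)) (ρ j)) e (climb o)
      where
      climb : ∀ o → Above (stackW (ρ i)) (ρ (i + o))
      climb zero = [] , cong (λ j → stackW (ρ j)) (ℕₚ.+-identityʳ i)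
      climb (suc o) = subst (λ j → Above (stackW (ρ i)) (ρ j)) (sym (ℕₚ.+-suc i o)) (further (climb o) (st (i + o)))
        where
        further : Above (stackW (ρ i)) (ρ (i + o)) → (Σ (StackOp l) λ op → StackRel op (stackW (ρ (i + o))) (stackW (ρ (suc (i + o))))) → Above (stackW (ρ i)) (ρ (suc (i + o)))
        further (U , e) (op , rel) = [ id , (λ lower → ⊥-elim (ih lower (suc (i + o)) (ℕₚ.≤-trans n≤i (ℕₚ.≤-trans (ℕₚ.m≤m+n i o) (ℕₚ.n≤1+n _))) refl)) ]′
          (suffix-step op U (stackW (ρ i)) (stackW (ρ (suc (i + o)))) (subst (λ w → StackRel op w (stackW (ρ (suc (i + o))))) e rel))

  locate : Cfg → Location
  locate c = state c , α (clocks c) , List.head (stackW c)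

  module Refute (e : ℕ → Cfg) (ex : InfiniteExecution A e) (e∈I : e 0 ∈ₚ I) (inf-P : ∀ N → Σ ℕ λ j → N ≤ j × e j ∈ₚ P)
                (none : ∀ p → ¬ Limiting p) (N : ℕ) (σ : Vec Stage k) (sd : Steady σ (λ i → e (N + i))) where

    ρ : ℕ → Cfg
    ρ i = e (N + i)

    Minimal : Subset
    Minimal i = ∀ j → i ≤ j → Above (stackW (ρ i)) (ρ j)

    minimal : Infinite Minimal
    minimal = minimal-infinite ρ λ i → stack (edge A (proj₁ (proj₂ (sd i)))) , proj₂ (proj₂ (proj₂ (proj₂ (proj₁ (proj₂ (proj₂ (sd i)))))))

    pre-holds : ∀ i s D t → locate (ρ i) ≡ (s , D , t) → Pre s D t (confVal (ρ i))
    pre-holds i s D t eqn = subst (λ θ → Pre (proj₁ θ) (proj₁ (proj₂ θ)) (proj₂ (proj₂ θ)) (confVal (ρ i))) eqn (pre-complete e (N + i) (λ j _ → ex j) e∈I)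

    pairs : ∀ s D t i → Minimal i → locate (ρ i) ≡ (s , D , t) → ∀ a → ρ (suc i + a) ∈ₚ P → ∀ j → suc i + a ≤ j → locate (ρ j) ≡ (s , D , t) →
            ⟦ pairQ σ (s , D , t) ⟧ᵠ [ confVal (ρ i) , confVal (ρ j) ]′
    pairs s D t i mi ei a inP j le′ ej = proj₂ (pairQ-spec σ s D t (confVal (ρ i)) (confVal (ρ j))) (loop , pre-holds i s D t ei)
      where
      split = ℕₚ.m≤n⇒∃[o]m+o≡n le′
      b = proj₁ split
      ej′ : locate (ρ (suc i + a + b)) ≡ (s , D , t)
      ej′ = subst (λ j → locate (ρ j) ≡ (s , D , t)) (sym (proj₂ split)) ej
      loop : ⟦ loopQ σ s D t ⟧ᵠ [ confVal (ρ i) , confVal (ρ j) ]′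
      loop = subst (λ j → ⟦ loopQ σ s D t ⟧ᵠ [ confVal (ρ i) , confVal (ρ j) ]′) (proj₂ split)
        (loopQ-complete σ s D t ρ sd i a b mi (cong proj₁ ei) (cong (proj₁ ∘ proj₂) ei) (cong (proj₂ ∘ proj₂) ei)
          (cong proj₁ ej′) (cong (proj₁ ∘ proj₂) ej′) (cong (proj₂ ∘ proj₂) ej′) inP)

    impossible : ⊥
    impossible = pigeonhole-finite finLocation (locate ∘ ρ) Minimal minimal λ (s , D , t) inf →
      LimitPairs.limit-pair (confVal ∘ ρ) (pairQ σ (s , D , t)) (λ i → Minimal i × locate (ρ i) ≡ (s , D , t)) inf
        (λ i (mi , ei) found → let j₀ , le′ , inP = inf-P (N + suc i)
                                   a , ea = ℕₚ.m≤n⇒∃[o]m+o≡n le′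
                               in found (suc i + a , λ j le″ (_ , ej) → pairs s D t i mi ei a (subst (λ z → e z ∈ₚ P) (trans (sym ea) (ℕₚ.+-assoc N (suc i) a)) inP) j le″ ej))
        (λ y d h → none (σ , s , D , t) (y , d , h))

  -- The goal is ⊥, so the doubly negated result of `eventually-steady` can be used directly.
  refute : (∀ p → ¬ Limiting p) → ¬ PresburgerLive A I P
  refute none (e , ex , e∈I , inf-P) = eventually-steady bound (λ _ → nondecr) e ex (λ n → energy-bound e n (λ i _ → ex i))
    λ (N , σ , sd) → Refute.impossible e ex e∈I inf-P none N σ sd

  decide : Dec (PresburgerLive A I P)
  decide with any-finite {P = Limiting} (finite-× (finite-Vec finite-Stage k) finLocation) (λ p → map′ (proj₁ (sentence-spec p)) (proj₂ (sentence-spec p)) (dec-QF (sentence p) (λ ())))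
  ... | yes ((σ , s , D , t) , x , d , lim) = yes (Build.live σ s D t x d lim)
  ... | no none = no (refute λ p q → none (p , q))

theorem7 : ∀ {nS m k l : ℕ} (A : Automaton nS m k l) (r : ℕ) →
    ReversalBounded r A →
    (I P : PresburgerSet m k l) →
    Dec (PresburgerLive A I P)
theorem7 A r rb I P = Decision.decide A r rb I P
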